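{- Let $\mathbf{A}=(A;\Gamma)$ be a finite relational structure. Then the following dichotomy holds. (1) If $\mathbf{A}$ has a majority polymorphism and a Maltsev polymorphism, then the assignment testing problem for $\mathrm{CSP}(\mathbf{A})$ is constant-query testable with one-sided error. (2) Otherwise, testing $\mathrm{CSP}(\mathbf{A})$ requires a super-constant number of queries, i.e. $\mathrm{CSP}(\mathbf{A})$ is not constant-query testable (even with two-sided error).
   Context: A finite relational structure $\mathbf{A}=(A;\Gamma)$ consists of a finite nonempty set $A$ and a finite set $\Gamma$ of finitary relations on $A$. An instance of $\mathrm{CSP}(\mathbf{A})$ is a triple $\mathcal{I}=(V,\mathcal{C},w)$ with: - $V$ a finite set of variables; - $\mathcal{C}$ a set of constraints $\langle (x_1,\dots,x_k),R\rangle$, where $x_i\in V$ and $R\in\Gamma$ is $k$-ary; - $w:V\to[0,1]$ a weight function with $\sum_{x\in V}w(x)=1$. An assignment $f:V\to A$ is satisfying if $(f(x_1),\dots,f(x_k))\in R$ for every constraint. For assignments $f,g$ set $\mathrm{dist}(f,g)=\sum_{x:f(x)\neq g(x)}w(x)$. The assignment $f$ is $\epsilon$-far from satisfying $\mathcal{I}$ if $\mathrm{dist}(f,g)>\epsilon$ for every satisfying assignment $g$. In the assignment testing problem the input is $(\mathcal{I},\epsilon,f)$, where $\mathcal{I}$ is assumed satisfiable. The tester has full access to $\mathcal{I}$ and $\epsilon$, and query access to $f$: querying $x$ returns $f(x)$. A tester must accept with probability at least $2/3$ if $f$ satisfies $\mathcal{I}$, and reject with probability at least $2/3$ if $f$ is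 $\epsilon$-far from satisfying $\mathcal{I}$. It has one-sided error if it always accepts satisfying assignments. Its query complexity is the number of queries to $f$. The problem is constant-query testable if for every $\epsilon\in(0,1)$ there is a tester whose query complexity is bounded by a function of $\epsilon$ alone, independent of the number $n=|V|$ of variables. An operation $g:A^k\to A$ is a polymorphism of $\mathbf{A}$ if for every relation $R\in\Gamma$ (say $r$-ary) and all tuples $t^1,\dots,t^k\in R$, the tuple obtained by applying $g$ coordinatewise, $(g(t^1_1,\dots,t^k_1),\dots,g(t^1_r,\dots,t^k_r))$, lies in $R$. A majority operation is a ternary $m$ with $m(b,a,a)=m(a,b,a)=m(a,a,b)=a$ for all $a,b$. A Maltsev operation is a ternary $p$ with $p(b,a,a)=p(a,a,b)=b$ for all $a,b$.
   Formalization: The weights w(x) and the parameter ε are rational instead of real, and a tester's random choice is uniform over a finite list of deterministic adaptive query strategies, so its probabilities are rational. -}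

module Defs where

open import Data.Nat as ℕ using (ℕ; zero; suc)
open import Data.Fin using (Fin; zero; suc; _≟_)
open import Data.Bool using (Bool; true; false; if_then_else_)
open import Data.List using (List; []; _∷_; length)
open import Data.List.Membership.Propositional using (_∈_)
open import Data.List.Relation.Unary.All using (All)
open import Data.Vec using (Vec; lookup; tabulate; map)
open import Data.Rational as ℚ using (ℚ; 0ℚ; 1ℚ)
open import Data.Product using (Σ; ∃; ∃-syntax; _×_; _,_)
open import Relation.Nullary using (¬_; does)
open import Relation.Binary.PropositionalEquality using (_≡_)

record Rel (A : Set) : Set where
  field
    arity : ℕ
    holds : Vec A arity → Bool
open Rel public

-- A finite relational structure (A; Γ) with A = Fin (suc size)
-- (finite and nonempty) and Γ a finite list of relations.
record Structure : Set where
  field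
    size : ℕ
    Γ    : List (Rel (Fin (suc size)))
open Structure public

Dom : Structure → Set
Dom S = Fin (suc (size S))

IsPolymorphism₃ : (S : Structure) → (Dom S → Dom S → Dom S → Dom S) → Set
IsPolymorphism₃ S g =
  ∀ {R} → R ∈ Γ S →
  (t₁ t₂ t₃ : Vec (Dom S) (arity R)) →
  holds R t₁ ≡ true → holds R t₂ ≡ true → holds R t₃ ≡ true →
  holds R (tabulate (λ i → g (lookup t₁ i) (lookup t₂ i) (lookup t₃ i))) ≡ true

IsMajority : {A : Set} → (A → A → A → A) → Set
IsMajority {A} m = ∀ (a b : A) → (m b a a ≡ a) × (m a b a ≡ a) × (m a a b ≡ a)

IsMaltsev : {A : Set} → (A → A → A → A) → Set
IsMaltsev {A} p = ∀ (a b : A) → (p b a a ≡ b) × (p a a b ≡ b)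

HasMajorityPolymorphism : Structure → Set
HasMajorityPolymorphism S =
  Σ (Dom S → Dom S → Dom S → Dom S) λ m → IsPolymorphism₃ S m × IsMajority m

HasMaltsevPolymorphism : Structure → Set
HasMaltsevPolymorphism S =
  Σ (Dom S → Dom S → Dom S → Dom S) λ p → IsPolymorphism₃ S p × IsMaltsev p

sumFin : (n : ℕ) → (Fin n → ℚ) → ℚ
sumFin zero    f = 0ℚ
sumFin (suc n) f = f zero ℚ.+ sumFin n (λ i → f (suc i))

record Constraint (S : Structure) (n : ℕ) : Set where
  field
    rel   : Rel (Dom S)
    rel∈Γ : rel ∈ Γ S
    scope : Vec (Fin n) (arity rel)
open Constraint public

record Instance (S : Structure) (n : ℕ) : Set where
  field
    constraints : List (Constraint S n)
    weight      : Fin n → ℚ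
    weight-≥0   : ∀ x → 0ℚ ℚ.≤ weight x
    weight-≤1   : ∀ x → weight x ℚ.≤ 1ℚ
    weight-sum  : sumFin n weight ≡ 1ℚ
open Instance public

Assignment : (S : Structure) → ℕ → Set
Assignment S n = Fin n → Dom S

Satisfies : ∀ {S n} → Instance S n → Assignment S n → Set
Satisfies I f = All (λ c → holds (rel c) (map f (scope c)) ≡ true) (constraints I)

Satisfiable : ∀ {S n} → Instance S n → Set
Satisfiable I = ∃[ g ] Satisfies I g

dist : ∀ {S n} → Instance S n → Assignment S n → Assignment S n → ℚ
dist {n = n} I f g = sumFin n (λ x → if does (f x ≟ g x) then 0ℚ else weight I x)

Far : ∀ {S n} → Instance S n → ℚ → Assignment S n → Set
Far I ε f = ∀ g → Satisfies I g → ε ℚ.< dist I f g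

-- Testers: adaptive query strategies (decision trees) and randomised
-- testers as uniform distributions over a finite nonempty list of them
-- (i.e. the random coins select a deterministic strategy).

data Tree (A : Set) (n : ℕ) : Set where
  leaf  : Bool → Tree A n                     -- true = accept
  query : Fin n → (A → Tree A n) → Tree A n

run : ∀ {A n} → Tree A n → (Fin n → A) → Bool
run (leaf b)    f = b
run (query x k) f = run (k (f x)) f

data AtMostQueries {A : Set} {n : ℕ} : ℕ → Tree A n → Set where
  leaf  : ∀ {q b} → AtMostQueries q (leaf b)
  query : ∀ {q x k} → (∀ a → AtMostQueries q (k a)) →
          AtMostQueries (suc q) (query x k)

acceptCount : ∀ {A n} → List (Tree A n) → (Fin n → A) → ℕ
acceptCount []       f = 0
acceptCount (t ∷ ts) f = (if run t f then 1 else 0) ℕ.+ acceptCount ts f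

rejectCount : ∀ {A n} → List (Tree A n) → (Fin n → A) → ℕ
rejectCount []       f = 0
rejectCount (t ∷ ts) f = (if run t f then 0 else 1) ℕ.+ rejectCount ts f

-- Pr[accept] ≥ 2/3, Pr[reject] ≥ 2/3, Pr[accept] = 1
AcceptsWHP : ∀ {A n} → List (Tree A n) → (Fin n → A) → Set
AcceptsWHP ts f = 2 ℕ.* length ts ℕ.≤ 3 ℕ.* acceptCount ts f

RejectsWHP : ∀ {A n} → List (Tree A n) → (Fin n → A) → Set
RejectsWHP ts f = 2 ℕ.* length ts ℕ.≤ 3 ℕ.* rejectCount ts f

AlwaysAccepts : ∀ {A n} → List (Tree A n) → (Fin n → A) → Set
AlwaysAccepts ts f = acceptCount ts f ≡ length ts

IsTester : ∀ {S n} → Bool → Instance S n → ℚ → ℕ → List (Tree (Dom S) n) → Set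
IsTester oneSided I ε q ts =
  ¬ (ts ≡ []) ×
  All (AtMostQueries q) ts ×
  (∀ f → Satisfies I f →
     (if oneSided then AlwaysAccepts ts f else AcceptsWHP ts f)) ×
  (∀ f → Far I ε f → RejectsWHP ts f)

ConstantQueryTestable' : Bool → Structure → Set
ConstantQueryTestable' oneSided S =
  ∀ (ε : ℚ) → 0ℚ ℚ.< ε → ε ℚ.< 1ℚ →
  ∃[ q ] ∀ (n : ℕ) (I : Instance S n) → Satisfiable I →
    ∃[ ts ] IsTester oneSided I ε q ts

ConstantQueryTestable : Structure → Set
ConstantQueryTestable = ConstantQueryTestable' false

ConstantQueryTestableOneSided : Structure → Set
ConstantQueryTestableOneSided = ConstantQueryTestable' true

{-# OPTIONS --safe #-}
module Submission where

-- Testability.  By Baker–Pixley, a majority polymorphism makes f a solution as soon as each pair (f x , f y) lies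
-- in the projection R x y of the solution set, and a Maltsev polymorphism makes R x y a bijection between the
-- classes of an equivalence relation at x and of one at y.  Hence f is a solution if and only if, on each set of
-- matching pairs (x , θ) of a variable and an equivalence relation, the θ-class of f x is constant up to the
-- matching.  The tester picks a random pair and a random pair matching it, and compares the classes: if this
-- rarely fails, then changing f on few variables makes all classes constant.
--
-- Hardness.  A tester cannot tell apart two families of assignments, satisfying and far ones, that depend on a
-- hidden index and on random bits.  Gadgets that describe the ternary polymorphisms yield a relation
-- x + y = u on tuples over A.  Without a Maltsev polymorphism it contains a NAND constraint on two tuples α, β;
-- a hypercube with its directions as hidden matchings gives the two families.  With a Maltsev but without a
-- majority polymorphism, the relation is the addition of a nontrivial abelian group modulo an equivalence.  The
-- instance then sums random group elements along the lines of a grid, and the far assignments shift all sums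
-- after a hidden layer by a fixed vector w which, by counting, is far from every vector of sums.

open import Defs
open import Data.Bool using (Bool; true; false; if_then_else_; _∧_; _xor_; not)
import Data.Bool.Properties as Bool
open import Data.Empty using (⊥; ⊥-elim)
open import Data.Fin using (Fin; zero; suc)
import Data.Fin as Fin
open import Data.Fin.Induction using (<-weakInduction)
import Data.Fin.Properties as Fin
open import Data.Integer using (+_; -[1+_])
import Data.Integer as ℤ
import Data.Integer.Properties as ℤ
import Data.Integer.Solver as ℤ
open import Data.List using (List; []; _∷_; length; map; _++_; allFin; applyUpTo; upTo; tabulate; filter; concatMap; replicate; cartesianProduct; cartesianProductWith)
open import Data.List.Extrema.Nat using (argmin; f[argmin]≤f[⊤]; f[argmin]≤f[xs])
open import Data.List.Membership.Propositional using (_∈_; lose; find)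
open import Data.List.Membership.Propositional.Properties using (∈-allFin; ∈-cartesianProduct⁺; ∈-cartesianProductWith⁺; ∈-concatMap⁺; ∈-filter⁺; ∈-filter⁻; ∈-map⁺; ∈-upTo⁻)
import Data.List.Properties as List
open import Data.List.Relation.Unary.All using (All; []; _∷_)
import Data.List.Relation.Unary.All as All
import Data.List.Relation.Unary.All.Properties as All
open import Data.List.Relation.Unary.Any using (here; there; any?)
open import Data.Nat using (ℕ; zero; suc; pred; NonZero; >-nonZero; _+_; _*_; _∸_; _^_; _/_; _%_; _!; _≤_; _<_; z≤n; s≤s)
import Data.Nat as ℕ
open import Data.Nat.Divisibility using (_∣_; quotient; ∣-trans; m∣m*n; m≤n⇒m!∣n!)
open import Data.Nat.DivMod using (_mod_; m≡m%n+[m/n]*n; m<n⇒m%n≡m; m%n<n; m%n%n≡m%n; n%n≡0; [m+n]%n≡m%n; %-distribˡ-+)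
open import Data.Nat.Properties
open import Data.Nat.Solver using (module +-*-Solver)
open import Data.Product using (Σ; ∃; _×_; _,_; proj₁; proj₂)
open import Data.Rational using (ℚ; 0ℚ; 1ℚ; mkℚ; fromℚᵘ; toℚᵘ)
import Data.Rational as ℚ
import Data.Rational.Properties as ℚ
open import Data.Rational.Unnormalised using (mkℚᵘ)
import Data.Rational.Unnormalised as ℚᵘ
import Data.Rational.Unnormalised.Properties as ℚᵘ
open import Data.Sum using (_⊎_; inj₁; inj₂)
import Data.Sum as Sum
open import Data.Vec using (Vec; []; _∷_; lookup; insertAt; removeAt; _[_]≔_)
import Data.Vec as Vec
import Data.Vec.Properties as Vec
open import Function using (_∘_; id; mk⇔)
open import Relation.Binary.PropositionalEquality using (_≡_; _≢_; _≗_; refl; sym; trans; cong; cong₂; subst; subst₂; module ≡-Reasoning)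
open import Relation.Nullary using (¬_; Dec; yes; no; does)
open import Relation.Nullary.Decidable using (¬?; _×-dec_; dec-true; dec-false; does-⇔)

-- A single pair of variables has little weight, so testing pairs one at a time would need many
-- queries. Grouping all nodes that match each other helps because A has boundedly many binary
-- relations: a variable lies in boundedly many groups, and the loss in the rejection probability
-- depends on A only. For hardness, the Maltsev and majority identities concern only triples in
-- which two entries coincide. Write t(a,b,a) = x, t(a,a,b) = y, t(a,b,b) = u for a ternary
-- polymorphism t. With α the first and β the second projection, t is Maltsev if y = β and u = α,
-- and a majority operation if x = y = α and u = β. So only these entries are shared between
-- gadgets. Both constructions hide their index in the same way. Two objects that are looked at
-- reveal at most one index; with many more indices than pairs of objects, at least three quarters
-- of the indices stay hidden, and for these a shift of the uniform random vector turns one family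
-- into the other on all that is seen. The difficulty is to keep the distance constant while the
-- number of indices grows: hence a matching that covers half of the vertices, and far more lines
-- than points.

private variable
  X Y Z : Set

-- Sums over lists


∑ : List X → (X → ℕ) → ℕ
∑ []       f = 0
∑ (x ∷ xs) f = f x + ∑ xs f

ind : Bool → ℕ
ind b = if b then 1 else 0

ind≤1 : ∀ b → ind b ≤ 1
ind≤1 true  = ≤-refl
ind≤1 false = z≤n

∑-cong-∈ : ∀ (xs : List X) {f g : X → ℕ} → (∀ {x} → x ∈ xs → f x ≡ g x) → ∑ xs f ≡ ∑ xs g
∑-cong-∈ []       h = refl
∑-cong-∈ (x ∷ xs) h = cong₂ _+_ (h (here refl)) (∑-cong-∈ xs (h ∘ there))

∑-cong : ∀ (xs : List X) {f g : X → ℕ} → (∀ x → f x ≡ g x) → ∑ xs f ≡ ∑ xs g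
∑-cong xs h = ∑-cong-∈ xs (λ {x} _ → h x)

∑-mono-∈ : ∀ (xs : List X) {f g : X → ℕ} → (∀ {x} → x ∈ xs → f x ≤ g x) → ∑ xs f ≤ ∑ xs g
∑-mono-∈ []       h = z≤n
∑-mono-∈ (x ∷ xs) h = +-mono-≤ (h (here refl)) (∑-mono-∈ xs (h ∘ there))

∑-mono : ∀ (xs : List X) {f g : X → ℕ} → (∀ x → f x ≤ g x) → ∑ xs f ≤ ∑ xs g
∑-mono xs h = ∑-mono-∈ xs (λ {x} _ → h x)

∑-0 : ∀ (xs : List X) → ∑ xs (λ _ → 0) ≡ 0
∑-0 []       = refl
∑-0 (x ∷ xs) = ∑-0 xs

∑-const : ∀ (xs : List X) c → ∑ xs (λ _ → c) ≡ length xs * c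
∑-const []       c = refl
∑-const (x ∷ xs) c = cong (λ t → c + t) (∑-const xs c)

∑-+ : ∀ (xs : List X) (f g : X → ℕ) → ∑ xs (λ x → f x + g x) ≡ ∑ xs f + ∑ xs g
∑-+ []       f g = refl
∑-+ (x ∷ xs) f g = trans (cong (λ t → f x + g x + t) (∑-+ xs f g))
  (solve 4 (λ a b c d → a :+ b :+ (c :+ d) := a :+ c :+ (b :+ d)) refl (f x) (g x) (∑ xs f) (∑ xs g))
  where open +-*-Solver

∑-*ˡ : ∀ (xs : List X) c (f : X → ℕ) → ∑ xs (λ x → c * f x) ≡ c * ∑ xs f
∑-*ˡ []       c f = sym (*-zeroʳ c)
∑-*ˡ (x ∷ xs) c f = trans (cong (λ t → c * f x + t) (∑-*ˡ xs c f)) (sym (*-distribˡ-+ c (f x) (∑ xs f)))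

∑-*ʳ : ∀ (xs : List X) c (f : X → ℕ) → ∑ xs (λ x → f x * c) ≡ ∑ xs f * c
∑-*ʳ xs c f = trans (∑-cong xs (λ x → *-comm (f x) c)) (trans (∑-*ˡ xs c f) (*-comm c (∑ xs f)))

∑-swap : ∀ (xs : List X) (ys : List Y) (f : X → Y → ℕ) →
         ∑ xs (λ x → ∑ ys (f x)) ≡ ∑ ys (λ y → ∑ xs (λ x → f x y))
∑-swap []       ys f = sym (∑-0 ys)
∑-swap (x ∷ xs) ys f = trans (cong (λ t → ∑ ys (f x) + t) (∑-swap xs ys f))
  (sym (∑-+ ys (f x) (λ y → ∑ xs (λ x → f x y))))

∑-++ : ∀ (xs ys : List X) (f : X → ℕ) → ∑ (xs ++ ys) f ≡ ∑ xs f + ∑ ys f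
∑-++ []       ys f = refl
∑-++ (x ∷ xs) ys f = trans (cong (λ t → f x + t) (∑-++ xs ys f)) (sym (+-assoc (f x) _ _))

∑-map : ∀ (h : X → Y) (xs : List X) (f : Y → ℕ) → ∑ (map h xs) f ≡ ∑ xs (f ∘ h)
∑-map h []       f = refl
∑-map h (x ∷ xs) f = cong (λ t → f (h x) + t) (∑-map h xs f)

∑-cartesian : ∀ (h : X → Y → Z) (xs : List X) (ys : List Y) (f : Z → ℕ) →
              ∑ (cartesianProductWith h xs ys) f ≡ ∑ xs (λ x → ∑ ys (λ y → f (h x y)))
∑-cartesian h []       ys f = refl
∑-cartesian h (x ∷ xs) ys f = trans (∑-++ (map (h x) ys) _ f)
  (cong₂ _+_ (∑-map (h x) ys f) (∑-cartesian h xs ys f))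

length-∑ : ∀ (xs : List X) → length xs ≡ ∑ xs (λ _ → 1)
length-∑ xs = sym (trans (∑-const xs 1) (*-identityʳ _))

∈⇒≤∑ : ∀ {xs : List X} {x} (f : X → ℕ) → x ∈ xs → f x ≤ ∑ xs f
∈⇒≤∑ f (here refl) = m≤m+n _ _
∈⇒≤∑ f (there i)   = ≤-trans (∈⇒≤∑ f i) (m≤n+m _ _)

∑-tabulate : ∀ {n} (h : Fin n → X) (f : X → ℕ) → ∑ (tabulate h) f ≡ ∑ (allFin n) (f ∘ h)
∑-tabulate {n = zero}  h f = refl
∑-tabulate {n = suc n} h f = cong (λ t → f (h zero) + t)
  (trans (∑-tabulate (h ∘ suc) f) (sym (∑-tabulate {n = n} suc (f ∘ h))))

∑-allFin-suc : ∀ {n} (f : Fin (suc n) → ℕ) → ∑ (allFin (suc n)) f ≡ f zero + ∑ (allFin n) (f ∘ suc)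
∑-allFin-suc f = cong (λ t → f zero + t) (∑-tabulate suc f)

∑-indicator-≟ : ∀ {n} (i : Fin n) → ∑ (allFin n) (λ x → ind (does (i Fin.≟ x))) ≡ 1
∑-indicator-≟ {suc n} zero    = trans (∑-allFin-suc {n} (λ x → ind (does (zero Fin.≟ x)))) (cong suc (∑-0 (allFin n)))
∑-indicator-≟ {suc n} (suc i) = trans (∑-allFin-suc {n} (λ x → ind (does (suc i Fin.≟ x)))) (∑-indicator-≟ i)

-- frac c d is c / (d + 1).
abstract
  frac : ℕ → ℕ → ℚ
  frac c d = fromℚᵘ (mkℚᵘ (+ c) d)

  toℚᵘ-frac : ∀ c d → toℚᵘ (frac c d) ℚᵘ.≃ mkℚᵘ (+ c) d
  toℚᵘ-frac c d = ℚ.toℚᵘ-fromℚᵘ (mkℚᵘ (+ c) d)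

  frac-0/1 : frac 0 0 ≡ 0ℚ
  frac-0/1 = refl

  frac-1/1 : frac 1 0 ≡ 1ℚ
  frac-1/1 = refl

frac-+ : ∀ a b d → frac a d ℚ.+ frac b d ≡ frac (a + b) d
frac-+ a b d = ℚ.toℚᵘ-injective (begin
    toℚᵘ (frac a d ℚ.+ frac b d)         ≈⟨ ℚ.toℚᵘ-homo-+ (frac a d) (frac b d) ⟩
    toℚᵘ (frac a d) ℚᵘ.+ toℚᵘ (frac b d) ≈⟨ ℚᵘ.+-cong (toℚᵘ-frac a d) (toℚᵘ-frac b d) ⟩
    mkℚᵘ (+ a) d ℚᵘ.+ mkℚᵘ (+ b) d       ≈⟨ ℚᵘ.*≡* eq ⟩
    mkℚᵘ (+ (a + b)) d                   ≈⟨ toℚᵘ-frac (a + b) d ⟨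
    toℚᵘ (frac (a + b) d)                ∎)
  where
  open ℚᵘ.≃-Reasoning
  eq : ((+ a) ℤ.* (+ suc d) ℤ.+ (+ b) ℤ.* (+ suc d)) ℤ.* (+ suc d) ≡ (+ (a + b)) ℤ.* (+ (suc d * suc d))
  eq = trans (cong (ℤ._* (+ suc d)) (cong₂ ℤ._+_ (sym (ℤ.pos-* a (suc d))) (sym (ℤ.pos-* b (suc d)))))
       (trans (sym (ℤ.pos-* (a * suc d + b * suc d) (suc d)))
       (trans (cong +_ (solve 3 (λ a b s → (a :* s :+ b :* s) :* s := (a :+ b) :* (s :* s)) refl a b (suc d)))
              (ℤ.pos-* (a + b) (suc d * suc d))))
    where open +-*-Solver

frac-< : ∀ a d b e → a * suc e < b * suc d → frac a d ℚ.< frac b e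
frac-< a d b e lt = ℚ.toℚᵘ-cancel-< (ℚᵘ.<-respˡ-≃ (ℚᵘ.≃-sym (toℚᵘ-frac a d))
  (ℚᵘ.<-respʳ-≃ (ℚᵘ.≃-sym (toℚᵘ-frac b e))
    (ℚᵘ.*<* (subst₂ ℤ._<_ (ℤ.pos-* a (suc e)) (ℤ.pos-* b (suc d)) (ℤ.+<+ lt)))))

frac-<⁻¹ : ∀ a d b e → frac a d ℚ.< frac b e → a * suc e < b * suc d
frac-<⁻¹ a d b e lt with ℚᵘ.<-respˡ-≃ (toℚᵘ-frac a d) (ℚᵘ.<-respʳ-≃ (toℚᵘ-frac b e) (ℚ.toℚᵘ-mono-< lt))
... | ℚᵘ.*<* p = ℤ.drop‿+<+ (subst₂ ℤ._<_ (sym (ℤ.pos-* a (suc e))) (sym (ℤ.pos-* b (suc d))) p)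

frac-≤ : ∀ a d b e → a * suc e ≤ b * suc d → frac a d ℚ.≤ frac b e
frac-≤ a d b e le = ℚ.≮⇒≥ (λ lt → <⇒≱ (frac-<⁻¹ b e a d lt) le)

frac-≡ : ∀ a d b e → a * suc e ≡ b * suc d → frac a d ≡ frac b e
frac-≡ a d b e eq = ℚ.≤-antisym (frac-≤ a d b e (≤-reflexive eq)) (frac-≤ b e a d (≤-reflexive (sym eq)))

frac-0 : ∀ d → frac 0 d ≡ 0ℚ
frac-0 d = trans (frac-≡ 0 d 0 0 refl) frac-0/1

frac-1 : ∀ d → frac (suc d) d ≡ 1ℚ
frac-1 d = trans (frac-≡ (suc d) d 1 0 (*-comm (suc d) 1)) frac-1/1

sumFin-frac : ∀ n (c : Fin n → ℕ) d → sumFin n (λ i → frac (c i) d) ≡ frac (∑ (allFin n) c) d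
sumFin-frac zero    c d = sym (frac-0 d)
sumFin-frac (suc n) c d = trans (cong (frac (c zero) d ℚ.+_) (sumFin-frac n (c ∘ suc) d))
  (trans (frac-+ (c zero) _ d) (cong (λ t → frac t d) (sym (∑-allFin-suc c))))

sumFin-cong : ∀ n {f g : Fin n → ℚ} → (∀ i → f i ≡ g i) → sumFin n f ≡ sumFin n g
sumFin-cong zero    h = refl
sumFin-cong (suc n) h = cong₂ ℚ._+_ (h zero) (sumFin-cong n (h ∘ suc))

-- Enumerations

allVecs : List X → ∀ n → List (Vec X n)
allVecs xs zero    = [] ∷ []
allVecs xs (suc n) = cartesianProductWith _∷_ xs (allVecs xs n)

∈-allVecs : ∀ {xs : List X} {n} (v : Vec X n) → (∀ i → lookup v i ∈ xs) → v ∈ allVecs xs n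
∈-allVecs []      h = here refl
∈-allVecs (x ∷ v) h = ∈-cartesianProductWith⁺ _∷_ (h zero) (∈-allVecs v (h ∘ suc))

bools : List Bool
bools = true ∷ false ∷ []

∈-bools : ∀ b → b ∈ bools
∈-bools true  = here refl
∈-bools false = there (here refl)

map-≡⁻ : ∀ {f g : X → Y} (xs : List X) → map f xs ≡ map g xs → ∀ {x} → x ∈ xs → f x ≡ g x
map-≡⁻ (x ∷ xs) eq (here refl) = List.∷-injectiveˡ eq
map-≡⁻ (x ∷ xs) eq (there i)   = map-≡⁻ xs (List.∷-injectiveʳ eq) i

map-≡⁺ : ∀ {f g : X → Y} (xs : List X) → (∀ {x} → x ∈ xs → f x ≡ g x) → map f xs ≡ map g xs
map-≡⁺ []       h = refl
map-≡⁺ (x ∷ xs) h = cong₂ _∷_ (h (here refl)) (map-≡⁺ xs (h ∘ there))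

does⇒ : ∀ {P : Set} (d : Dec P) → does d ≡ true → P
does⇒ (yes p) _ = p

-- Common denominators

frac-injective : ∀ a b d → frac a d ≡ frac b d → a ≡ b
frac-injective a b d eq = ≤-antisym
  (≮⇒≥ (λ b<a → ℚ.<-irrefl (sym eq) (frac-< b d a d (*-monoˡ-< (suc d) b<a))))
  (≮⇒≥ (λ a<b → ℚ.<-irrefl eq (frac-< a d b d (*-monoˡ-< (suc d) a<b))))

nonNegative⇒frac : ∀ (w : ℚ) → 0ℚ ℚ.≤ w → ∃ λ a → ∃ λ d → w ≡ frac a d
nonNegative⇒frac w@(mkℚ (+ a) d _)    _ = a , d , ℚ.toℚᵘ-injective (ℚᵘ.≃-sym (toℚᵘ-frac a d))
nonNegative⇒frac (mkℚ -[1+ a ] d _) (ℚ.*≤* ())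

commonDenominator : ∀ n (w : Fin n → ℚ) → (∀ i → 0ℚ ℚ.≤ w i) →
  ∃ λ (c : Fin n → ℕ) → ∃ λ d → ∀ i → w i ≡ frac (c i) d
commonDenominator zero    w w≥0 = (λ ()) , 0 , λ ()
commonDenominator (suc n) w w≥0 with commonDenominator n (w ∘ suc) (w≥0 ∘ suc) | nonNegative⇒frac (w zero) (w≥0 zero)
... | c , d , eq | a , e , eq₀ = c′ , d + e * suc d , λ where
    zero    → trans eq₀ (frac-≡ a e (a * suc d) _ (solve 3 (λ a e d → a :* (con 1 :+ d :+ e :* (con 1 :+ d)) := a :* (con 1 :+ d) :* (con 1 :+ e)) refl a e d))
    (suc i) → trans (eq i) (frac-≡ (c i) d (c i * suc e) _ (solve 3 (λ a e d → a :* (con 1 :+ d :+ e :* (con 1 :+ d)) := a :* (con 1 :+ e) :* (con 1 :+ d)) refl (c i) e d))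
  where
  open +-*-Solver
  c′ : Fin (suc n) → ℕ
  c′ zero    = a * suc d
  c′ (suc i) = c i * suc e

-- Conjunctions of decision trees

module _ {A : Set} {n : ℕ} where

  andT : Tree A n → Tree A n → Tree A n
  andT (leaf true)  u = u
  andT (leaf false) u = leaf false
  andT (query x k)  u = query x (λ a → andT (k a) u)

  run-andT : ∀ t u f → run (andT t u) f ≡ run t f ∧ run u f
  run-andT (leaf true)  u f = refl
  run-andT (leaf false) u f = refl
  run-andT (query x k)  u f = run-andT (k (f x)) u f

  atMost-weaken : ∀ {q r} {t : Tree A n} → q ≤ r → AtMostQueries q t → AtMostQueries r t
  atMost-weaken _         leaf      = leaf
  atMost-weaken (s≤s q≤r) (query h) = query (λ a → atMost-weaken q≤r (h a))

  atMost-andT : ∀ {q r} {t u : Tree A n} → AtMostQueries q t → AtMostQueries r u → AtMostQueries (q + r) (andT t u)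
  atMost-andT {q} {r} (leaf {b = true})  h = atMost-weaken (m≤n+m r q) h
  atMost-andT (leaf {b = false}) h = leaf
  atMost-andT (query g) h = query (λ a → atMost-andT (g a) h)

  -- A uniform choice from this list amounts to j independent choices from `ts`, and the conjunction
  -- rejects as soon as one of them does.
  powT : List (Tree A n) → ℕ → List (Tree A n)
  powT ts zero    = leaf true ∷ []
  powT ts (suc j) = cartesianProductWith andT ts (powT ts j)

  acceptCount-∑ : ∀ (ts : List (Tree A n)) f → acceptCount ts f ≡ ∑ ts (λ t → ind (run t f))
  acceptCount-∑ []       f = refl
  acceptCount-∑ (t ∷ ts) f = cong (λ z → ind (run t f) + z) (acceptCount-∑ ts f)

  rejectCount-∑ : ∀ (ts : List (Tree A n)) f → rejectCount ts f ≡ ∑ ts (λ t → ind (not (run t f)))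
  rejectCount-∑ []       f = refl
  rejectCount-∑ (t ∷ ts) f with run t f
  ... | true  = rejectCount-∑ ts f
  ... | false = cong suc (rejectCount-∑ ts f)

  accept+reject : ∀ (ts : List (Tree A n)) f → acceptCount ts f + rejectCount ts f ≡ length ts
  accept+reject []       f = refl
  accept+reject (t ∷ ts) f with run t f
  ... | true  = cong suc (accept+reject ts f)
  ... | false = trans (+-suc _ _) (cong suc (accept+reject ts f))

  private
    ind-∧ : ∀ b c → ind (b ∧ c) ≡ ind b * ind c
    ind-∧ true  c = sym (+-identityʳ _)
    ind-∧ false c = refl

  ∑-product : ∀ (f : X → ℕ) (g : Y → ℕ) (xs : List X) (ys : List Y) →
              ∑ xs (λ x → ∑ ys (λ y → f x * g y)) ≡ ∑ xs f * ∑ ys g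
  ∑-product f g xs ys = trans (∑-cong xs (λ x → ∑-*ˡ ys (f x) g)) (∑-*ʳ xs _ f)

  acceptCount-powT : ∀ ts j f → acceptCount (powT ts j) f ≡ acceptCount ts f ^ j
  acceptCount-powT ts zero    f = refl
  acceptCount-powT ts (suc j) f = begin
    acceptCount (powT ts (suc j)) f                                     ≡⟨ acceptCount-∑ (powT ts (suc j)) f ⟩
    ∑ (powT ts (suc j)) (λ t → ind (run t f))                           ≡⟨ ∑-cartesian andT ts (powT ts j) _ ⟩
    ∑ ts (λ t → ∑ (powT ts j) (λ u → ind (run (andT t u) f)))           ≡⟨ ∑-cong ts (λ t → ∑-cong (powT ts j) (λ u → trans (cong ind (run-andT t u f)) (ind-∧ (run t f) _))) ⟩
    ∑ ts (λ t → ∑ (powT ts j) (λ u → ind (run t f) * ind (run u f)))    ≡⟨ ∑-product _ _ ts (powT ts j) ⟩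
    ∑ ts (λ t → ind (run t f)) * ∑ (powT ts j) (λ u → ind (run u f))    ≡⟨ cong₂ _*_ (sym (acceptCount-∑ ts f)) (trans (sym (acceptCount-∑ (powT ts j) f)) (acceptCount-powT ts j f)) ⟩
    acceptCount ts f ^ suc j                                            ∎
    where open ≡-Reasoning

  length-powT : ∀ ts j → length (powT ts j) ≡ length ts ^ j
  length-powT ts zero    = refl
  length-powT ts (suc j) = begin
    length (powT ts (suc j))             ≡⟨ length-∑ (powT ts (suc j)) ⟩
    ∑ (powT ts (suc j)) (λ _ → 1)        ≡⟨ ∑-cartesian andT ts (powT ts j) _ ⟩
    ∑ ts (λ _ → ∑ (powT ts j) (λ _ → 1)) ≡⟨ ∑-const ts _ ⟩
    length ts * ∑ (powT ts j) (λ _ → 1)  ≡⟨ cong (length ts *_) (trans (sym (length-∑ (powT ts j))) (length-powT ts j)) ⟩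
    length ts ^ suc j                    ∎
    where open ≡-Reasoning

  atMost-powT : ∀ {q ts} j → All (AtMostQueries q) ts → All (AtMostQueries (j * q)) (powT ts j)
  atMost-powT zero    h = leaf ∷ []
  atMost-powT {q} {ts} (suc j) h = go h
    where
    go : ∀ {us} → All (AtMostQueries q) us → All (AtMostQueries (suc j * q)) (cartesianProductWith andT us (powT ts j))
    go []      = []
    go (p ∷ ps) = All.++⁺ (All.map⁺ (All.map (λ r → atMost-andT p r) (atMost-powT j h))) (go ps)

-- Error reduction by repetition

bernoulli : ∀ a r i → a ^ suc i + suc i * r * a ^ i ≤ (a + r) ^ suc i
bernoulli a r zero    = ≤-reflexive (solve 2 (λ a r → a :* con 1 :+ (r :+ con 0) :* con 1 := (a :+ r) :* con 1) refl a r)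
  where open +-*-Solver
bernoulli a r (suc i) = begin
  a * (a * p) + suc (suc i) * r * (a * p)                     ≤⟨ m≤m+n _ _ ⟩
  a * (a * p) + suc (suc i) * r * (a * p) + suc i * r * p * r ≡⟨ solve 4 (λ a r i p → a :* (a :* p) :+ (con 2 :+ i) :* r :* (a :* p) :+ (con 1 :+ i) :* r :* p :* r := (a :+ r) :* (a :* p :+ (con 1 :+ i) :* r :* p)) refl a r i p ⟩
  (a + r) * (a * p + suc i * r * p)                           ≤⟨ *-monoʳ-≤ (a + r) (bernoulli a r i) ⟩
  (a + r) * (a + r) ^ suc i                                   ∎
  where
  open ≤-Reasoning
  open +-*-Solver
  p = a ^ i

-- With a accepting and r rejecting trees, the hypothesis says that one draw rejects with
-- probability at least 1/(E + 1). The second term of `bernoulli` is then at least twice the first,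
-- so 2(E + 1) draws all accept with probability at most 1/3.
amplification : ∀ a r E → a + r ≤ r * suc E → 3 * a ^ (2 * suc E) ≤ (a + r) ^ (2 * suc E)
amplification a r E h = begin
  3 * (a * p)                         ≡⟨ solve 2 (λ a p → con 3 :* (a :* p) := a :* p :+ con 2 :* a :* p) refl a p ⟩
  a * p + 2 * a * p                   ≤⟨ +-monoʳ-≤ (a * p) (*-monoˡ-≤ p (*-monoʳ-≤ 2 (≤-trans (m≤m+n a r) h))) ⟩
  a * p + 2 * (r * suc E) * p         ≡⟨ solve 4 (λ a p r e → a :* p :+ con 2 :* (r :* (con 1 :+ e)) :* p := a :* p :+ (con 2 :* (con 1 :+ e)) :* r :* p) refl a p r E ⟩
  a * p + 2 * suc E * r * p           ≤⟨ bernoulli a r (E + suc (E + 0)) ⟩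
  (a + r) ^ (2 * suc E)               ∎
  where
  open ≤-Reasoning
  open +-*-Solver
  p = a ^ (E + suc (E + 0))

-- Sets of solutions

module Solutions (S : Structure) {n : ℕ} (I : Instance S n) where

  A : Set
  A = Dom S

  satisfies-resp : ∀ {f g : Assignment S n} → f ≗ g → Satisfies I f → Satisfies I g
  satisfies-resp f≗g = All.map (λ {c} h → trans (cong (holds (rel c)) (sym (Vec.map-cong f≗g (scope c)))) h)

  satisfies? : ∀ f → Dec (Satisfies I f)
  satisfies? f = All.all? (λ c → holds (rel c) (Vec.map f (scope c)) Bool.≟ true) (constraints I)

  solutions-closed : ∀ g → IsPolymorphism₃ S g → ∀ {s₁ s₂ s₃} → Satisfies I s₁ → Satisfies I s₂ → Satisfies I s₃ →
                     Satisfies I (λ x → g (s₁ x) (s₂ x) (s₃ x))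
  solutions-closed g pol {s₁} {s₂} {s₃} h₁ h₂ h₃ = All.tabulate λ {c} c∈ →
    trans (cong (holds (rel c)) (trans (sym (Vec.tabulate∘lookup (Vec.map _ (scope c)))) (Vec.tabulate-cong (λ i →
        trans (Vec.lookup-map i _ (scope c)) (sym (cong₃ (Vec.lookup-map i s₁ (scope c)) (Vec.lookup-map i s₂ (scope c)) (Vec.lookup-map i s₃ (scope c))))))))
      (pol (rel∈Γ c) (Vec.map s₁ (scope c)) (Vec.map s₂ (scope c)) (Vec.map s₃ (scope c)) (All.lookup h₁ c∈) (All.lookup h₂ c∈) (All.lookup h₃ c∈))
    where
    cong₃ : ∀ {a a′ b b′ c c′} → a ≡ a′ → b ≡ b′ → c ≡ c′ → g a b c ≡ g a′ b′ c′
    cong₃ refl refl refl = refl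

  sols : List (Vec A n)
  sols = filter (λ v → satisfies? (lookup v)) (allVecs (allFin _) n)

  ∈-sols⁺ : ∀ {f} → Satisfies I f → Vec.tabulate f ∈ sols
  ∈-sols⁺ {f} h = ∈-filter⁺ (λ v → satisfies? (lookup v)) (∈-allVecs (Vec.tabulate f) (λ i → ∈-allFin _))
    (satisfies-resp (λ x → sym (Vec.lookup∘tabulate f x)) h)

  ∈-sols⁻ : ∀ {v} → v ∈ sols → Satisfies I (lookup v)
  ∈-sols⁻ v∈ = proj₂ (∈-filter⁻ (λ v → satisfies? (lookup v)) {xs = allVecs (allFin _) n} v∈)

  R : Fin n → Fin n → A → A → Set
  R x y a b = ∃ λ s → Satisfies I s × s x ≡ a × s y ≡ b

  R? : ∀ x y a b → Dec (R x y a b)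
  R? x y a b with any? (λ v → (lookup v x Fin.≟ a) ×-dec (lookup v y Fin.≟ b)) sols
  ... | yes p = let v , v∈ , ex , ey = find p in yes (lookup v , ∈-sols⁻ v∈ , ex , ey)
  ... | no ¬p = no λ (s , h , ex , ey) → ¬p (lose (∈-sols⁺ h) (trans (Vec.lookup∘tabulate s x) ex , trans (Vec.lookup∘tabulate s y) ey))

  R-swap : ∀ {x y a b} → R x y a b → R y x b a
  R-swap (s , h , ex , ey) = s , h , ey , ex

  -- The three solutions take the values a, a′, a′ at x and b, b, b′ at y, so p leaves a and b′.
  R-rectangular : HasMaltsevPolymorphism S → ∀ {x y a a′ b b′} → R x y a b → R x y a′ b → R x y a′ b′ → R x y a b′
  R-rectangular (p , pol , maltsev) {a = a} {a′} {b} {b′} (s₁ , h₁ , refl , refl) (s₂ , h₂ , refl , ey₂) (s₃ , h₃ , ex₃ , refl) =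
    _ , solutions-closed p pol h₁ h₂ h₃ , trans (cong (p _ _) ex₃) (proj₁ (maltsev _ _)) ,
    trans (cong (λ t → p _ t _) ey₂) (proj₂ (maltsev _ _))

  -- Baker–Pixley: with a majority polymorphism a partial assignment extends to a solution as soon
  -- as each pair of its values does.  The induction carries two extra variables u, v along, so that
  -- each value prescribed for z ∷ xs, u, v is taken by two of the three solutions that are combined.
  extend-pairs : HasMajorityPolymorphism S → ∀ (f : Assignment S n) (G : List (Fin n)) →
                 (∀ {x y} → x ∈ G → y ∈ G → R x y (f x) (f y)) →
                 ∀ xs → (∀ {z} → z ∈ xs → z ∈ G) → ∀ {u v} → u ∈ G → v ∈ G →
                 ∃ λ s → Satisfies I s × (∀ {z} → z ∈ xs → s z ≡ f z) × s u ≡ f u × s v ≡ f v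
  extend-pairs maj f G pairs []       sub u∈ v∈ =
    let s , h , eu , ev = pairs u∈ v∈ in s , h , (λ ()) , eu , ev
  extend-pairs maj@(m , pol , majority) f G pairs (z ∷ xs) sub {u} {v} u∈ v∈ =
    let z∈ = sub (here refl)
        s₁ , h₁ , e₁ , u₁ , v₁ = extend-pairs maj f G pairs xs (sub ∘ there) u∈ v∈
        s₂ , h₂ , e₂ , u₂ , z₂ = extend-pairs maj f G pairs xs (sub ∘ there) u∈ z∈
        s₃ , h₃ , e₃ , v₃ , z₃ = extend-pairs maj f G pairs xs (sub ∘ there) v∈ z∈
    in (λ x → m (s₁ x) (s₂ x) (s₃ x)) , solutions-closed m pol h₁ h₂ h₃ ,
       (λ { (here refl) → maj₂₃ z₂ z₃ ; (there i) → maj₁₂ (e₁ i) (e₂ i) }) ,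
       maj₁₂ u₁ u₂ , maj₁₃ v₁ v₃
    where
    maj₁₂ : ∀ {a b c d} → a ≡ d → b ≡ d → m a b c ≡ d
    maj₁₂ refl refl = proj₂ (proj₂ (majority _ _))
    maj₁₃ : ∀ {a b c d} → a ≡ d → c ≡ d → m a b c ≡ d
    maj₁₃ refl refl = proj₁ (proj₂ (majority _ _))
    maj₂₃ : ∀ {a b c d} → b ≡ d → c ≡ d → m a b c ≡ d
    maj₂₃ refl refl = proj₁ (majority _ _)

-- The two-query test and its analysis

Matrix : ℕ → Set
Matrix k = Vec (Vec Bool k) k

-- All Boolean matrices stand in for the equivalence relations on A: what counts is that their
-- number depends on |A| only, and the axioms of an equivalence never have to be decided.
matrices : ∀ k → List (Matrix k)
matrices k = allVecs (allVecs bools k) k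

∈-matrices : ∀ {k} (θ : Matrix k) → θ ∈ matrices k
∈-matrices θ = ∈-allVecs θ (λ i → ∈-allVecs (lookup θ i) (λ j → ∈-bools _))

entry : ∀ {k} → Matrix k → Fin k → Fin k → Bool
entry θ a b = lookup (lookup θ a) b

matrixOf : ∀ {k} → (Fin k → Fin k → Bool) → Matrix k
matrixOf h = Vec.tabulate (λ a → Vec.tabulate (h a))

entry-matrixOf : ∀ {k} (h : Fin k → Fin k → Bool) a b → entry (matrixOf h) a b ≡ h a b
entry-matrixOf h a b = trans (cong (λ v → lookup v b) (Vec.lookup∘tabulate (λ a → Vec.tabulate (h a)) a)) (Vec.lookup∘tabulate (h a) b)

replicate-∑ : ∀ m (x : X) (f : X → ℕ) → ∑ (replicate m x) f ≡ m * f x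
replicate-∑ zero    x f = refl
replicate-∑ (suc m) x f = cong (λ t → f x + t) (replicate-∑ m x f)

concatMap-∑ : ∀ (h : X → List Y) xs (f : Y → ℕ) → ∑ (concatMap h xs) f ≡ ∑ xs (λ x → ∑ (h x) f)
concatMap-∑ h []       f = refl
concatMap-∑ h (x ∷ xs) f = trans (∑-++ (h x) (concatMap h xs) f) (cong (λ t → ∑ (h x) f + t) (concatMap-∑ h xs f))

ind-not-does : ∀ {P : Set} (d : Dec P) → ind (not (does d)) ≡ 0 → P
ind-not-does (yes p) _ = p

All-concatMap : ∀ {P : Y → Set} {h : X → List Y} xs → (∀ x → All P (h x)) → All P (concatMap h xs)
All-concatMap []       p = []
All-concatMap (x ∷ xs) p = All.++⁺ (p x) (All-concatMap xs p)

module Tester (S : Structure) {n : ℕ} (I : Instance S n) (W : Fin n → ℕ) where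
  open Solutions S I

  k : ℕ
  k = suc (size S)

  -- Two nodes (x, θ) and (y, ψ) have the same signature when θ and ψ induce the same relation on
  -- the solutions; for equivalence relations this means that all solutions match the θ-class of
  -- the value at x with the ψ-class of the value at y.
  Node : Set
  Node = Fin n × Matrix k

  Sig : Set
  Sig = List (List Bool)

  nodes : List Node
  nodes = cartesianProduct (allFin n) (matrices k)

  ∈-nodes : ∀ ν → ν ∈ nodes
  ∈-nodes (x , θ) = ∈-cartesianProduct⁺ (∈-allFin x) (∈-matrices θ)

  sig : Node → Sig
  sig (x , θ) = map (λ s → map (λ s′ → entry θ (lookup s x) (lookup s′ x)) sols) sols

  _≟ˢ_ : (σ τ : Sig) → Dec (σ ≡ τ)
  _≟ˢ_ = List.≡-dec (List.≡-dec Bool._≟_)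

  key : Node → A → List Bool
  key (x , θ) a = map (λ s → entry θ (lookup s x) a) sols

  -- The condition `R x x a a`, that some solution takes the value a at x, provides the solution
  -- from which `agree⇒R` starts; keys alone could agree by being false throughout.
  Agree : Node → Node → A → A → Set
  Agree ν@(x , _) ν′@(y , _) a b = R x x a a × key ν a ≡ key ν′ b

  agree? : ∀ ν ν′ a b → Dec (Agree ν ν′ a b)
  agree? ν@(x , _) ν′ a b = R? x x a a ×-dec List.≡-dec Bool._≟_ (key ν a) (key ν′ b)

  agree-solution : ∀ ν ν′ → sig ν ≡ sig ν′ → ∀ {f} → Satisfies I f → Agree ν ν′ (f (proj₁ ν)) (f (proj₁ ν′))
  agree-solution (x , θ) (y , ψ) eq {f} h = (f , h , refl , refl) , map-≡⁺ sols λ {s} s∈ → begin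
      entry θ (lookup s x) (f x)                     ≡⟨ cong (entry θ (lookup s x)) (Vec.lookup∘tabulate f x) ⟨
      entry θ (lookup s x) (lookup (Vec.tabulate f) x) ≡⟨ map-≡⁻ sols (map-≡⁻ sols eq s∈) (∈-sols⁺ h) ⟩
      entry ψ (lookup s y) (lookup (Vec.tabulate f) y) ≡⟨ cong (entry ψ (lookup s y)) (Vec.lookup∘tabulate f y) ⟩
      entry ψ (lookup s y) (f y)                     ∎
    where open ≡-Reasoning

  θ? : ∀ x y a a′ → Dec (∃ λ b → R x y a b × R x y a′ b)
  θ? x y a a′ = Fin.any? (λ b → R? x y a b ×-dec R? x y a′ b)

  leftNode : Fin n → Fin n → Node
  leftNode x y = x , matrixOf (λ a a′ → does (θ? x y a a′))

  -- With a Maltsev polymorphism, R x y is a bijection between the classes of the two equivalence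
  -- relations ∃ b. R a b ∧ R a′ b and ∃ a. R a b ∧ R a b′.
  sig-leftNode : HasMaltsevPolymorphism S → ∀ x y → sig (leftNode x y) ≡ sig (leftNode y x)
  sig-leftNode malt x y = map-≡⁺ sols λ {s} s∈ → map-≡⁺ sols λ {s′} s′∈ →
      trans (entry-matrixOf (λ a a′ → does (θ? x y a a′)) (lookup s x) (lookup s′ x))
        (trans (does-⇔ (mk⇔ (to x y s∈ s′∈) (to y x s∈ s′∈)) (θ? x y _ _) (θ? y x _ _))
          (sym (entry-matrixOf (λ a a′ → does (θ? y x a a′)) (lookup s y) (lookup s′ y))))
    where
    to : ∀ x y {s s′} → s ∈ sols → s′ ∈ sols →
         (∃ λ b → R x y (lookup s x) b × R x y (lookup s′ x) b) → ∃ λ a → R y x (lookup s y) a × R y x (lookup s′ y) a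
    to x y {s} {s′} s∈ s′∈ (b , r , r′) =
      lookup s′ x , R-swap (R-rectangular malt r′ r (_ , ∈-sols⁻ s∈ , refl , refl)) , (_ , ∈-sols⁻ s′∈ , refl , refl)

  -- Let s be a solution with s x = a. The entry of the key of a at s is true, hence so is that of
  -- b: s y and b have a common partner c at x. Rectangularity applied to (a, s y), (c, s y), (c, b)
  -- gives (a, b).
  agree⇒R : HasMaltsevPolymorphism S → ∀ {x y a b} → R x x a a → R y y b b → key (leftNode x y) a ≡ key (leftNode y x) b → R x y a b
  agree⇒R malt {x} {y} {a} {b} (s , h , refl , _) (_ , _ , _ , _) eq =
    let s∈ = ∈-sols⁺ h
        v  = Vec.tabulate s
        vx = Vec.lookup∘tabulate s x
        rv : R x y (s x) (lookup v y)
        rv = s , h , refl , sym (Vec.lookup∘tabulate s y)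
        θtrue : entry (proj₂ (leftNode x y)) (lookup v x) (s x) ≡ true
        θtrue = trans (entry-matrixOf (λ a a′ → does (θ? x y a a′)) (lookup v x) (s x))
                  (dec-true (θ? x y _ _) (lookup v y , subst (λ t → R x y t (lookup v y)) (sym vx) rv , rv))
        ψtrue = trans (sym (entry-matrixOf (λ a a′ → does (θ? y x a a′)) (lookup v y) b)) (trans (sym (map-≡⁻ sols eq s∈)) θtrue)
        c , r₁ , r₂ = does⇒ (θ? y x _ _) ψtrue
    in R-rectangular malt rv (R-swap r₁) (R-swap r₂)

  same : Sig → Sig → ℕ
  same σ τ = ind (does (σ ≟ˢ τ))

  wt : Node → ℕ
  wt (x , _) = W x

  total : Sig → ℕ
  total σ = ∑ nodes (λ ν → same σ (sig ν) * wt ν)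

  M : ℕ
  M = ∑ nodes wt

  same-refl : ∀ σ → same σ σ ≡ 1
  same-refl σ = cong ind (dec-true (σ ≟ˢ σ) refl)

  same-sym : ∀ σ τ → same σ τ ≡ same τ σ
  same-sym σ τ = cong ind (does-⇔ (mk⇔ sym sym) (σ ≟ˢ τ) (τ ≟ˢ σ))

  same≤1 : ∀ σ τ → same σ τ ≤ 1
  same≤1 σ τ = ind≤1 _

  same-subst : ∀ σ τ (h : Sig → ℕ) → same σ τ * h σ ≡ same σ τ * h τ
  same-subst σ τ h with σ ≟ˢ τ
  ... | yes refl = refl
  ... | no  _    = refl

  total≤M : ∀ σ → total σ ≤ M
  total≤M σ = ∑-mono nodes (λ ν → ≤-trans (*-monoˡ-≤ (wt ν) (same≤1 σ (sig ν))) (≤-reflexive (*-identityˡ _)))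

  suc∣! : ∀ t m → suc t ≤ m → suc t ∣ m !
  suc∣! t m le = ∣-trans (m∣m*n {suc t} (t !)) (m≤n⇒m!∣n! le)

  -- This is M!/t. Class weights are at most M, so M! is a common multiple of the nonzero ones and
  -- the probabilities become integer multiplicities. The value at t = 0 is a default: nodes of a
  -- class of weight 0 have weight 0 themselves.
  coeff′ : ∀ t → t ≤ M → ℕ
  coeff′ zero    _  = 0
  coeff′ (suc t) le = quotient (suc∣! t M le)

  coeff : Sig → ℕ
  coeff σ = coeff′ (total σ) (total≤M σ)

  coeff′-total : ∀ t (le : t ≤ M) w → w ≤ t → w * (coeff′ t le * t) ≡ w * (M !)
  coeff′-total zero    le zero z≤n = refl
  coeff′-total (suc t) le w    _   = cong (λ z → w * z) (sym (_∣_.equality (suc∣! t M le)))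

  wt≤total : ∀ ν → wt ν ≤ total (sig ν)
  wt≤total ν = ≤-trans (≤-reflexive (sym (trans (cong (λ z → z * wt ν) (same-refl (sig ν))) (*-identityˡ _))))
    (∈⇒≤∑ (λ ν′ → same (sig ν) (sig ν′) * wt ν′) (∈-nodes ν))

  wt-coeff-total : ∀ ν → wt ν * (coeff (sig ν) * total (sig ν)) ≡ wt ν * (M !)
  wt-coeff-total ν = coeff′-total _ _ (wt ν) (wt≤total ν)

  test : Node → Node → Tree A n
  test ν ν′ = query (proj₁ ν) (λ a → query (proj₁ ν′) (λ b → leaf (does (agree? ν ν′ a b))))

  -- Within a class, the pair (ν, ν′) is drawn with probability proportional to
  -- wt ν · wt ν′ / (weight of the class).
  mult : Node → Node → ℕ
  mult ν ν′ = same (sig ν) (sig ν′) * (wt ν * (wt ν′ * coeff (sig ν)))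

  tests : List (Tree A n)
  tests = concatMap (λ ν → concatMap (λ ν′ → replicate (mult ν ν′) (test ν ν′)) nodes) nodes

  ∑-tests : ∀ (h : Tree A n → ℕ) → ∑ tests h ≡ ∑ nodes (λ ν → ∑ nodes (λ ν′ → mult ν ν′ * h (test ν ν′)))
  ∑-tests h = trans (concatMap-∑ _ nodes h) (∑-cong nodes (λ ν → trans (concatMap-∑ _ nodes h)
    (∑-cong nodes (λ ν′ → replicate-∑ (mult ν ν′) (test ν ν′) h))))

  -- The sum of wt ν · g ν / (weight of the class of ν) over pairs ν, ν′ weighted by wt ν′.
  ∑-class : ∀ (g : Node → ℕ) →
    ∑ nodes (λ ν → ∑ nodes (λ ν′ → mult ν ν′ * g ν)) ≡ (M !) * ∑ nodes (λ ν → wt ν * g ν)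
  ∑-class g = trans (∑-cong nodes step) (trans (∑-*ˡ nodes (M !) (λ ν → wt ν * g ν)) refl)
    where
    open +-*-Solver
    open ≡-Reasoning
    step : ∀ ν → ∑ nodes (λ ν′ → mult ν ν′ * g ν) ≡ (M !) * (wt ν * g ν)
    step ν = begin
      ∑ nodes (λ ν′ → mult ν ν′ * g ν)
        ≡⟨ ∑-cong nodes (λ ν′ → solve 5 (λ s w w′ c g → s :* (w :* (w′ :* c)) :* g := (w :* c :* g) :* (s :* w′)) refl
             (same (sig ν) (sig ν′)) (wt ν) (wt ν′) (coeff (sig ν)) (g ν)) ⟩
      ∑ nodes (λ ν′ → (wt ν * coeff (sig ν) * g ν) * (same (sig ν) (sig ν′) * wt ν′))
        ≡⟨ ∑-*ˡ nodes (wt ν * coeff (sig ν) * g ν) (λ ν′ → same (sig ν) (sig ν′) * wt ν′) ⟩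
      (wt ν * coeff (sig ν) * g ν) * total (sig ν)
        ≡⟨ solve 4 (λ w c g t → w :* c :* g :* t := w :* (c :* t) :* g) refl (wt ν) (coeff (sig ν)) (g ν) (total (sig ν)) ⟩
      wt ν * (coeff (sig ν) * total (sig ν)) * g ν
        ≡⟨ cong (λ z → z * g ν) (wt-coeff-total ν) ⟩
      wt ν * (M !) * g ν
        ≡⟨ solve 3 (λ w m g → w :* m :* g := m :* (w :* g)) refl (wt ν) (M !) (g ν) ⟩
      (M !) * (wt ν * g ν) ∎

  length-tests : length tests ≡ (M !) * M
  length-tests = trans (length-∑ tests) (trans (∑-tests (λ _ → 1)) (trans (∑-class (λ _ → 1))
    (cong (λ z → (M !) * z) (∑-cong nodes (λ ν → *-identityʳ _)))))

  tests-queries : All (AtMostQueries 2) tests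
  tests-queries = All-concatMap nodes (λ ν → All-concatMap nodes (λ ν′ →
    All.replicate⁺ (mult ν ν′) (query {x = proj₁ ν} (λ _ → query {x = proj₁ ν′} (λ _ → leaf)))))

  disagree : Assignment S n → Node → Node → ℕ
  disagree f ν ν′ = ind (not (does (agree? ν ν′ (f (proj₁ ν)) (f (proj₁ ν′)))))

  rejectCount-tests : ∀ f → rejectCount tests f ≡ ∑ nodes (λ ν → ∑ nodes (λ ν′ → mult ν ν′ * disagree f ν ν′))
  rejectCount-tests f = trans (rejectCount-∑ tests f) (∑-tests (λ t → ind (not (run t f))))

  tests-accept : ∀ f → Satisfies I f → rejectCount tests f ≡ 0
  tests-accept f h = trans (rejectCount-tests f) (trans (∑-cong nodes (λ ν → trans (∑-cong nodes (zero′ ν)) (∑-0 nodes))) (∑-0 nodes))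
    where
    zero′ : ∀ ν ν′ → mult ν ν′ * disagree f ν ν′ ≡ 0
    zero′ ν ν′ with sig ν ≟ˢ sig ν′
    ... | no _   = refl
    ... | yes eq = trans (cong (λ b → 1 * (wt ν * (wt ν′ * coeff (sig ν))) * ind (not b)) (dec-true (agree? ν ν′ _ _) (agree-solution ν ν′ eq h)))
                     (*-zeroʳ (1 * (wt ν * (wt ν′ * coeff (sig ν)))))

  module Soundness (f : Assignment S n) where

    cost : Sig → Node → ℕ
    cost σ ν′ = ∑ nodes (λ ν → same σ (sig ν) * (wt ν * disagree f ν ν′))

    best : Sig → Node → List Node → Node
    best σ ν νs = argmin (cost σ) ν νs

    class : Sig → List Node
    class σ = filter (λ ν → σ ≟ˢ sig ν) nodes

    repIn : Sig → Node → List Node → Node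
    repIn σ ν []       = ν
    repIn σ ν (μ ∷ μs) = best σ μ μs

    -- The default ν is irrelevant, as ν itself lies in the class of its signature.
    rep : Node → Node
    rep ν = repIn (sig ν) ν (class (sig ν))

    repIn-min : ∀ σ ν μs {μ} → μ ∈ μs → cost σ (repIn σ ν μs) ≤ cost σ μ
    repIn-min σ ν (μ ∷ μs) (here refl) = f[argmin]≤f[⊤] {f = cost σ} μ μs
    repIn-min σ ν (μ ∷ μs) (there i)   = All.lookup (f[argmin]≤f[xs] {f = cost σ} μ μs) i

    repIn-const : ∀ σ ν ν′ μs {μ} → μ ∈ μs → repIn σ ν μs ≡ repIn σ ν′ μs
    repIn-const σ ν ν′ (μ ∷ μs) _ = refl

    ∈-class : ∀ ν → ν ∈ class (sig ν)
    ∈-class ν = ∈-filter⁺ (λ ν′ → sig ν ≟ˢ sig ν′) (∈-nodes ν) refl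

    rep-cong : ∀ ν ν′ → sig ν ≡ sig ν′ → rep ν ≡ rep ν′
    rep-cong ν ν′ eq = trans (repIn-const (sig ν) ν ν′ (class (sig ν)) (∈-class ν))
      (cong (λ σ → repIn σ ν′ (class σ)) eq)

    rep-min : ∀ ν → cost (sig ν) (rep ν) ≤ cost (sig ν) ν
    rep-min ν = repIn-min (sig ν) ν _ (∈-class ν)

    badness : Fin n → ℕ
    badness x = ∑ (matrices k) (λ θ → disagree f (x , θ) (rep (x , θ)))

    totalBad : ℕ
    totalBad = ∑ (allFin n) (λ x → W x * badness x)

    totalBad-nodes : totalBad ≡ ∑ nodes (λ ν → wt ν * disagree f ν (rep ν))
    totalBad-nodes = trans (∑-cong (allFin n) (λ x → sym (∑-*ˡ (matrices k) (W x) _)))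
      (sym (∑-cartesian _,_ (allFin n) (matrices k) (λ ν → wt ν * disagree f ν (rep ν))))

    -- Both sides are sums over pairs in a common class, once against the representative and
    -- once against a random member.
    rejects : (M !) * totalBad ≤ rejectCount tests f
    rejects = begin
      (M !) * totalBad
        ≡⟨ cong (λ z → (M !) * z) totalBad-nodes ⟩
      (M !) * ∑ nodes (λ ν → wt ν * disagree f ν (rep ν))
        ≡⟨ ∑-class (λ ν → disagree f ν (rep ν)) ⟨
      ∑ nodes (λ ν → ∑ nodes (λ ν′ → mult ν ν′ * disagree f ν (rep ν)))
        ≡⟨ ∑-swap nodes nodes _ ⟩
      ∑ nodes (λ ν′ → ∑ nodes (λ ν → mult ν ν′ * disagree f ν (rep ν)))
        ≡⟨ ∑-cong nodes (λ ν′ → trans (∑-cong nodes (λ ν → move ν ν′)) (∑-*ˡ nodes (wt ν′ * coeff (sig ν′)) (λ ν → same (sig ν′) (sig ν) * (wt ν * disagree f ν (rep ν′))))) ⟩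
      ∑ nodes (λ ν′ → wt ν′ * coeff (sig ν′) * cost (sig ν′) (rep ν′))
        ≤⟨ ∑-mono nodes (λ ν′ → *-monoʳ-≤ (wt ν′ * coeff (sig ν′)) (rep-min ν′)) ⟩
      ∑ nodes (λ ν′ → wt ν′ * coeff (sig ν′) * cost (sig ν′) ν′)
        ≡⟨ ∑-cong nodes (λ ν′ → trans (sym (∑-*ˡ nodes (wt ν′ * coeff (sig ν′)) (λ ν → same (sig ν′) (sig ν) * (wt ν * disagree f ν ν′)))) (∑-cong nodes (λ ν → sym (move′ ν ν′ (disagree f ν ν′))))) ⟩
      ∑ nodes (λ ν′ → ∑ nodes (λ ν → mult ν ν′ * disagree f ν ν′))
        ≡⟨ ∑-swap nodes nodes _ ⟩
      ∑ nodes (λ ν → ∑ nodes (λ ν′ → mult ν ν′ * disagree f ν ν′))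
        ≡⟨ rejectCount-tests f ⟨
      rejectCount tests f ∎
      where
      open ≤-Reasoning
      open +-*-Solver
      move′ : ∀ ν ν′ d → mult ν ν′ * d ≡ wt ν′ * coeff (sig ν′) * (same (sig ν′) (sig ν) * (wt ν * d))
      move′ ν ν′ d = trans
        (solve 5 (λ s w w′ c d → s :* (w :* (w′ :* c)) :* d := s :* c :* (w :* w′ :* d)) refl
          (same (sig ν) (sig ν′)) (wt ν) (wt ν′) (coeff (sig ν)) d)
        (trans (cong (λ z → z * (wt ν * wt ν′ * d)) (trans (same-subst (sig ν) (sig ν′) coeff) (cong (λ z → z * coeff (sig ν′)) (same-sym (sig ν) (sig ν′)))))
          (solve 5 (λ s w w′ c d → s :* c :* (w :* w′ :* d) := w′ :* c :* (s :* (w :* d))) refl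
            (same (sig ν′) (sig ν)) (wt ν) (wt ν′) (coeff (sig ν′)) d))
      move : ∀ ν ν′ → mult ν ν′ * disagree f ν (rep ν) ≡
             wt ν′ * coeff (sig ν′) * (same (sig ν′) (sig ν) * (wt ν * disagree f ν (rep ν′)))
      move ν ν′ = trans (move′ ν ν′ _) (cong (λ z → wt ν′ * coeff (sig ν′) * z) same-rep)
        where
        same-rep : same (sig ν′) (sig ν) * (wt ν * disagree f ν (rep ν)) ≡ same (sig ν′) (sig ν) * (wt ν * disagree f ν (rep ν′))
        same-rep with sig ν′ ≟ˢ sig ν
        ... | yes eq = cong (λ μ → 1 * (wt ν * disagree f ν μ)) (rep-cong ν ν′ (sym eq))
        ... | no _   = refl

    good : List (Fin n)
    good = filter (λ x → badness x ℕ.≟ 0) (allFin n)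

    disagree-0 : ∀ ν ν′ → disagree f ν ν′ ≡ 0 → Agree ν ν′ (f (proj₁ ν)) (f (proj₁ ν′))
    disagree-0 ν ν′ = ind-not-does (agree? ν ν′ (f (proj₁ ν)) (f (proj₁ ν′)))

    good-agree : ∀ {x} → x ∈ good → ∀ θ → Agree (x , θ) (rep (x , θ)) (f x) (f (proj₁ (rep (x , θ))))
    good-agree {x} x∈ θ = disagree-0 (x , θ) (rep (x , θ)) (n≤0⇒n≡0 (≤-trans
      (∈⇒≤∑ (λ θ → disagree f (x , θ) (rep (x , θ))) (∈-matrices θ))
      (≤-reflexive (proj₂ (∈-filter⁻ (λ x → badness x ℕ.≟ 0) {xs = allFin n} x∈)))))

    -- The two nodes have equal signatures, hence a common representative μ, and the keys of f x and
    -- f y both equal the key of the value of f at μ.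
    good-pairs : HasMaltsevPolymorphism S → ∀ {x y} → x ∈ good → y ∈ good → R x y (f x) (f y)
    good-pairs malt {x} {y} x∈ y∈ =
      let rx , kx = good-agree x∈ (proj₂ (leftNode x y))
          ry , ky = good-agree y∈ (proj₂ (leftNode y x))
          eq = rep-cong (leftNode x y) (leftNode y x) (sig-leftNode malt x y)
      in agree⇒R malt rx ry (trans kx (trans (cong (λ μ → key μ (f (proj₁ μ))) eq) (sym ky)))

    repair : HasMajorityPolymorphism S → HasMaltsevPolymorphism S → Satisfiable I →
             ∃ λ g → Satisfies I g × (∀ {x} → x ∈ good → g x ≡ f x)
    repair maj malt (g₀ , h₀) = from good id
      where
      from : ∀ xs → (∀ {z} → z ∈ xs → z ∈ good) → ∃ λ g → Satisfies I g × (∀ {x} → x ∈ xs → g x ≡ f x)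
      -- `extend-pairs` has to be given members of the list; if no variable is good, any solution
      -- serves.
      from []       sub = g₀ , h₀ , λ ()
      from (x ∷ xs) sub =
        let g , h , e , _ , _ = extend-pairs maj f good (good-pairs malt) (x ∷ xs) sub (sub (here refl)) (sub (here refl))
        in g , h , e

    module _ (d : ℕ) (w≡ : ∀ x → weight I x ≡ frac (W x) d) where

      -- A variable on which f and g differ is not good, so its badness is at least 1.
      dist≤totalBad : ∀ {g} → (∀ {x} → x ∈ good → g x ≡ f x) → dist I f g ℚ.≤ frac totalBad d
      dist≤totalBad {g} agree = subst (ℚ._≤ frac totalBad d) (sym dist≡)
        (frac-≤ (∑ (allFin n) moved) d totalBad d (*-monoˡ-≤ (suc d) (∑-mono (allFin n) moved≤)))
        where
        moved : Fin n → ℕ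
        moved x = if does (f x Fin.≟ g x) then 0 else W x
        dist≡ : dist I f g ≡ frac (∑ (allFin n) moved) d
        dist≡ = trans (sumFin-cong n each) (sumFin-frac n moved d)
          where
          each : ∀ x → (if does (f x Fin.≟ g x) then 0ℚ else weight I x) ≡ frac (moved x) d
          each x with does (f x Fin.≟ g x)
          ... | true  = sym (frac-0 d)
          ... | false = w≡ x
        moved≤ : ∀ x → moved x ≤ W x * badness x
        moved≤ x with f x Fin.≟ g x
        ... | yes _ = z≤n
        ... | no f≢g with badness x in eq
        ...   | zero  = ⊥-elim (f≢g (sym (agree (∈-filter⁺ (λ x → badness x ℕ.≟ 0) (∈-allFin x) eq))))
        ...   | suc b = m≤m*n (W x) (suc b)

-- One-sided testers with majority and Maltsev polymorphisms

amplify : ∀ {S n ε} (I : Instance S n) q (ts : List (Tree (Dom S) n)) E → 1 ≤ length ts → All (AtMostQueries q) ts →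
          (∀ f → Satisfies I f → rejectCount ts f ≡ 0) →
          (∀ f → Far I ε f → length ts ≤ rejectCount ts f * suc E) →
          ∃ λ ts′ → IsTester true I ε (2 * suc E * q) ts′
amplify {S} {n} {ε} I q ts E length>0 queries complete sound = P , nonempty , atMost-powT N queries , accepts , rejects-far
  where
  N = 2 * suc E
  P = powT ts N
  nonempty : ¬ (P ≡ [])
  nonempty eq = <⇒≢ (m^n>0 (length ts) {{>-nonZero length>0}} N) (sym (trans (sym (length-powT ts N)) (cong length eq)))
  accepts : ∀ f → Satisfies I f → AlwaysAccepts P f
  accepts f h = trans (acceptCount-powT ts N f) (trans (cong (_^ N) all) (sym (length-powT ts N)))
    where
    all : acceptCount ts f ≡ length ts
    all = trans (sym (+-identityʳ _)) (trans (cong (λ z → acceptCount ts f + z) (sym (complete f h))) (accept+reject ts f))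
  rejects-far : ∀ f → Far I ε f → RejectsWHP P f
  rejects-far f far = +-cancelˡ-≤ (length P) _ _ (begin
      length P + 2 * length P                          ≡⟨ cong (λ z → z + 2 * z) (sym (accept+reject P f)) ⟩
      a′ + r′ + 2 * (a′ + r′)                          ≡⟨ solve 2 (λ a r → a :+ r :+ con 2 :* (a :+ r) := con 3 :* a :+ con 3 :* r) refl a′ r′ ⟩
      3 * a′ + 3 * r′                                  ≡⟨ cong (λ z → 3 * z + 3 * r′) (acceptCount-powT ts N f) ⟩
      3 * a ^ N + 3 * r′                               ≤⟨ +-monoˡ-≤ (3 * r′) (amplification a r E (≤-trans (≤-reflexive (accept+reject ts f)) (sound f far))) ⟩
      (a + r) ^ N + 3 * r′                             ≡⟨ cong (λ z → z ^ N + 3 * r′) (accept+reject ts f) ⟩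
      length ts ^ N + 3 * r′                           ≡⟨ cong (λ z → z + 3 * r′) (sym (length-powT ts N)) ⟩
      length P + 3 * r′                                ∎)
    where
    open ≤-Reasoning
    open +-*-Solver
    a = acceptCount ts f
    r = rejectCount ts f
    a′ = acceptCount P f
    r′ = rejectCount P f

∈⇒1≤length : ∀ {xs : List X} {x} → x ∈ xs → 1 ≤ length xs
∈⇒1≤length {xs = _ ∷ _} _ = s≤s z≤n

module _ (S : Structure) (maj : HasMajorityPolymorphism S) (malt : HasMaltsevPolymorphism S) where

  private
    J : ℕ
    J = length (matrices (suc (size S)))

    J≥1 : 1 ≤ J
    J≥1 = ∈⇒1≤length (∈-matrices (matrixOf {suc (size S)} (λ _ _ → true)))

  -- For a far f, the total badness is at least (d + 1)/(e + 1), while the nodes have total weight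
  -- J(d + 1). So one test of two queries rejects with probability at least 1/((e + 1) J), which
  -- depends on A and ε only.
  one-sided-tester : ∀ p e n (I : Instance S n) → Satisfiable I →
    ∃ λ ts → IsTester true I (frac (suc p) e) (2 * suc (suc e * J) * 2) ts
  one-sided-tester p e n I sat with commonDenominator n (weight I) (weight-≥0 I)
  ... | W , d , w≡ = amplify I 2 tests (suc e * J) length>0 tests-queries tests-accept sound
    where
    open Tester S I W
    ∑W : ∑ (allFin n) W ≡ suc d
    ∑W = frac-injective _ _ d (trans (sym (sumFin-frac n W d)) (trans (sym (sumFin-cong n w≡)) (trans (weight-sum I) (sym (frac-1 d)))))
    M≡ : M ≡ J * suc d
    M≡ = trans (∑-cartesian _,_ (allFin n) (matrices k) wt) (trans (∑-cong (allFin n) (λ x → ∑-const (matrices k) (W x)))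
      (trans (∑-*ˡ (allFin n) J W) (cong (λ z → J * z) ∑W)))
    length>0 : 1 ≤ length tests
    length>0 = subst (1 ≤_) (sym length-tests) (*-mono-≤ (1≤n! M)
      (subst (1 ≤_) (sym M≡) (*-mono-≤ J≥1 (s≤s z≤n))))
    sound : ∀ f → Far I (frac (suc p) e) f → length tests ≤ rejectCount tests f * suc (suc e * J)
    sound f far = begin
        length tests                      ≡⟨ trans length-tests (cong (λ z → (M !) * z) M≡) ⟩
        (M !) * (J * suc d)               ≤⟨ *-monoʳ-≤ (M !) (*-monoʳ-≤ J far-count) ⟩
        (M !) * (J * (totalBad * suc e))  ≡⟨ solve 4 (λ m j t e → m :* (j :* (t :* (con 1 :+ e))) := m :* t :* ((con 1 :+ e) :* j)) refl (M !) J totalBad e ⟩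
        (M !) * totalBad * (suc e * J)    ≤⟨ *-mono-≤ rejects (n≤1+n (suc e * J)) ⟩
        rejectCount tests f * suc (suc e * J) ∎
      where
      open ≤-Reasoning
      open +-*-Solver
      open Soundness f
      far-count : suc d ≤ totalBad * suc e
      far-count =
        let g , h , agree = repair maj malt sat
        in ≤-trans (m≤m+n (suc d) (p * suc d)) (<⇒≤ (frac-<⁻¹ (suc p) e totalBad d (ℚ.<-≤-trans (far g h) (dist≤totalBad d w≡ agree))))

  majority+maltsev⇒testable : ConstantQueryTestableOneSided S
  majority+maltsev⇒testable ε 0<ε _ with nonNegative⇒frac ε (ℚ.<⇒≤ 0<ε)
  ... | zero  , e , refl = ⊥-elim (ℚ.<-irrefl (sym (frac-0 e)) 0<ε)
  ... | suc p , e , refl = _ , one-sided-tester p e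

-- Vectors of residues modulo m′ + 1

incIf : ∀ m′ → Bool → ℕ → ℕ
incIf m′ true  j = suc j % suc m′
incIf m′ false j = j

shift : ∀ m′ {L} → Vec Bool L → Vec ℕ L → Vec ℕ L
shift m′ = Vec.zipWith (incIf m′)

residues : ℕ → ∀ L → List (Vec ℕ L)
residues m′ L = allVecs (upTo (suc m′)) L

∑-upTo-suc : ∀ m (ψ : ℕ → ℕ) → ∑ (upTo (suc m)) ψ ≡ ∑ (upTo m) ψ + ψ m
∑-upTo-suc m ψ = trans (cong (λ xs → ∑ xs ψ) (sym (List.upTo-∷ʳ m)))
  (trans (∑-++ (upTo m) (m ∷ []) ψ) (cong (λ t → ∑ (upTo m) ψ + t) (+-identityʳ (ψ m))))

∑-applyUpTo : ∀ m (h ψ : ℕ → ℕ) → ∑ (applyUpTo h m) ψ ≡ ∑ (upTo m) (ψ ∘ h)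
∑-applyUpTo zero    h ψ = refl
∑-applyUpTo (suc m) h ψ = cong (λ t → ψ (h 0) + t)
  (trans (∑-applyUpTo m (h ∘ suc) ψ) (sym (∑-applyUpTo m suc (ψ ∘ h))))

∑-rotate : ∀ m′ b (ψ : ℕ → ℕ) → ∑ (upTo (suc m′)) (ψ ∘ incIf m′ b) ≡ ∑ (upTo (suc m′)) ψ
∑-rotate m′ false ψ = refl
∑-rotate m′ true  ψ = begin
  ∑ (upTo (suc m′)) (λ j → ψ (suc j % suc m′))             ≡⟨ ∑-upTo-suc m′ _ ⟩
  ∑ (upTo m′) (λ j → ψ (suc j % suc m′)) + ψ (suc m′ % suc m′)
    ≡⟨ cong₂ _+_ (∑-cong-∈ (upTo m′) (λ j∈ → cong ψ (m<n⇒m%n≡m (s≤s (upTo< j∈))))) (cong ψ (n%n≡0 (suc m′))) ⟩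
  ∑ (upTo m′) (λ j → ψ (suc j)) + ψ 0                       ≡⟨ +-comm _ (ψ 0) ⟩
  ψ 0 + ∑ (upTo m′) (λ j → ψ (suc j))                       ≡⟨ cong (λ t → ψ 0 + t) (sym (∑-applyUpTo m′ suc ψ)) ⟩
  ∑ (upTo (suc m′)) ψ                                        ∎
  where
  open ≡-Reasoning
  upTo< : ∀ {j} → j ∈ upTo m′ → j < m′
  upTo< = ∈-upTo⁻

-- Shifting permutes the residue vectors, so a uniform ω may be replaced by its shift; this is why
-- the two families of assignments can look alike.
∑-shift : ∀ m′ {L} (ρ : Vec Bool L) (φ : Vec ℕ L → ℕ) → ∑ (residues m′ L) (φ ∘ shift m′ ρ) ≡ ∑ (residues m′ L) φ
∑-shift m′ []      φ = refl
∑-shift m′ {suc L} (b ∷ ρ) φ = begin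
  ∑ (residues m′ (suc L)) (φ ∘ shift m′ (b ∷ ρ))
    ≡⟨ ∑-cartesian _∷_ (upTo (suc m′)) (residues m′ L) (φ ∘ shift m′ (b ∷ ρ)) ⟩
  ∑ (upTo (suc m′)) (λ j → ∑ (residues m′ L) (λ ω → φ (incIf m′ b j ∷ shift m′ ρ ω)))
    ≡⟨ ∑-cong (upTo (suc m′)) (λ j → ∑-shift m′ ρ (λ ω → φ (incIf m′ b j ∷ ω))) ⟩
  ∑ (upTo (suc m′)) (λ j → ∑ (residues m′ L) (λ ω → φ (incIf m′ b j ∷ ω)))
    ≡⟨ ∑-rotate m′ b (λ j → ∑ (residues m′ L) (λ ω → φ (j ∷ ω))) ⟩
  ∑ (upTo (suc m′)) (λ j → ∑ (residues m′ L) (λ ω → φ (j ∷ ω)))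
    ≡⟨ ∑-cartesian _∷_ (upTo (suc m′)) (residues m′ L) φ ⟨
  ∑ (residues m′ (suc L)) φ ∎
  where open ≡-Reasoning

length-residues>0 : ∀ m′ L → 1 ≤ length (residues m′ L)
length-residues>0 m′ zero    = ≤-refl
length-residues>0 m′ (suc L) with residues m′ L | length-residues>0 m′ L
... | _ ∷ _ | _ = s≤s z≤n

-- Queried variables

-- All branches are followed. This replaces an adaptive tree by a set of variables fixed in advance,
-- whose size is still bounded in terms of q and |A|.
queried : ∀ {k n} → Tree (Fin k) n → List (Fin n)
queried         (leaf b)    = []
queried {k = k} (query x t) = x ∷ concatMap (λ a → queried (t a)) (allFin k)

queryBound : ℕ → ℕ → ℕ
queryBound k zero    = 0
queryBound k (suc q) = suc (k * queryBound k q)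

length-allFin : ∀ k → length (allFin k) ≡ k
length-allFin k = List.length-tabulate id

length-queried : ∀ {k n q} {t : Tree (Fin k) n} → AtMostQueries q t → length (queried t) ≤ queryBound k q
length-queried {t = leaf b}    leaf = z≤n
length-queried {k} {q = suc q} {t = query x t} (query h) = s≤s (begin
  length (concatMap (λ a → queried (t a)) (allFin k))                  ≡⟨ length-∑ (concatMap (λ a → queried (t a)) (allFin k)) ⟩
  ∑ (concatMap (λ a → queried (t a)) (allFin k)) (λ _ → 1)             ≡⟨ concatMap-∑ (λ a → queried (t a)) (allFin k) (λ _ → 1) ⟩
  ∑ (allFin k) (λ a → ∑ (queried (t a)) (λ _ → 1))                     ≤⟨ ∑-mono (allFin k) (λ a → ≤-trans (≤-reflexive (sym (length-∑ (queried (t a))))) (length-queried (h a))) ⟩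
  ∑ (allFin k) (λ _ → queryBound k q)                                  ≡⟨ trans (∑-const (allFin k) _) (cong (λ z → z * queryBound k q) (length-allFin k)) ⟩
  k * queryBound k q                                                    ∎)
  where open ≤-Reasoning

∈-concatMap : ∀ {h : X → List Y} {xs x y} → x ∈ xs → y ∈ h x → y ∈ concatMap h xs
∈-concatMap {h = h} x∈ y∈ = ∈-concatMap⁺ h (lose x∈ y∈)

run-queried : ∀ {k n} (t : Tree (Fin k) n) {f g} → (∀ {x} → x ∈ queried t → f x ≡ g x) → run t f ≡ run t g
run-queried (leaf b)    h = refl
run-queried (query x t) {f} {g} h rewrite h (here refl) =
  run-queried (t (g x)) (λ y∈ → h (there (∈-concatMap (∈-allFin (g x)) y∈)))

-- Averaged over the hidden index B and the random vector ω, the acceptance probabilities of the two families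
-- differ by at most 1/4, whereas a tester separates them by at least 1/3.

module _ {S : Structure} {n K L : ℕ} (I : Instance S n) (ε : ℚ) (q m′ : ℕ)
         (yesF noF : Fin K → Vec ℕ L → Assignment S n)
         (sat : ∀ B ω → Satisfies I (yesF B ω))
         (far : ∀ B {ω} → ω ∈ residues m′ L → Far I ε (noF B ω))
         (fool : ∀ (W : List (Fin n)) → length W ≤ queryBound (suc (size S)) q →
                 ∃ λ (bad : Fin K → Bool) → 4 * ∑ (allFin K) (ind ∘ bad) ≤ K ×
                   (∀ B → bad B ≡ false → ∃ λ ρ → ∀ ω {x} → x ∈ W → noF B ω x ≡ yesF B (shift m′ ρ ω) x))
         (K≥1 : 1 ≤ K) where

  private
    Ω = residues m′ L
    N = length Ω

  accept-≤ : ∀ t → AtMostQueries q t →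
    4 * ∑ (allFin K) (λ B → ∑ Ω (λ ω → ind (run t (yesF B ω)))) ≤
    4 * ∑ (allFin K) (λ B → ∑ Ω (λ ω → ind (run t (noF B ω)))) + K * N
  accept-≤ t atMost with fool (queried t) (length-queried atMost)
  ... | bad , few , good = begin
      4 * ∑ (allFin K) (λ B → ∑ Ω (λ ω → ind (run t (yesF B ω))))
        ≤⟨ *-monoʳ-≤ 4 (∑-mono (allFin K) each) ⟩
      4 * ∑ (allFin K) (λ B → ∑ Ω (λ ω → ind (run t (noF B ω))) + ind (bad B) * N)
        ≡⟨ cong (4 *_) (trans (∑-+ (allFin K) (λ B → ∑ Ω (λ ω → ind (run t (noF B ω)))) (λ B → ind (bad B) * N))
             (cong (λ z → ∑ (allFin K) (λ B → ∑ Ω (λ ω → ind (run t (noF B ω)))) + z) (∑-*ʳ (allFin K) N (ind ∘ bad)))) ⟩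
      4 * (∑ (allFin K) (λ B → ∑ Ω (λ ω → ind (run t (noF B ω)))) + ∑ (allFin K) (ind ∘ bad) * N)
        ≡⟨ trans (*-distribˡ-+ 4 (∑ (allFin K) (λ B → ∑ Ω (λ ω → ind (run t (noF B ω))))) (∑ (allFin K) (ind ∘ bad) * N))
             (cong (λ z → 4 * ∑ (allFin K) (λ B → ∑ Ω (λ ω → ind (run t (noF B ω)))) + z) (sym (*-assoc 4 (∑ (allFin K) (ind ∘ bad)) N))) ⟩
      4 * ∑ (allFin K) (λ B → ∑ Ω (λ ω → ind (run t (noF B ω)))) + 4 * ∑ (allFin K) (ind ∘ bad) * N
        ≤⟨ +-monoʳ-≤ (4 * ∑ (allFin K) (λ B → ∑ Ω (λ ω → ind (run t (noF B ω))))) (*-monoˡ-≤ N few) ⟩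
      4 * ∑ (allFin K) (λ B → ∑ Ω (λ ω → ind (run t (noF B ω)))) + K * N ∎
    where
    open ≤-Reasoning
    each : ∀ B → ∑ Ω (λ ω → ind (run t (yesF B ω))) ≤ ∑ Ω (λ ω → ind (run t (noF B ω))) + ind (bad B) * N
    each B with bad B in eq
    ... | true  = ≤-trans (≤-trans (∑-mono Ω (λ ω → ind≤1 (run t (yesF B ω)))) (≤-reflexive (trans (sym (length-∑ Ω)) (sym (+-identityʳ N))))) (m≤n+m (N + 0) (∑ Ω (λ ω → ind (run t (noF B ω)))))
    -- On a good index the tree sees the far assignment of ω as the satisfying one of the shifted ω,
    -- and the shift preserves the sum over ω.
    ... | false = let ρ , same = good B eq in
      ≤-trans (≤-reflexive (trans (sym (∑-shift m′ ρ (λ ω → ind (run t (yesF B ω)))))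
        (∑-cong Ω (λ ω → cong ind (run-queried t (λ x∈ → sym (same ω x∈))))))) (m≤m+n _ _)

  no-tester : ∀ ts → ¬ IsTester false I ε q ts
  no-tester ts (nonempty , atMost , accepts , rejects) = <⇒≱ T>0 (+-cancelˡ-≤ (7 * T) T 0 (begin
      7 * T + T              ≡⟨ solve 1 (λ t → con 7 :* t :+ t := con 4 :* (con 2 :* t)) refl T ⟩
      4 * (2 * T)            ≤⟨ *-monoʳ-≤ 4 yes-bound ⟩
      4 * (3 * accY)            ≡⟨ solve 1 (λ y → con 4 :* (con 3 :* y) := con 3 :* (con 4 :* y)) refl accY ⟩
      3 * (4 * accY)            ≤⟨ *-monoʳ-≤ 3 gap ⟩
      3 * (4 * accN + T)       ≡⟨ solve 2 (λ z t → con 3 :* (con 4 :* z :+ t) := con 4 :* (con 3 :* z) :+ con 3 :* t) refl accN T ⟩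
      4 * (3 * accN) + 3 * T   ≤⟨ +-monoˡ-≤ (3 * T) (*-monoʳ-≤ 4 no-bound) ⟩
      4 * T + 3 * T          ≡⟨ solve 1 (λ t → con 4 :* t :+ con 3 :* t := con 7 :* t :+ con 0) refl T ⟩
      7 * T + 0              ∎))
    where
    open ≤-Reasoning
    open +-*-Solver
    T = K * (N * length ts)
    sumΩ : (Fin K → Vec ℕ L → ℕ) → ℕ
    sumΩ h = ∑ (allFin K) (λ B → ∑ Ω (h B))
    accY  = sumΩ (λ B ω → acceptCount ts (yesF B ω))
    accN = sumΩ (λ B ω → acceptCount ts (noF B ω))
    sumΩ-const : ∀ c → sumΩ (λ _ _ → c) ≡ K * (N * c)
    sumΩ-const c = trans (∑-cong (allFin K) (λ _ → ∑-const Ω c)) (trans (∑-const (allFin K) _) (cong (λ z → z * (N * c)) (length-allFin K)))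
    sumΩ-mono : ∀ {h h′} → (∀ B ω → h B ω ≤ h′ B ω) → sumΩ h ≤ sumΩ h′
    sumΩ-mono le = ∑-mono (allFin K) (λ B → ∑-mono Ω (le B))
    sumΩ-* : ∀ c h → sumΩ (λ B ω → c * h B ω) ≡ c * sumΩ h
    sumΩ-* c h = trans (∑-cong (allFin K) (λ B → ∑-*ˡ Ω c (h B))) (∑-*ˡ (allFin K) c _)
    swapped : ∀ (F : Fin K → Vec ℕ L → Assignment S n) →
      sumΩ (λ B ω → acceptCount ts (F B ω)) ≡ ∑ ts (λ t → sumΩ (λ B ω → ind (run t (F B ω))))
    swapped F = trans (∑-cong (allFin K) (λ B → trans (∑-cong Ω (λ ω → acceptCount-∑ ts (F B ω))) (∑-swap Ω ts _))) (∑-swap (allFin K) ts _)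
    length>0 : ∀ (us : List (Tree (Dom S) n)) → ¬ (us ≡ []) → 1 ≤ length us
    length>0 []      ne = ⊥-elim (ne refl)
    length>0 (_ ∷ _) ne = s≤s z≤n
    T>0 : 0 < T
    T>0 = *-mono-≤ K≥1 (*-mono-≤ (length-residues>0 m′ L) (length>0 ts nonempty))
    yes-bound : 2 * T ≤ 3 * accY
    yes-bound = begin
      2 * T                               ≡⟨ trans (cong (2 *_) (sym (sumΩ-const (length ts)))) (sym (sumΩ-* 2 (λ _ _ → length ts))) ⟩
      sumΩ (λ _ _ → 2 * length ts)        ≤⟨ sumΩ-mono (λ B ω → accepts (yesF B ω) (sat B ω)) ⟩
      sumΩ (λ B ω → 3 * acceptCount ts (yesF B ω)) ≡⟨ sumΩ-* 3 _ ⟩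
      3 * accY                               ∎
    no-bound : 3 * accN ≤ T
    no-bound = begin
      3 * accN                              ≡⟨ sym (sumΩ-* 3 _) ⟩
      sumΩ (λ B ω → 3 * acceptCount ts (noF B ω)) ≤⟨ ∑-mono (allFin K) (λ B → ∑-mono-∈ Ω (λ {ω} ω∈ → third (noF B ω) (rejects (noF B ω) (far B ω∈)))) ⟩
      sumΩ (λ _ _ → length ts)            ≡⟨ sumΩ-const (length ts) ⟩
      T                                   ∎
      where
      third : ∀ f → RejectsWHP ts f → 3 * acceptCount ts f ≤ length ts
      third f rej = +-cancelʳ-≤ (2 * length ts) _ _ (begin
        3 * a + 2 * length ts   ≤⟨ +-monoʳ-≤ (3 * a) rej ⟩
        3 * a + 3 * r           ≡⟨ solve 2 (λ a r → con 3 :* a :+ con 3 :* r := a :+ r :+ con 2 :* (a :+ r)) refl a r ⟩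
        a + r + 2 * (a + r)     ≡⟨ cong (λ z → z + 2 * z) (accept+reject ts f) ⟩
        length ts + 2 * length ts ∎)
        where
        a = acceptCount ts f
        r = rejectCount ts f
    gap : 4 * accY ≤ 4 * accN + T
    gap = begin
      4 * accY ≡⟨ trans (cong (4 *_) (swapped yesF)) (sym (∑-*ˡ ts 4 _)) ⟩
      ∑ ts (λ t → 4 * sumΩ (λ B ω → ind (run t (yesF B ω))))
        ≤⟨ ∑-mono-∈ ts (λ t∈ → accept-≤ _ (All.lookup atMost t∈)) ⟩
      ∑ ts (λ t → 4 * sumΩ (λ B ω → ind (run t (noF B ω))) + K * N)
        ≡⟨ ∑-+ ts _ _ ⟩
      ∑ ts (λ t → 4 * sumΩ (λ B ω → ind (run t (noF B ω)))) + ∑ ts (λ _ → K * N)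
        ≡⟨ cong₂ _+_ (trans (∑-*ˡ ts 4 _) (cong (4 *_) (sym (swapped noF)))) (trans (∑-const ts (K * N)) (trans (*-comm (length ts) (K * N)) (*-assoc K N (length ts)))) ⟩
      4 * accN + T ∎

-- Counting conflicting indices

length-concatMap≤ : ∀ (h : X → List Y) c xs → (∀ x → length (h x) ≤ c) → length (concatMap h xs) ≤ length xs * c
length-concatMap≤ h c []       le = z≤n
length-concatMap≤ h c (x ∷ xs) le = ≤-trans (≤-reflexive (List.length-++ (h x))) (+-mono-≤ (le x) (length-concatMap≤ h c xs le))

-- An atom is a piece of the hidden assignment that a variable depends on, and `C p p′ B` says that
-- seeing p together with p′ could expose the hidden index B. As each pair exposes at most one
-- index, a union bound over pairs suffices.
module _ {At : Set} {K : ℕ} (C : At → At → Fin K → Set) (C? : ∀ p p′ B → Dec (C p p′ B))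
         (unique : ∀ p p′ {B B′} → C p p′ B → C p p′ B′ → B ≡ B′) where

  conflicting : List At → Fin K → Bool
  conflicting As B = does (any? (λ p → any? (λ p′ → C? p p′ B) As) As)

  ∑-unique : ∀ {k} (P : Fin k → Set) (P? : ∀ B → Dec (P B)) → (∀ {B B′} → P B → P B′ → B ≡ B′) →
             ∑ (allFin k) (λ B → ind (does (P? B))) ≤ 1
  ∑-unique {zero}  P P? u = z≤n
  ∑-unique {suc k} P P? u = ≤-trans (≤-reflexive (∑-allFin-suc (λ B → ind (does (P? B))))) go
    where
    go : ind (does (P? zero)) + ∑ (allFin k) (λ B → ind (does (P? (suc B)))) ≤ 1
    go with P? zero
    ... | no  _ = ∑-unique (P ∘ suc) (P? ∘ suc) (λ p p′ → Fin.suc-injective (u p p′))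
    ... | yes p = ≤-reflexive (cong suc (trans (∑-cong (allFin k) none) (∑-0 (allFin k))))
      where
      none : ∀ B → ind (does (P? (suc B))) ≡ 0
      none B with P? (suc B)
      ... | no  _  = refl
      ... | yes p′ = ⊥-elim (Fin.0≢1+n (u p p′))

  ind-any : ∀ {P : X → Set} (P? : ∀ x → Dec (P x)) xs → ind (does (any? P? xs)) ≤ ∑ xs (λ x → ind (does (P? x)))
  ind-any P? []       = z≤n
  ind-any P? (x ∷ xs) with does (P? x)
  ... | true  = s≤s z≤n
  ... | false = ind-any P? xs

  few-conflicts : ∀ As → ∑ (allFin K) (ind ∘ conflicting As) ≤ length As * length As
  few-conflicts As = begin
    ∑ (allFin K) (ind ∘ conflicting As)
      ≤⟨ ∑-mono (allFin K) (λ B → ≤-trans (ind-any (λ p → any? (λ p′ → C? p p′ B) As) As) (∑-mono As (λ p → ind-any (λ p′ → C? p p′ B) As))) ⟩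
    ∑ (allFin K) (λ B → ∑ As (λ p → ∑ As (λ p′ → ind (does (C? p p′ B)))))
      ≡⟨ trans (∑-swap (allFin K) As _) (∑-cong As (λ p → ∑-swap (allFin K) As _)) ⟩
    ∑ As (λ p → ∑ As (λ p′ → ∑ (allFin K) (λ B → ind (does (C? p p′ B)))))
      ≤⟨ ∑-mono As (λ p → ∑-mono As (λ p′ → ∑-unique (C p p′) (C? p p′) (unique p p′))) ⟩
    ∑ As (λ p → ∑ As (λ p′ → 1))
      ≡⟨ trans (∑-cong As (λ p → sym (length-∑ As))) (∑-const As (length As)) ⟩
    length As * length As ∎
    where open ≤-Reasoning

  no-conflict : ∀ As B → conflicting As B ≡ false → ∀ p p′ → p ∈ As → p′ ∈ As → ¬ C p p′ B
  no-conflict As B eq p p′ p∈ p′∈ c with trans (sym (dec-true (any? (λ p → any? (λ p′ → C? p p′ B) As) As) (lose p∈ (lose p′∈ c)))) eq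
  ... | ()

  -- A variable depends on at most two atoms, so Q variables yield at most 2Q atoms and 4Q² bad
  -- indices. With at least 16Q² indices these are at most a quarter.
  few-conflicts-queried : ∀ Q (h : X → List At) → (∀ x → length (h x) ≤ 2) → ∀ W → length W ≤ Q →
    4 * ∑ (allFin K) (ind ∘ conflicting (concatMap h W)) ≤ 16 * (Q * Q)
  few-conflicts-queried Q h h≤2 W len = begin
    4 * ∑ (allFin K) (ind ∘ conflicting As)  ≤⟨ *-monoʳ-≤ 4 (few-conflicts As) ⟩
    4 * (length As * length As)              ≤⟨ *-monoʳ-≤ 4 (*-mono-≤ lenAs lenAs) ⟩
    4 * (Q * 2 * (Q * 2))                    ≡⟨ solve 1 (λ q → con 4 :* (q :* con 2 :* (q :* con 2)) := con 16 :* (q :* q)) refl Q ⟩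
    16 * (Q * Q)                             ∎
    where
    open ≤-Reasoning
    open +-*-Solver
    As = concatMap h W
    lenAs : length As ≤ Q * 2
    lenAs = ≤-trans (length-concatMap≤ h 2 W h≤2) (*-monoˡ-≤ 2 len)

-- Codes of finite types

-- An embedding into `Fin card` with a left inverse is enough: a code without preimage would be a
-- variable of weight 0 that occurs in no constraint.
record Finite (X : Set) : Set where
  field
    card    : ℕ
    enc     : X → Fin card
    dec     : Fin card → X
    dec-enc : ∀ x → dec (enc x) ≡ x

open Finite

retract : Finite X → (f : Y → X) (g : X → Y) → (∀ y → g (f y) ≡ y) → Finite Y
retract F f g gf = record
  { card = card F ; enc = enc F ∘ f ; dec = g ∘ dec F
  ; dec-enc = λ y → trans (cong g (dec-enc F (f y))) (gf y) }

finFin : ∀ k → Finite (Fin k)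
finFin k = record { card = k ; enc = id ; dec = id ; dec-enc = λ _ → refl }

finBool : Finite Bool
finBool = record { card = 2 ; enc = λ { true → zero ; false → suc zero } ; dec = λ { zero → true ; (suc _) → false }
                 ; dec-enc = λ { true → refl ; false → refl } }

fin× : Finite X → Finite Y → Finite (X × Y)
fin× F G = record
  { card = card F * card G
  ; enc = λ (x , y) → Fin.combine (enc F x) (enc G y)
  ; dec = λ i → let a , b = Fin.remQuot (card G) i in dec F a , dec G b
  ; dec-enc = λ (x , y) → trans (cong (λ (a , b) → dec F a , dec G b) (Fin.remQuot-combine (enc F x) (enc G y)))
                            (cong₂ _,_ (dec-enc F x) (dec-enc G y)) }

fin⊎ : Finite X → Finite Y → Finite (X ⊎ Y)
fin⊎ F G = record
  { card = card F + card G
  ; enc = λ z → Fin.join _ _ (Data.Sum.map (enc F) (enc G) z)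
  ; dec = λ i → Data.Sum.map (dec F) (dec G) (Fin.splitAt (card F) i)
  ; dec-enc = λ z → trans (cong (Data.Sum.map (dec F) (dec G)) (Fin.splitAt-join (card F) (card G) (Data.Sum.map (enc F) (enc G) z))) (back z) }
  where
  back : ∀ z → Data.Sum.map (dec F) (dec G) (Data.Sum.map (enc F) (enc G) z) ≡ z
  back (inj₁ x) = cong inj₁ (dec-enc F x)
  back (inj₂ y) = cong inj₂ (dec-enc G y)

finVec : Finite X → ∀ n → Finite (Vec X n)
finVec F zero    = retract (finFin 1) (λ _ → zero) (λ _ → []) (λ { [] → refl })
finVec F (suc n) = retract (fin× F (finVec F n)) (λ { (x ∷ v) → x , v }) (λ (x , v) → x ∷ v) (λ { (x ∷ v) → refl })

elements : Finite X → List X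
elements F = map (dec F) (allFin (card F))

∈-elements : ∀ (F : Finite X) x → x ∈ elements F
∈-elements F x = subst (_∈ elements F) (dec-enc F x)
  (∈-map⁺ (dec F) (∈-allFin (enc F x)))

-- Composition of polymorphisms

Op₃ : Structure → Set
Op₃ S = Dom S → Dom S → Dom S → Dom S

π₁ π₂ π₃ : {A : Set} → A → A → A → A
π₁ a b c = a
π₂ a b c = b
π₃ a b c = c

module _ {S : Structure} where

  pol-resp : ∀ {g h : Op₃ S} → (∀ a b c → g a b c ≡ h a b c) → IsPolymorphism₃ S g → IsPolymorphism₃ S h
  pol-resp eq pol {R} R∈ t₁ t₂ t₃ h₁ h₂ h₃ =
    trans (cong (holds R) (Vec.tabulate-cong (λ i → sym (eq (lookup t₁ i) (lookup t₂ i) (lookup t₃ i))))) (pol R∈ t₁ t₂ t₃ h₁ h₂ h₃)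

  pol-comp : ∀ (g t₁ t₂ t₃ : Op₃ S) → IsPolymorphism₃ S g → IsPolymorphism₃ S t₁ → IsPolymorphism₃ S t₂ → IsPolymorphism₃ S t₃ →
             IsPolymorphism₃ S (λ a b c → g (t₁ a b c) (t₂ a b c) (t₃ a b c))
  pol-comp g t₁ t₂ t₃ pg p₁ p₂ p₃ {R} R∈ u v w hu hv hw =
    trans (cong (holds R) (Vec.tabulate-cong (λ i → sym (cong₃ (Vec.lookup∘tabulate (at t₁) i) (Vec.lookup∘tabulate (at t₂) i) (Vec.lookup∘tabulate (at t₃) i)))))
      (pg R∈ (Vec.tabulate (at t₁)) (Vec.tabulate (at t₂)) (Vec.tabulate (at t₃)) (p₁ R∈ u v w hu hv hw) (p₂ R∈ u v w hu hv hw) (p₃ R∈ u v w hu hv hw))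
    where
    at : Op₃ S → Fin (arity R) → Dom S
    at t i = t (lookup u i) (lookup v i) (lookup w i)
    cong₃ : ∀ {a a′ b b′ c c′} → a ≡ a′ → b ≡ b′ → c ≡ c′ → g a b c ≡ g a′ b′ c′
    cong₃ refl refl refl = refl

  pol-π₁ : IsPolymorphism₃ S π₁
  pol-π₁ {R} R∈ u v w hu hv hw = trans (cong (holds R) (Vec.tabulate∘lookup u)) hu

  pol-π₂ : IsPolymorphism₃ S π₂
  pol-π₂ {R} R∈ u v w hu hv hw = trans (cong (holds R) (Vec.tabulate∘lookup v)) hv

  pol-π₃ : IsPolymorphism₃ S π₃
  pol-π₃ {R} R∈ u v w hu hv hw = trans (cong (holds R) (Vec.tabulate∘lookup w)) hw

  -- A map u : A → A → A is regarded as the tuple (u a b) indexed by the pairs (a, b); Add is the relation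
  -- on tuples generated by (α, α, α), (β, α, β) and (α, β, β), where α a b = a and β a b = b.
  record Add (x y u : Dom S → Dom S → Dom S) : Set where
    constructor add
    field
      {op}  : Op₃ S
      pol   : IsPolymorphism₃ S op
      idem  : ∀ a → op a a a ≡ a
      op-x  : ∀ a b → op a b a ≡ x a b
      op-y  : ∀ a b → op a a b ≡ y a b
      op-u  : ∀ a b → op a b b ≡ u a b

-- Instances whose edges are copies of the instance that describes the ternary polymorphisms.  The variable
-- (a, b, c) of an edge is identified with an entry of the tuple of one of three nodes if two of a, b, c
-- coincide, and with the global variable const a if all of them do.

data Var (A Nd Ed : Set) : Set where
  const : A → Var A Nd Ed
  node  : Nd → A → A → Var A Nd Ed
  priv  : Ed → A → A → A → Var A Nd Ed

abstract
  finVar : ∀ {A Nd Ed} → Finite A → Finite Nd → Finite Ed → Finite (Var A Nd Ed)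
  finVar {A} {Nd} {Ed} FA FN FE = retract (fin⊎ FA (fin⊎ (fin× FN (fin× FA FA)) (fin× FE (fin× FA (fin× FA FA))))) to from
      λ { (const a) → refl ; (node ν a b) → refl ; (priv e a b c) → refl }
    where
    to : Var A Nd Ed → A ⊎ ((Nd × A × A) ⊎ (Ed × A × A × A))
    to (const a)      = inj₁ a
    to (node ν a b)   = inj₂ (inj₁ (ν , a , b))
    to (priv e a b c) = inj₂ (inj₂ (e , a , b , c))
    from : A ⊎ ((Nd × A × A) ⊎ (Ed × A × A × A)) → Var A Nd Ed
    from (inj₁ a)                      = const a
    from (inj₂ (inj₁ (ν , a , b)))     = node ν a b
    from (inj₂ (inj₂ (e , a , b , c))) = priv e a b c

∑-pick : ∀ {n} (i : Fin n) (h : Fin n → ℕ) → ∑ (allFin n) (λ x → ind (does (i Fin.≟ x)) * h x) ≡ h i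
∑-pick {n} i h = trans (∑-cong (allFin n) same) (trans (∑-*ʳ (allFin n) (h i) _) (trans (cong (λ z → z * h i) (∑-indicator-≟ i)) (*-identityˡ (h i))))
  where
  same : ∀ x → ind (does (i Fin.≟ x)) * h x ≡ ind (does (i Fin.≟ x)) * h i
  same x with i Fin.≟ x
  ... | yes refl = refl
  ... | no  _    = refl

-- With s = `size S` and k = s + 1, an instance has (r + 1)(1 + s + 8k²) marks: r + 1 for each of
-- the k constants and k² for each of 8(r + 1) nodes. A far assignment differs from every solution
-- on at least r + 1 of them, and the threshold is half of this fraction, independent of r.
gapDenominator : Structure → ℕ
gapDenominator S = suc (2 * (size S + 8 * (suc (size S) * suc (size S))))

threshold : Structure → ℚ
threshold S = frac 1 (gapDenominator S)

module Gadgets (S : Structure) {Nd Ed : Set} (FN : Finite Nd) (FE : Finite Ed)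
               (xN yN uN : Ed → Nd) (MN : List Nd) (r : ℕ) (lengthMN : length MN ≡ 8 * suc r) where

  k : ℕ
  k = suc (size S)

  V : Set
  V = Var (Dom S) Nd Ed

  FV : Finite V
  FV = finVar (finFin k) FN FE

  n : ℕ
  n = card FV

  code : V → Fin n
  code = enc FV

  gvar : Ed → Dom S → Dom S → Dom S → V
  gvar e a b c with a Fin.≟ b | b Fin.≟ c | a Fin.≟ c
  ... | yes _ | yes _ | _     = const a
  ... | yes _ | no  _ | _     = node (yN e) a c
  ... | no  _ | yes _ | _     = node (uN e) a b
  ... | no  _ | no  _ | yes _ = node (xN e) a b
  ... | no  _ | no  _ | no  _ = priv e a b c

  satTuples : ∀ (R : Rel (Dom S)) → List (Vec (Dom S) (arity R))
  satTuples R = filter (λ t → holds R t Bool.≟ true) (allVecs (allFin k) (arity R))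

  ∈-satTuples : ∀ (R : Rel (Dom S)) t → holds R t ≡ true → t ∈ satTuples R
  ∈-satTuples R t h = ∈-filter⁺ (λ t → holds R t Bool.≟ true) (∈-allVecs t (λ i → ∈-allFin _)) h

  -- These are the constraints of the indicator problem: they force the values on the variables of
  -- the edge, read as a map on triples, to preserve R.
  edgeConstraint : ∀ {R} → R ∈ Γ S → Ed → (t₁ t₂ t₃ : Vec (Dom S) (arity R)) → Constraint S n
  edgeConstraint {R} R∈ e t₁ t₂ t₃ = record
    { rel = R ; rel∈Γ = R∈ ; scope = Vec.tabulate (λ i → code (gvar e (lookup t₁ i) (lookup t₂ i) (lookup t₃ i))) }

  relConstraints : ∀ {R} → R ∈ Γ S → List (Constraint S n)
  relConstraints {R} R∈ = concatMap (λ e → concatMap (λ t₁ → concatMap (λ t₂ →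
    map (edgeConstraint R∈ e t₁ t₂) (satTuples R)) (satTuples R)) (satTuples R)) (elements FE)

  gather : ∀ Rs → (∀ {R} → R ∈ Rs → R ∈ Γ S) → List (Constraint S n)
  gather []       sub = []
  gather (R ∷ Rs) sub = relConstraints (sub (here refl)) ++ gather Rs (sub ∘ there)

  Holds : Assignment S n → Constraint S n → Set
  Holds f c = holds (rel c) (Vec.map f (scope c)) ≡ true

  gather⁺ : ∀ f Rs (sub : ∀ {R} → R ∈ Rs → R ∈ Γ S) →
            (∀ {R} (R∈ : R ∈ Γ S) e {t₁ t₂ t₃} → holds R t₁ ≡ true → holds R t₂ ≡ true → holds R t₃ ≡ true → Holds f (edgeConstraint R∈ e t₁ t₂ t₃)) →
            All (Holds f) (gather Rs sub)
  gather⁺ f []       sub h = []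
  gather⁺ f (R ∷ Rs) sub h = All.++⁺
    (All-concatMap (elements FE) (λ e → over (λ h₁ → over (λ h₂ → All.map⁺ (All.map (λ h₃ → h (sub (here refl)) e h₁ h₂ h₃) sat)))))
    (gather⁺ f Rs (sub ∘ there) h)
    where
    sat : All (λ t → holds R t ≡ true) (satTuples R)
    sat = All.all-filter (λ t → holds R t Bool.≟ true) (allVecs (allFin k) (arity R))
    over : ∀ {h : Vec (Dom S) (arity R) → List (Constraint S n)} → (∀ {t} → holds R t ≡ true → All (Holds f) (h t)) → All (Holds f) (concatMap h (satTuples R))
    over p = All.concat⁺ (All.map⁺ (All.map p sat))

  gather⁻ : ∀ f Rs (sub : ∀ {R} → R ∈ Rs → R ∈ Γ S) → All (Holds f) (gather Rs sub) →
            ∀ {R} → R ∈ Rs → ∀ e {t₁ t₂ t₃} → holds R t₁ ≡ true → holds R t₂ ≡ true → holds R t₃ ≡ true →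
            holds R (Vec.map f (Vec.tabulate (λ i → code (gvar e (lookup t₁ i) (lookup t₂ i) (lookup t₃ i))))) ≡ true
  gather⁻ f (R ∷ Rs) sub all (here refl) e {t₁} {t₂} {t₃} h₁ h₂ h₃ =
    All.lookup (All.++⁻ˡ (relConstraints (sub (here refl))) all)
      (∈-concatMap (∈-elements FE e) (∈-concatMap (∈-satTuples R t₁ h₁) (∈-concatMap (∈-satTuples R t₂ h₂)
        (∈-map⁺ (edgeConstraint (sub (here refl)) e t₁ t₂) (∈-satTuples R t₃ h₃)))))
  gather⁻ f (R ∷ Rs) sub all (there R∈) = gather⁻ f Rs (sub ∘ there) (All.++⁻ʳ (relConstraints (sub (here refl))) all) R∈

  -- The weight of a variable is its multiplicity in marks.  Each const a is marked as often as a far assignment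
  -- has to be changed on marked nodes, so that only solutions that map const a to a have to be considered.
  constMarks : Dom S → List V
  constMarks a = replicate (suc r) (const a)

  nodeMarks : Nd → List V
  nodeMarks ν = cartesianProductWith (node ν) (allFin k) (allFin k)

  marks : List V
  marks = concatMap constMarks (allFin k) ++ concatMap nodeMarks MN

  ∑-marks : ∀ (h : V → ℕ) → ∑ marks h ≡ ∑ (allFin k) (λ a → suc r * h (const a)) + ∑ MN (λ ν → ∑ (allFin k) (λ a → ∑ (allFin k) (λ b → h (node ν a b))))
  ∑-marks h = trans (∑-++ (concatMap constMarks (allFin k)) (concatMap nodeMarks MN) h) (cong₂ _+_
    (trans (concatMap-∑ constMarks (allFin k) h) (∑-cong (allFin k) (λ a → replicate-∑ (suc r) (const a) h)))
    (trans (concatMap-∑ nodeMarks MN h) (∑-cong MN (λ ν → ∑-cartesian (node ν) (allFin k) (allFin k) h))))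

  D : ℕ
  D = r + (size S * suc r + 8 * suc r * (k * k))

  ∑-marks-1 : ∑ marks (λ _ → 1) ≡ suc D
  ∑-marks-1 = trans (∑-marks (λ _ → 1)) (cong₂ _+_
    (trans (∑-const (allFin k) _) (cong₂ _*_ (length-allFin k) (*-identityʳ (suc r))))
    (trans (∑-const MN _) (cong₂ _*_ lengthMN (trans (∑-cong (allFin k) (λ _ → trans (sym (length-∑ (allFin k))) (length-allFin k)))
      (trans (∑-const (allFin k) k) (cong (λ z → z * k) (length-allFin k)))))) ■
    (solve 3 (λ s r kk → (con 1 :+ s) :* (con 1 :+ r) :+ con 8 :* (con 1 :+ r) :* kk := con 1 :+ (r :+ (s :* (con 1 :+ r) :+ con 8 :* (con 1 :+ r) :* kk))) refl (size S) r (k * k)))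
    where
    open +-*-Solver
    infixr 2 _■_
    _■_ : ∀ {a b c : ℕ} → a ≡ b → b ≡ c → a ≡ c
    _■_ = trans

  count : Fin n → ℕ
  count x = ∑ marks (λ v → ind (does (code v Fin.≟ x)))

  ∑-count : ∀ (h : Fin n → ℕ) → ∑ (allFin n) (λ x → count x * h x) ≡ ∑ marks (h ∘ code)
  ∑-count h = trans (∑-cong (allFin n) (λ x → sym (∑-*ʳ marks (h x) (λ v → ind (does (code v Fin.≟ x))))))
    (trans (∑-swap (allFin n) marks (λ x v → ind (does (code v Fin.≟ x)) * h x)) (∑-cong marks (λ v → ∑-pick (code v) h)))

  ∑-count-1 : ∑ (allFin n) count ≡ suc D
  ∑-count-1 = trans (∑-cong (allFin n) (λ x → sym (*-identityʳ (count x)))) (trans (∑-count (λ _ → 1)) ∑-marks-1)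

  I : Instance S n
  I = record
    { constraints = gather (Γ S) id
    ; weight      = λ x → frac (count x) D
    ; weight-≥0   = λ x → subst (ℚ._≤ frac (count x) D) (frac-0 D) (frac-≤ 0 D (count x) D z≤n)
    ; weight-≤1   = λ x → subst (frac (count x) D ℚ.≤_) (frac-1 D) (frac-≤ (count x) D (suc D) D
                      (*-monoˡ-≤ (suc D) (≤-trans (∈⇒≤∑ count (∈-allFin x)) (≤-reflexive ∑-count-1))))
    ; weight-sum  = trans (sumFin-frac n count D) (trans (cong (λ z → frac z D) ∑-count-1) (frac-1 D))
    }

  gadgetOp : Assignment S n → Ed → Op₃ S
  gadgetOp f e a b c = f (code (gvar e a b c))

  polymorphism⇒satisfies : ∀ f → (∀ e → IsPolymorphism₃ S (gadgetOp f e)) → Satisfies I f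
  polymorphism⇒satisfies f pol = gather⁺ f (Γ S) id λ {R} R∈ e {t₁} {t₂} {t₃} h₁ h₂ h₃ →
    trans (cong (holds R) (sym (Vec.tabulate-∘ f (λ i → code (gvar e (lookup t₁ i) (lookup t₂ i) (lookup t₃ i)))))) (pol e R∈ t₁ t₂ t₃ h₁ h₂ h₃)

  satisfies⇒polymorphism : ∀ f → Satisfies I f → ∀ e → IsPolymorphism₃ S (gadgetOp f e)
  satisfies⇒polymorphism f sat e {R} R∈ t₁ t₂ t₃ h₁ h₂ h₃ =
    trans (cong (holds R) (Vec.tabulate-∘ f (λ i → code (gvar e (lookup t₁ i) (lookup t₂ i) (lookup t₃ i))))) (gather⁻ f (Γ S) id sat R∈ e h₁ h₂ h₃)

  value : (Nd → Dom S → Dom S → Dom S) → (Ed → Op₃ S) → V → Dom S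
  value F T (const a)      = a
  value F T (node ν a b)   = F ν a b
  value F T (priv e a b c) = T e a b c

  assign : (Nd → Dom S → Dom S → Dom S) → (Ed → Op₃ S) → Assignment S n
  assign F T x = value F T (dec FV x)

  assign-code : ∀ F T v → assign F T (code v) ≡ value F T v
  assign-code F T v = cong (value F T) (dec-enc FV v)

  assign-satisfies : ∀ F T → (∀ e → IsPolymorphism₃ S (T e)) → (∀ e a → T e a a a ≡ a) →
    (∀ e a b → T e a b a ≡ F (xN e) a b) → (∀ e a b → T e a a b ≡ F (yN e) a b) → (∀ e a b → T e a b b ≡ F (uN e) a b) →
    Satisfies I (assign F T)
  assign-satisfies F T pol idem ex ey eu = polymorphism⇒satisfies (assign F T) λ e →
    pol-resp (λ a b c → trans (eq e a b c) (sym (assign-code F T (gvar e a b c)))) (pol e)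
    where
    eq : ∀ e a b c → T e a b c ≡ value F T (gvar e a b c)
    eq e a b c with a Fin.≟ b | b Fin.≟ c | a Fin.≟ c
    ... | yes refl | yes refl | _        = idem e a
    ... | yes refl | no  _    | _        = ey e a c
    ... | no  _    | yes refl | _        = eu e a b
    ... | no  _    | no  _    | yes refl = ex e a b
    ... | no  _    | no  _    | no  _    = refl

  -- `gvar` sends the diagonal to the constants, so no constraint mentions `node ν a a`. The
  -- diagonal is therefore filled in with a, the value under an idempotent operation.
  nodeval : Assignment S n → Nd → Dom S → Dom S → Dom S
  nodeval g ν a b = if does (a Fin.≟ b) then a else g (code (node ν a b))

  Standard : Assignment S n → Set
  Standard g = ∀ a → g (code (const a)) ≡ a

  satisfies⇒Add : ∀ g → Satisfies I g → Standard g → ∀ e → Add (nodeval g (xN e)) (nodeval g (yN e)) (nodeval g (uN e))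
  satisfies⇒Add g sat std e = add {op = gadgetOp g e} (satisfies⇒polymorphism g sat e) idem ex ey eu
    where
    idem : ∀ a → gadgetOp g e a a a ≡ a
    idem a with a Fin.≟ a
    ... | yes _ = std a
    ... | no ¬p = ⊥-elim (¬p refl)
    ex : ∀ a b → gadgetOp g e a b a ≡ nodeval g (xN e) a b
    ex a b with a Fin.≟ b | b Fin.≟ a | a Fin.≟ a
    ... | yes refl | yes _ | _     = std a
    ... | yes refl | no ¬p | _     = ⊥-elim (¬p refl)
    ... | no ¬p | yes refl | _     = ⊥-elim (¬p refl)
    ... | no _  | no _     | yes _ = refl
    ... | no _  | no _     | no ¬q = ⊥-elim (¬q refl)
    ey : ∀ a b → gadgetOp g e a a b ≡ nodeval g (yN e) a b
    ey a b with a Fin.≟ a | a Fin.≟ b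
    ... | yes _ | yes refl = std a
    ... | yes _ | no _     = refl
    ... | no ¬p | _        = ⊥-elim (¬p refl)
    eu : ∀ a b → gadgetOp g e a b b ≡ nodeval g (uN e) a b
    eu a b with a Fin.≟ b | b Fin.≟ b
    ... | yes refl | yes _ = std a
    ... | no _     | yes _ = refl
    ... | _        | no ¬p = ⊥-elim (¬p refl)

  abstract
    diff : (Nd → Dom S → Dom S → Dom S) → Assignment S n → Nd → ℕ
    diff F g ν = ∑ (allFin k) (λ a → ∑ (allFin k) (λ b → ind (not (does (F ν a b Fin.≟ g (code (node ν a b)))))))

    diff-≡ : ∀ F g ν → diff F g ν ≡ ∑ (allFin k) (λ a → ∑ (allFin k) (λ b → ind (not (does (F ν a b Fin.≟ g (code (node ν a b)))))))
    diff-≡ F g ν = refl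

    diff-0 : ∀ F g ν → diff F g ν ≡ 0 → ∀ a b → F ν a b ≡ g (code (node ν a b))
    diff-0 F g ν eq a b = ind0 (n≤0⇒n≡0 (≤-trans (≤-trans
        (∈⇒≤∑ (λ b → ind (not (does (F ν a b Fin.≟ g (code (node ν a b)))))) (∈-allFin b))
        (∈⇒≤∑ (λ a → ∑ (allFin k) (λ b → ind (not (does (F ν a b Fin.≟ g (code (node ν a b))))))) (∈-allFin a)))
        (≤-reflexive eq)))
      where
      ind0 : ind (not (does (F ν a b Fin.≟ g (code (node ν a b))))) ≡ 0 → F ν a b ≡ g (code (node ν a b))
      ind0 h with F ν a b Fin.≟ g (code (node ν a b))
      ind0 h  | yes p = p
      ind0 () | no _

  dist-marks : ∀ F T g → dist I (assign F T) g ≡ frac (∑ marks (λ v → ind (not (does (value F T v Fin.≟ g (code v)))))) D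
  dist-marks F T g = trans (sumFin-cong n each) (trans (sumFin-frac n _ D)
      (cong (λ z → frac z D) (trans (∑-count (λ x → ind (not (does (assign F T x Fin.≟ g x)))))
        (∑-cong marks (λ v → cong (λ z → ind (not (does (z Fin.≟ g (code v))))) (assign-code F T v))))))
    where
    each : ∀ x → (if does (assign F T x Fin.≟ g x) then 0ℚ else frac (count x) D) ≡ frac (count x * ind (not (does (assign F T x Fin.≟ g x)))) D
    each x with does (assign F T x Fin.≟ g x)
    ... | true  = sym (trans (cong (λ z → frac z D) (*-zeroʳ (count x))) (frac-0 D))
    ... | false = cong (λ z → frac z D) (sym (*-identityʳ (count x)))

  standard? : ∀ g → Standard g ⊎ ∃ λ a → ¬ (a ≡ g (code (const a)))
  standard? g with Fin.all? (λ a → g (code (const a)) Fin.≟ a)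
  ... | yes p = inj₁ p
  ... | no ¬p = let a , ne = Fin.¬∀⟶∃¬ k _ (λ a → g (code (const a)) Fin.≟ a) ¬p in inj₂ (a , ne ∘ sym)

  far-from : ∀ F T → (∀ g → Satisfies I g → Standard g → suc r ≤ ∑ MN (diff F g)) → Far I (threshold S) (assign F T)
  far-from F T h g sat = subst (threshold S ℚ.<_) (sym (dist-marks F T g)) (frac-< 1 E c D (begin-strict
      1 * suc D                                  ≡⟨ *-identityˡ (suc D) ⟩
      suc D                                      ≡⟨ solve 3 (λ s r kk → con 1 :+ (r :+ (s :* (con 1 :+ r) :+ con 8 :* (con 1 :+ r) :* kk)) := (con 1 :+ r) :* (con 1 :+ (s :+ con 8 :* kk))) refl (size S) r (k * k) ⟩
      suc r * suc w                              <⟨ *-monoʳ-< (suc r) (s≤s (s≤s (m≤m+n w (w + 0)))) ⟩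
      suc r * suc E                              ≤⟨ *-monoˡ-≤ (suc E) count≥ ⟩
      c * suc E                                  ∎))
    where
    open ≤-Reasoning
    open +-*-Solver
    E = gapDenominator S
    w = size S + 8 * (k * k)
    δ : V → ℕ
    δ v = ind (not (does (value F T v Fin.≟ g (code v))))
    c = ∑ marks δ
    ∑-δ : c ≡ ∑ (allFin k) (λ a → suc r * δ (const a)) + ∑ MN (diff F g)
    ∑-δ = trans (∑-marks δ) (cong (λ z → ∑ (allFin k) (λ a → suc r * δ (const a)) + z) (∑-cong MN (λ ν → sym (diff-≡ F g ν))))
    count≥ : suc r ≤ c
    count≥ with standard? g
    ... | inj₁ std = begin
      suc r                                                       ≤⟨ h g sat std ⟩
      ∑ MN (diff F g)                                             ≤⟨ m≤n+m _ (∑ (allFin k) (λ a → suc r * δ (const a))) ⟩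
      ∑ (allFin k) (λ a → suc r * δ (const a)) + ∑ MN (diff F g)  ≡⟨ ∑-δ ⟨
      c                                                           ∎
    ... | inj₂ (a , ne) = begin
      suc r                                                       ≡⟨ trans (sym (*-identityʳ (suc r))) (cong (suc r *_) (sym δ≡1)) ⟩
      suc r * δ (const a)                                         ≤⟨ ∈⇒≤∑ (λ a → suc r * δ (const a)) (∈-allFin a) ⟩
      ∑ (allFin k) (λ a → suc r * δ (const a))                    ≤⟨ m≤m+n _ (∑ MN (diff F g)) ⟩
      ∑ (allFin k) (λ a → suc r * δ (const a)) + ∑ MN (diff F g)  ≡⟨ ∑-δ ⟨
      c                                                           ∎
      where
      δ≡1 : δ (const a) ≡ 1
      δ≡1 with a Fin.≟ g (code (const a))
      ... | yes eq = ⊥-elim (ne eq)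
      ... | no _   = refl

  nodeval-diff-0 : ∀ F g ν → diff F g ν ≡ 0 → (∀ a → F ν a a ≡ a) → ∀ a b → nodeval g ν a b ≡ F ν a b
  nodeval-diff-0 F g ν d≡0 idem a b with a Fin.≟ b
  ... | yes refl = sym (idem a)
  ... | no  _    = sym (diff-0 F g ν d≡0 a b)

unitFraction>0 : ∀ e → 0ℚ ℚ.< frac 1 e
unitFraction>0 e = subst (ℚ._< frac 1 e) (frac-0 e) (frac-< 0 e 1 e (s≤s z≤n))

unitFraction<1 : ∀ e → frac 1 (suc e) ℚ.< 1ℚ
unitFraction<1 e = subst (frac 1 (suc e) ℚ.<_) (frac-1 (suc e)) (frac-< 1 (suc e) (suc (suc e)) (suc e) (*-monoˡ-< (suc (suc e)) {1} {suc (suc e)} (s≤s (s≤s z≤n))))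

-- Parities and coordinates of Boolean vectors

odd : ℕ → Bool
odd zero    = false
odd (suc j) = not (odd j)

odd-%2 : ∀ j → odd (j % 2) ≡ odd j
odd-%2 zero          = refl
odd-%2 (suc zero)    = refl
odd-%2 (suc (suc j)) = trans (cong odd (trans (cong (_% 2) (+-comm 2 j)) ([m+n]%n≡m%n j 2)))
  (trans (odd-%2 j) (sym (Bool.not-involutive (odd j))))

odd-incIf : ∀ b j → odd (incIf 1 b j) ≡ odd j xor b
odd-incIf true  j = trans (odd-%2 (suc j)) (sym (trans (Bool.xor-comm (odd j) true) refl))
odd-incIf false j = sym (Bool.xor-identityʳ (odd j))

∑-insertAt : ∀ {n} (i : Fin (suc n)) (h : Vec Bool (suc n) → ℕ) →
  ∑ (allVecs bools (suc n)) h ≡ ∑ (allVecs bools n) (λ z → h (insertAt z i true) + h (insertAt z i false))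
∑-insertAt {n} zero h = trans (∑-cartesian _∷_ bools (allVecs bools n) h)
  (trans (cong (λ t → ∑ (allVecs bools n) (λ z → h (true ∷ z)) + t) (+-identityʳ _)) (sym (∑-+ (allVecs bools n) _ _)))
∑-insertAt {suc n} (suc i) h = trans (∑-cartesian _∷_ bools (allVecs bools (suc n)) h)
  (trans (∑-cong bools (λ b → ∑-insertAt i (λ z → h (b ∷ z))))
    (sym (∑-cartesian _∷_ bools (allVecs bools n) (λ z → h (insertAt z (suc i) true) + h (insertAt z (suc i) false)))))

length-allVecs : ∀ (xs : List X) n → length (allVecs xs n) ≡ length xs ^ n
length-allVecs xs zero    = refl
length-allVecs xs (suc n) = trans (length-∑ (allVecs xs (suc n))) (trans (∑-cartesian _∷_ xs (allVecs xs n) (λ _ → 1))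
  (trans (∑-const xs _) (cong (length xs *_) (trans (sym (length-∑ (allVecs xs n))) (length-allVecs xs n)))))

removeAt-[]≔ : ∀ {n} (x : Vec X (suc n)) i v → removeAt (x [ i ]≔ v) i ≡ removeAt x i
removeAt-[]≔ (y ∷ x) zero v = refl
removeAt-[]≔ (y ∷ x@(_ ∷ _)) (suc i) v with x [ i ]≔ v in eq
... | _ ∷ _ = cong (y ∷_) (trans (cong (λ z → removeAt z i) (sym eq)) (removeAt-[]≔ x i v))

insertAt-[]≔ : ∀ {n} (z : Vec X n) i u v → insertAt z i u [ i ]≔ v ≡ insertAt z i v
insertAt-[]≔ z       zero    u v = refl
insertAt-[]≔ (y ∷ z) (suc i) u v = cong (y ∷_) (insertAt-[]≔ z i u v)

lookup-removeAt : ∀ {n} (x y : Vec X (suc n)) i j → i ≢ j → removeAt x i ≡ removeAt y i → lookup x j ≡ lookup y j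
lookup-removeAt x y i j i≢j eq = trans (sym (Vec.removeAt-punchOut x i≢j)) (trans (cong (λ v → lookup v (Fin.punchOut i≢j)) eq) (Vec.removeAt-punchOut y i≢j))

-- If S has no Maltsev polymorphism, the edges of the gadgets exclude the pair (α, β) of values at u and y, so an
-- edge acts as a NAND constraint on two Boolean variables.  The vertices are two copies X, Y of Bool × Boolᴷ, and
-- X (e, x) is joined to Y (e, x [ j ]≔ true) for each j.  For each i the edges of direction i between the vertices
-- with x i = false and y i = true form an induced matching that covers half of the vertices; the hidden
-- assignment is supported on it.

module Nand (S : Structure) (¬malt : ¬ HasMaltsevPolymorphism S) (K′ : ℕ) where

  K : ℕ
  K = suc K′

  Vertex : Set
  Vertex = Bool × Bool × Vec Bool K

  Edge : Set
  Edge = Bool × Vec Bool K × Fin K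

  Nd : Set
  Nd = Vertex ⊎ Edge

  pattern left e x = true , e , x
  pattern right e y = false , e , y

  finEdge : Finite Edge
  finEdge = fin× finBool (fin× (finVec finBool K) (finFin K))

  finNd : Finite Nd
  finNd = fin⊎ (fin× finBool (fin× finBool (finVec finBool K))) finEdge

  leftEnd rightEnd : Edge → Vertex
  leftEnd  (e , x , j) = left e x
  rightEnd (e , x , j) = right e (x [ j ]≔ true)

  xNode yNode uNode : Edge → Nd
  xNode e = inj₂ e
  yNode e = inj₁ (rightEnd e)
  uNode e = inj₁ (leftEnd e)

  vertices : List Vertex
  vertices = cartesianProduct bools (cartesianProduct bools (allVecs bools K))

  marked : List Nd
  marked = map inj₁ vertices

  -- Of the 4 · 2^K = 8(r + 1) vertices, a direction matches r + 1 pairs in each of the two copies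
  -- e. A far assignment violates one copy of each pair, so that at least r + 1 vertices have to
  -- change.
  r : ℕ
  r = pred (2 ^ K′)

  suc-r : suc r ≡ 2 ^ K′
  suc-r = suc-pred (2 ^ K′) {{>-nonZero (m^n>0 2 K′)}}

  ∑-vertices : ∀ (h : Vertex → ℕ) → ∑ vertices h ≡ ∑ bools (λ s → ∑ bools (λ e → ∑ (allVecs bools K) (λ x → h (s , e , x))))
  ∑-vertices h = trans (∑-cartesian _,_ bools (cartesianProduct bools (allVecs bools K)) h)
    (∑-cong bools (λ s → ∑-cartesian _,_ bools (allVecs bools K) (λ v → h (s , v))))

  abstract
    length-vertices : length marked ≡ 8 * suc r
    length-vertices = begin
      length marked          ≡⟨ List.length-map inj₁ vertices ⟩
      length vertices                              ≡⟨ length-∑ vertices ⟩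
      ∑ vertices (λ _ → 1)                         ≡⟨ ∑-vertices (λ _ → 1) ⟩
      ∑ bools (λ _ → ∑ bools (λ _ → ∑ (allVecs bools K) (λ _ → 1))) ≡⟨ cong (λ c → ∑ bools (λ _ → ∑ bools (λ _ → c))) (trans (sym (length-∑ (allVecs bools K))) (length-allVecs bools K)) ⟩
      ∑ bools (λ _ → ∑ bools (λ _ → 2 * 2 ^ K′))   ≡⟨ solve 1 (λ p → (con 2 :* p :+ (con 2 :* p :+ con 0)) :+ ((con 2 :* p :+ (con 2 :* p :+ con 0)) :+ con 0) := con 8 :* p) refl (2 ^ K′) ⟩
      8 * 2 ^ K′                                   ≡⟨ cong (8 *_) (sym suc-r) ⟩
      8 * suc r                                    ∎
      where
      open ≡-Reasoning
      open +-*-Solver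

  open Gadgets S finNd finEdge xNode yNode uNode marked r length-vertices public

  L : ℕ
  L = card (finVec finBool K′)

  index : Vec Bool K′ → Fin L
  index = enc (finVec finBool K′)

  index-injective : ∀ {z z′} → index z ≡ index z′ → z ≡ z′
  index-injective {z} {z′} eq = trans (sym (dec-enc (finVec finBool K′) z)) (trans (cong (dec (finVec finBool K′)) eq) (dec-enc (finVec finBool K′) z′))

  -- Coordinate i is removed so that the two ends of a matching edge of direction i read the same
  -- random bit.
  secret : Fin K → Vec ℕ L → Vec Bool K → Bool
  secret i ω x = odd (lookup ω (index (removeAt x i)))

  -- The flag t distinguishes the satisfying assignments (t = true) from the far ones.
  bit : Bool → Fin K → Vec ℕ L → Vertex → Bool
  bit t i ω (left e x)  = if lookup x i then false else secret i ω x xor e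
  bit t i ω (right e y) = if lookup y i then (secret i ω y xor e) xor t else false

  -- The bit true stands for α at a left end, which is the entry u of an edge, and for β at a right
  -- end, which is the entry y. An edge with both bits true would thus need a Maltsev operation.
  vertexValue : Vertex → Bool → Dom S → Dom S → Dom S
  vertexValue (left _ _)  b a c = if b then a else c
  vertexValue (right _ _) b a c = if b then c else a

  -- The three projections realise the three admissible pairs of bits. For the pair (true, true),
  -- which only far assignments contain, the first projection is a default.
  select : Bool → Bool → Op₃ S
  select true  _     a b c = a
  select false true  a b c = c
  select false false a b c = b

  opOf : Bool → Fin K → Vec ℕ L → Edge → Op₃ S
  opOf t i ω e = select (bit t i ω (leftEnd e)) (bit t i ω (rightEnd e))

  nodeOf : Bool → Fin K → Vec ℕ L → Nd → Dom S → Dom S → Dom S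
  nodeOf t i ω (inj₁ v) = vertexValue v (bit t i ω v)
  nodeOf t i ω (inj₂ e) = λ a b → opOf t i ω e a b a

  hiddenAssignment : Bool → Fin K → Vec ℕ L → Assignment S n
  hiddenAssignment t i ω = assign (nodeOf t i ω) (opOf t i ω)

  -- Two true bits require x i = false and y i = true for the ends x and y, hence j = i. The ends
  -- then share their secret, and the flag makes their bits complementary.
  yes-independent : ∀ i ω e → bit true i ω (leftEnd e) ≡ true → bit true i ω (rightEnd e) ≡ true → ⊥
  yes-independent i ω (e , x , j) hl hr with lookup x i in xi | lookup (x [ j ]≔ true) i in yi
  yes-independent i ω (e , x , j) hl hr | false | true with i Fin.≟ j
  ... | no i≢j   with trans (sym yi) (trans (Vec.lookup∘updateAt′ i j i≢j x) xi)
  ...   | ()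
  yes-independent i ω (e , x , j) hl hr | false | true | yes refl = contra (secret i ω x xor e) hl
    (trans (cong (λ z → (odd (lookup ω (index z)) xor e) xor true) (sym (removeAt-[]≔ x i true))) hr)
    where
    contra : ∀ b → b ≡ true → b xor true ≡ true → ⊥
    contra true refl ()

  if-idem : ∀ {A : Set} {a : A} b → (if b then a else a) ≡ a
  if-idem true  = refl
  if-idem false = refl

  pol-select : ∀ b c → IsPolymorphism₃ S (select b c)
  pol-select true  _     = pol-π₁
  pol-select false true  = pol-π₃
  pol-select false false = pol-π₂

  yes-satisfies : ∀ i ω → Satisfies I (hiddenAssignment true i ω)
  yes-satisfies i ω = assign-satisfies _ _ (λ e → pol-select (bit true i ω (leftEnd e)) (bit true i ω (rightEnd e))) idem (λ e a b → refl) ey eu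
    where
    idem : ∀ e a → opOf true i ω e a a a ≡ a
    idem e a with bit true i ω (leftEnd e) | bit true i ω (rightEnd e)
    ... | true  | _     = refl
    ... | false | true  = refl
    ... | false | false = refl
    eu : ∀ e a b → opOf true i ω e a b b ≡ nodeOf true i ω (inj₁ (leftEnd e)) a b
    eu e a b with bit true i ω (leftEnd e) | bit true i ω (rightEnd e)
    ... | true  | _     = refl
    ... | false | true  = refl
    ... | false | false = refl
    ey : ∀ e a b → opOf true i ω e a a b ≡ nodeOf true i ω (inj₁ (rightEnd e)) a b
    ey e a b with bit true i ω (leftEnd e) in eql | bit true i ω (rightEnd e) in eqr
    ... | true  | true  = ⊥-elim (yes-independent i ω e eql eqr)
    ... | true  | false = refl
    ... | false | true  = refl
    ... | false | false = refl

  violated-edge : ∀ i ω e → bit false i ω (leftEnd e) ≡ true → bit false i ω (rightEnd e) ≡ true →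
    ∀ g → Satisfies I g → Standard g → 1 ≤ diff (nodeOf false i ω) g (inj₁ (leftEnd e)) + diff (nodeOf false i ω) g (inj₁ (rightEnd e))
  violated-edge i ω e bl br g sat std = n≢0⇒n>0 λ d≡0 → ¬malt (maltsev (m+n≡0⇒m≡0 dl d≡0) (m+n≡0⇒n≡0 dl d≡0))
    where
    dl = diff (nodeOf false i ω) g (inj₁ (leftEnd e))
    maltsev : diff (nodeOf false i ω) g (inj₁ (leftEnd e)) ≡ 0 → diff (nodeOf false i ω) g (inj₁ (rightEnd e)) ≡ 0 → HasMaltsevPolymorphism S
    maltsev dl dr with satisfies⇒Add g sat std e
    ... | add {p} pol idem ex ey eu = p , pol , λ a b → trans (eu b a) (valL b a) , trans (ey a b) (valR a b)
      where
      valL : ∀ a b → nodeval g (inj₁ (leftEnd e)) a b ≡ a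
      valL a b = trans (nodeval-diff-0 (nodeOf false i ω) g (inj₁ (leftEnd e)) dl (λ a → if-idem (bit false i ω (leftEnd e))) a b)
        (cong (λ z → vertexValue (leftEnd e) z a b) bl)
      valR : ∀ a b → nodeval g (inj₁ (rightEnd e)) a b ≡ b
      valR a b = trans (nodeval-diff-0 (nodeOf false i ω) g (inj₁ (rightEnd e)) dr (λ a → if-idem (bit false i ω (rightEnd e))) a b)
        (cong (λ z → vertexValue (rightEnd e) z a b) br)

  no-far : ∀ i ω → Far I (threshold S) (hiddenAssignment false i ω)
  no-far i ω = far-from _ _ λ g sat std →
    let d : Vertex → ℕ
        d v = diff (nodeOf false i ω) g (inj₁ v)
        Vs = allVecs bools K
        Zs = allVecs bools K′
    in begin
      suc r                                              ≡⟨ trans suc-r (sym (length-allVecs bools K′)) ⟩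
      length Zs                                          ≡⟨ length-∑ Zs ⟩
      ∑ Zs (λ _ → 1)                                     ≤⟨ ∑-mono Zs (edge g sat std) ⟩
      ∑ Zs (λ z → ∑ bools (λ e → d (left e (insertAt z i false)) + d (right e (insertAt z i true))))
        ≤⟨ ∑-mono Zs (λ z → ∑-mono bools (λ e → +-mono-≤ (m≤n+m (d (left e (insertAt z i false))) (d (left e (insertAt z i true)))) (m≤m+n (d (right e (insertAt z i true))) (d (right e (insertAt z i false)))))) ⟩
      ∑ Zs (λ z → ∑ bools (λ e → (d (left e (insertAt z i true)) + d (left e (insertAt z i false))) + (d (right e (insertAt z i true)) + d (right e (insertAt z i false)))))
        ≡⟨ ∑-swap Zs bools (λ z e → (d (left e (insertAt z i true)) + d (left e (insertAt z i false))) + (d (right e (insertAt z i true)) + d (right e (insertAt z i false)))) ⟩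
      ∑ bools (λ e → ∑ Zs (λ z → (d (left e (insertAt z i true)) + d (left e (insertAt z i false))) + (d (right e (insertAt z i true)) + d (right e (insertAt z i false)))))
        ≡⟨ ∑-cong bools (λ e → trans (∑-+ Zs (λ z → d (left e (insertAt z i true)) + d (left e (insertAt z i false))) (λ z → d (right e (insertAt z i true)) + d (right e (insertAt z i false)))) (cong₂ _+_ (sym (∑-insertAt i (λ x → d (left e x)))) (sym (∑-insertAt i (λ x → d (right e x)))))) ⟩
      ∑ bools (λ e → ∑ Vs (λ x → d (left e x)) + ∑ Vs (λ x → d (right e x)))
        ≡⟨ trans (∑-+ bools (λ e → ∑ Vs (λ x → d (left e x))) (λ e → ∑ Vs (λ x → d (right e x)))) (cong (λ t → ∑ bools (λ e → ∑ Vs (λ x → d (left e x))) + t) (sym (+-identityʳ _))) ⟩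
      ∑ bools (λ s → ∑ bools (λ e → ∑ Vs (λ x → d (s , e , x))))
        ≡⟨ ∑-vertices d ⟨
      ∑ vertices d
        ≡⟨ ∑-map inj₁ vertices (diff (nodeOf false i ω) g) ⟨
      ∑ marked (diff (nodeOf false i ω) g)  ∎
    where
    open ≤-Reasoning
    edge : ∀ g → Satisfies I g → Standard g → ∀ z → 1 ≤ ∑ bools (λ e → diff (nodeOf false i ω) g (inj₁ (left e (insertAt z i false))) + diff (nodeOf false i ω) g (inj₁ (right e (insertAt z i true))))
    edge g sat std z = ≤-trans (subst (λ y → 1 ≤ diff (nodeOf false i ω) g (inj₁ (left e₀ x)) + diff (nodeOf false i ω) g (inj₁ (right e₀ y))) (insertAt-[]≔ z i false true)
        (violated-edge i ω (e₀ , x , i) bl br g sat std))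
        (∈⇒≤∑ (λ e → diff (nodeOf false i ω) g (inj₁ (left e (insertAt z i false))) + diff (nodeOf false i ω) g (inj₁ (right e (insertAt z i true)))) (∈-bools e₀))
      where
      x = insertAt z i false
      o = odd (lookup ω (index z))
      -- In this copy both ends carry the bit o xor e₀ = true. Having both copies makes the number
      -- of violated edges independent of ω.
      e₀ = not o
      xor-not : ∀ b → b xor not b ≡ true
      xor-not true  = refl
      xor-not false = refl
      bl : bit false i ω (left e₀ x) ≡ true
      bl rewrite Vec.insertAt-lookup z i false | Vec.removeAt-insertAt z i false = xor-not o
      br : bit false i ω (right e₀ (x [ i ]≔ true)) ≡ true
      br rewrite insertAt-[]≔ z i false true | Vec.insertAt-lookup z i true | Vec.removeAt-insertAt z i true = trans (Bool.xor-identityʳ (o xor e₀)) (xor-not o)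

  -- The copies e are ignored, since both of them read the same entry of ω.
  Conflict : Vertex → Vertex → Fin K → Set
  Conflict (s , _ , x) (s′ , _ , y) i = s ≡ true × s′ ≡ false × lookup x i ≡ false × lookup y i ≡ true × removeAt x i ≡ removeAt y i

  conflict? : ∀ v w i → Dec (Conflict v w i)
  conflict? (s , _ , x) (s′ , _ , y) i = (s Bool.≟ true) ×-dec (s′ Bool.≟ false) ×-dec (lookup x i Bool.≟ false) ×-dec (lookup y i Bool.≟ true)
    ×-dec Vec.≡-dec Bool._≟_ (removeAt x i) (removeAt y i)

  -- Two vectors that agree outside coordinate i differ at no other coordinate.
  conflict-unique : ∀ v w {i j} → Conflict v w i → Conflict v w j → i ≡ j
  conflict-unique (_ , _ , x) (_ , _ , y) {i} {j} (_ , _ , _ , _ , eq) (_ , _ , xj , yj , _) with i Fin.≟ j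
  ... | yes p = p
  ... | no i≢j with trans (sym xj) (trans (lookup-removeAt x y i j i≢j eq) yj)
  ...   | ()

  atoms : V → List Vertex
  atoms (const a)             = []
  atoms (node (inj₁ v) a b)   = v ∷ []
  atoms (node (inj₂ e) a b)   = leftEnd e ∷ rightEnd e ∷ []
  atoms (priv e a b c)        = leftEnd e ∷ rightEnd e ∷ []

  length-atoms : ∀ v → length (atoms v) ≤ 2
  length-atoms (const a)           = z≤n
  length-atoms (node (inj₁ v) a b) = s≤s z≤n
  length-atoms (node (inj₂ e) a b) = ≤-refl
  length-atoms (priv e a b c)      = ≤-refl

  value-atoms : ∀ t t′ i ω ω′ v → (∀ {p} → p ∈ atoms v → bit t i ω p ≡ bit t′ i ω′ p) →
    value (nodeOf t i ω) (opOf t i ω) v ≡ value (nodeOf t′ i ω′) (opOf t′ i ω′) v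
  value-atoms t t′ i ω ω′ (const a)           h = refl
  value-atoms t t′ i ω ω′ (node (inj₁ v) a b) h = cong (λ z → vertexValue v z a b) (h (here refl))
  value-atoms t t′ i ω ω′ (node (inj₂ e) a b) h = cong₂ (λ y z → select y z a b a) (h (here refl)) (h (there (here refl)))
  value-atoms t t′ i ω ω′ (priv e a b c)      h = cong₂ (λ y z → select y z a b c) (h (here refl)) (h (there (here refl)))

  module _ (As : List Vertex) (i : Fin K) (free : ∀ v w → v ∈ As → w ∈ As → ¬ Conflict v w i) where

    -- An entry of ω is flipped if it is read by a right vertex under inspection with y i = true;
    -- this makes up for the flag t there. Without conflicts, no left vertex under inspection with x
    -- i = false reads a flipped entry.
    Flip : Fin L → Vertex → Set
    Flip l (s , _ , y) = s ≡ false × lookup y i ≡ true × index (removeAt y i) ≡ l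

    flip? : ∀ l v → Dec (Flip l v)
    flip? l (s , _ , y) = (s Bool.≟ false) ×-dec (lookup y i Bool.≟ true) ×-dec (index (removeAt y i) Fin.≟ l)

    flips : Vec Bool L
    flips = Vec.tabulate (λ l → does (any? (flip? l) As))

    lookup-shift : ∀ ω l → odd (lookup (shift 1 flips ω) l) ≡ odd (lookup ω l) xor does (any? (flip? l) As)
    lookup-shift ω l = trans (cong odd (trans (Vec.lookup-zipWith (incIf 1) l flips ω)
      (cong (λ b → incIf 1 b (lookup ω l)) (Vec.lookup∘tabulate (λ l → does (any? (flip? l) As)) l)))) (odd-incIf _ (lookup ω l))

    bit-flips : ∀ ω {v} → v ∈ As → bit false i ω v ≡ bit true i (shift 1 flips ω) v
    bit-flips ω {left e x} v∈ with lookup x i in xi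
    ... | true  = refl
    ... | false = cong (_xor e) (sym (trans (lookup-shift ω (index (removeAt x i))) (trans (cong (odd (lookup ω (index (removeAt x i))) xor_) none) (Bool.xor-identityʳ (odd (lookup ω (index (removeAt x i))))))))
      where
      none : does (any? (flip? (index (removeAt x i))) As) ≡ false
      none = dec-false (any? (flip? (index (removeAt x i))) As) λ p →
        let w , w∈ , s≡ , yi , eq = find p
        in free (left e x) w v∈ w∈ (refl , s≡ , xi , yi , sym (index-injective eq))
    bit-flips ω {right e y} v∈ with lookup y i in yi
    ... | false = refl
    ... | true  = sym (trans (cong (λ z → (z xor e) xor true) (trans (lookup-shift ω (index (removeAt y i))) (cong (odd (lookup ω (index (removeAt y i))) xor_) some)))
                    (twist (odd (lookup ω (index (removeAt y i)))) e))
      where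
      some : does (any? (flip? (index (removeAt y i))) As) ≡ true
      some = dec-true (any? (flip? (index (removeAt y i))) As) (lose v∈ (refl , yi , refl))
      twist : ∀ b e → ((b xor true) xor e) xor true ≡ (b xor e) xor false
      twist true  true  = refl
      twist true  false = refl
      twist false true  = refl
      twist false false = refl

  untestable : ∀ q → 16 * (queryBound (suc (size S)) q * queryBound (suc (size S)) q) ≤ K → ∀ ts → ¬ IsTester false I (threshold S) q ts
  untestable q large = no-tester I (threshold S) q 1 (hiddenAssignment true) (hiddenAssignment false) yes-satisfies (λ i {ω} _ → no-far i ω) fool (s≤s z≤n)
    where
    fool : ∀ (W : List (Fin n)) → length W ≤ queryBound (suc (size S)) q →
           ∃ λ (bad : Fin K → Bool) → 4 * ∑ (allFin K) (ind ∘ bad) ≤ K ×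
             (∀ i → bad i ≡ false → ∃ λ ρ → ∀ ω {x} → x ∈ W → hiddenAssignment false i ω x ≡ hiddenAssignment true i (shift 1 ρ ω) x)
    fool W len = conflicting Conflict conflict? conflict-unique As , few , good
      where
      As = concatMap (atoms ∘ dec FV) W
      few : 4 * ∑ (allFin K) (ind ∘ conflicting Conflict conflict? conflict-unique As) ≤ K
      few = ≤-trans (few-conflicts-queried Conflict conflict? conflict-unique (queryBound (suc (size S)) q) (atoms ∘ dec FV) (λ x → length-atoms (dec FV x)) W len) large
      good : ∀ i → conflicting Conflict conflict? conflict-unique As i ≡ false → ∃ λ ρ → ∀ ω {x} → x ∈ W → hiddenAssignment false i ω x ≡ hiddenAssignment true i (shift 1 ρ ω) x
      good i eq = flips As i free , λ ω {x} x∈ → value-atoms false true i ω _ (dec FV x) (λ p∈ → bit-flips As i free ω (∈-concatMap x∈ p∈))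
        where
        free : ∀ v w → v ∈ As → w ∈ As → ¬ Conflict v w i
        free = no-conflict Conflict conflict? conflict-unique As i eq

no-maltsev⇒untestable : ∀ S → ¬ HasMaltsevPolymorphism S → ¬ ConstantQueryTestable S
no-maltsev⇒untestable S ¬malt testable with testable (threshold S) (unitFraction>0 (gapDenominator S)) (unitFraction<1 (2 * (size S + 8 * (suc (size S) * suc (size S)))))
... | q , tester = untestable q (n≤1+n K′) ts isTester
  where
  K′ = 16 * (queryBound (suc (size S)) q * queryBound (suc (size S)) q)
  open Nand S ¬malt K′
  satisfiable : Satisfiable I
  satisfiable = _ , yes-satisfies zero (Vec.replicate L 0)
  ts = proj₁ (tester n I satisfiable)
  isTester = proj₂ (tester n I satisfiable)

-- Derandomised choice of a far vector

-- Each table agrees with at most one of the two values of a coordinate, so summing 8^agreements over both values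
-- of the next coordinate gives a factor of at most 9.
few-agreements : ∀ {T : Set} (ts : List T) n (tab : T → Fin n → Bool → Bool) → (∀ τ i → ¬ (tab τ i true ≡ true × tab τ i false ≡ true)) →
  ∀ (c : T → ℕ) → ∃ λ (w : Fin n → Bool) →
    2 ^ n * ∑ ts (λ τ → c τ * 8 ^ ∑ (allFin n) (λ i → ind (tab τ i (w i)))) ≤ 9 ^ n * ∑ ts c
few-agreements ts zero    tab ex c = (λ ()) , ≤-reflexive (cong (1 *_) (∑-cong ts (λ τ → *-identityʳ (c τ))))
few-agreements {T} ts (suc n) tab ex c = let b , le = choice in b ◂ proj₁ (rest b) , (begin
    2 ^ suc n * ∑ ts (λ τ → c τ * 8 ^ ∑ (allFin (suc n)) (λ i → ind (tab τ i ((b ◂ proj₁ (rest b)) i))))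
      ≡⟨ cong (2 ^ suc n *_) (∑-cong ts (λ τ → trans (cong (λ z → c τ * 8 ^ z) (∑-allFin-suc (λ i → ind (tab τ i ((b ◂ proj₁ (rest b)) i)))))
           (trans (cong (c τ *_) (^-distribˡ-+-* 8 (ind (tab τ zero b)) _)) (sym (*-assoc (c τ) _ _))))) ⟩
    2 * 2 ^ n * ∑ ts (λ τ → c′ b τ * 8 ^ ∑ (allFin n) (λ i → ind (tab τ (suc i) (proj₁ (rest b) i))))
      ≡⟨ *-assoc 2 (2 ^ n) _ ⟩
    2 * (2 ^ n * ∑ ts (λ τ → c′ b τ * 8 ^ ∑ (allFin n) (λ i → ind (tab τ (suc i) (proj₁ (rest b) i)))))
      ≤⟨ *-monoʳ-≤ 2 (proj₂ (rest b)) ⟩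
    2 * (9 ^ n * ∑ ts (c′ b))
      ≡⟨ solve 2 (λ p s → con 2 :* (p :* s) := p :* (con 2 :* s)) refl (9 ^ n) (∑ ts (c′ b)) ⟩
    9 ^ n * (2 * ∑ ts (c′ b))
      ≤⟨ *-monoʳ-≤ (9 ^ n) le ⟩
    9 ^ n * (9 * ∑ ts c)
      ≡⟨ solve 2 (λ p s → p :* (con 9 :* s) := con 9 :* p :* s) refl (9 ^ n) (∑ ts c) ⟩
    9 ^ suc n * ∑ ts c ∎)
  where
  open ≤-Reasoning
  open +-*-Solver
  c′ : Bool → T → ℕ
  c′ b τ = c τ * 8 ^ ind (tab τ zero b)
  rest : ∀ b → _
  rest b = few-agreements ts n (λ τ i → tab τ (suc i)) (λ τ i → ex τ (suc i)) (c′ b)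
  _◂_ : Bool → (Fin n → Bool) → Fin (suc n) → Bool
  (b ◂ w) zero    = b
  (b ◂ w) (suc i) = w i
  nine : ∀ τ → c′ true τ + c′ false τ ≤ 9 * c τ
  nine τ with tab τ zero true in et | tab τ zero false in ef
  ... | true  | true  = ⊥-elim (ex τ zero (et , ef))
  ... | true  | false = ≤-reflexive (solve 1 (λ c → c :* con 8 :+ c :* con 1 := con 9 :* c) refl (c τ))
  ... | false | true  = ≤-reflexive (solve 1 (λ c → c :* con 1 :+ c :* con 8 := con 9 :* c) refl (c τ))
  ... | false | false = ≤-trans (≤-reflexive (solve 1 (λ c → c :* con 1 :+ c :* con 1 := con 2 :* c) refl (c τ))) (*-monoˡ-≤ (c τ) {2} {9} (s≤s (s≤s z≤n)))
  total : ∑ ts (c′ true) + ∑ ts (c′ false) ≤ 9 * ∑ ts c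
  total = ≤-trans (≤-reflexive (sym (∑-+ ts (c′ true) (c′ false)))) (≤-trans (∑-mono ts nine) (≤-reflexive (∑-*ˡ ts 9 c)))
  choice : ∃ λ b → 2 * ∑ ts (c′ b) ≤ 9 * ∑ ts c
  choice with ≤-total (∑ ts (c′ true)) (∑ ts (c′ false))
  ... | inj₁ t≤f = true  , ≤-trans (+-monoʳ-≤ (∑ ts (c′ true)) (≤-trans (≤-reflexive (+-identityʳ _)) t≤f)) total
  ... | inj₂ f≤t = false , ≤-trans (≤-trans (+-monoʳ-≤ (∑ ts (c′ false)) (≤-trans (≤-reflexive (+-identityʳ _)) f≤t)) (≤-reflexive (+-comm (∑ ts (c′ false)) _))) total

*-^ : ∀ r a b → (a * b) ^ r ≡ a ^ r * b ^ r
*-^ zero    a b = refl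
*-^ (suc r) a b = trans (cong (a * b *_) (*-^ r a b))
  (solve 4 (λ a b x y → a :* b :* (x :* y) := a :* x :* (b :* y)) refl a b (a ^ r) (b ^ r))
  where open +-*-Solver

-- The constants fit since 9⁸ · 8 ≤ 2⁸ · 8⁷.
agreement-bound : ∀ r a N → N ≤ 8 ^ r → 2 ^ (8 * r) * 8 ^ a ≤ 9 ^ (8 * r) * N → a ≤ 7 * r
agreement-bound r a N N≤ h = ≮⇒≥ λ 7r<a → <⇒≱ (m<m*n (x ^ r) 8 {{m^n≢0 x r}} (s≤s (s≤s z≤n))) (begin
    x ^ r * 8                             ≡⟨ cong (_* 8) (trans (*-^ r (2 ^ 8) (8 ^ 7)) (cong₂ _*_ (^-*-assoc 2 8 r) (^-*-assoc 8 7 r))) ⟩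
    2 ^ (8 * r) * 8 ^ (7 * r) * 8         ≡⟨ trans (*-assoc (2 ^ (8 * r)) (8 ^ (7 * r)) 8) (cong (2 ^ (8 * r) *_) (*-comm (8 ^ (7 * r)) 8)) ⟩
    2 ^ (8 * r) * 8 ^ suc (7 * r)         ≤⟨ *-monoʳ-≤ (2 ^ (8 * r)) (^-monoʳ-≤ 8 7r<a) ⟩
    2 ^ (8 * r) * 8 ^ a                   ≤⟨ h ⟩
    9 ^ (8 * r) * N                       ≤⟨ *-monoʳ-≤ (9 ^ (8 * r)) N≤ ⟩
    9 ^ (8 * r) * 8 ^ r                   ≡⟨ trans (cong (_* 8 ^ r) (sym (^-*-assoc 9 8 r))) (sym (*-^ r (9 ^ 8) 8)) ⟩
    (9 ^ 8 * 8) ^ r                       ≤⟨ ^-monoˡ-≤ r (≤ᵇ⇒≤ (9 ^ 8 * 8) x _) ⟩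
    x ^ r                                 ∎)
  where
  open ≤-Reasoning
  x = 2 ^ 8 * 8 ^ 7

-- Double negation and finite quantification

¬¬-dec : ∀ (P : Set) → ¬ ¬ Dec P
¬¬-dec P k = k (no (λ p → k (yes p)))

¬¬-∀ : ∀ {n} {P : Fin n → Set} → (∀ i → ¬ ¬ P i) → ¬ ¬ (∀ i → P i)
¬¬-∀ {zero}  h k = k (λ ())
¬¬-∀ {suc n} h k = h zero (λ p₀ → ¬¬-∀ (h ∘ suc) (λ p → k (λ { zero → p₀ ; (suc i) → p i })))

¬¬-All : ∀ {P : X → Set} → (∀ x → ¬ ¬ P x) → ∀ xs → ¬ ¬ All P xs
¬¬-All h []       k = k []
¬¬-All h (x ∷ xs) k = h x (λ p → ¬¬-All h xs (λ ps → k (p ∷ ps)))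

tag : ∀ {P : X → Set} {xs} → All P xs → List (Σ X P)
tag []       = []
tag (p ∷ ps) = (_ , p) ∷ tag ps

∈-tag : ∀ {P : X → Set} {xs} (ps : All P xs) {x} → x ∈ xs → ∃ λ p → (x , p) ∈ tag ps
∈-tag (p ∷ ps) (here refl) = p , here refl
∈-tag (p ∷ ps) (there i)   = let q , q∈ = ∈-tag ps i in q , there q∈

length-tag : ∀ {P : X → Set} {xs} (ps : All P xs) → length (tag ps) ≡ length xs
length-tag []       = refl
length-tag (p ∷ ps) = cong suc (length-tag ps)

-- For a Maltsev polymorphism p without a majority polymorphism, Add behaves like the graph of the addition of an
-- abelian group on tuples, modulo the equivalence u ∼ v, and α ≁ β.

module Addition (S : Structure) (p : Op₃ S) (pol-p : IsPolymorphism₃ S p) (maltsev : IsMaltsev p)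
                (¬maj : ¬ HasMajorityPolymorphism S) where

  A : Set
  A = Dom S

  Tuple : Set
  Tuple = A → A → A

  _≗₂_ : Tuple → Tuple → Set
  x ≗₂ y = ∀ a b → x a b ≡ y a b

  p-right : ∀ a b → p b a a ≡ b
  p-right a b = proj₁ (maltsev a b)

  p-left : ∀ a b → p a a b ≡ b
  p-left a b = proj₂ (maltsev a b)

  α β : Tuple
  α a b = a
  β a b = b

  Binary : Tuple → Set
  Binary x = IsPolymorphism₃ S (λ a b _ → x a b) × (∀ a → x a a ≡ a)

  -- Modulo `∼` this is x - y + z in the group whose zero is α; in particular `pp x α y` is x + y.
  pp : Tuple → Tuple → Tuple → Tuple
  pp x y z a b = p (x a b) (y a b) (z a b)

  binary-α : Binary α
  binary-α = pol-π₁ , λ _ → refl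

  binary-β : Binary β
  binary-β = pol-π₂ , λ _ → refl

  binary-pp : ∀ {x y z} → Binary x → Binary y → Binary z → Binary (pp x y z)
  binary-pp {x} {y} {z} (px , ix) (py , iy) (pz , iz) =
    pol-comp p (λ a b _ → x a b) (λ a b _ → y a b) (λ a b _ → z a b) pol-p px py pz ,
    λ a → trans (cong₂ (λ u v → p u v (z a a)) (ix a) (iy a)) (trans (p-left a (z a a)) (iz a))

  Add′ : Tuple → Tuple → Tuple → Set
  Add′ = Add {S}

  infix 4 _∼_
  _∼_ : Tuple → Tuple → Set
  u ∼ v = Add′ u α v

  add-binary : ∀ {x y u} → Add′ x y u → Binary x × Binary y × Binary u
  add-binary {x} {y} {u} (add {t} pol idem ex ey eu) =
    (pol-resp {g = λ a b c → t a b a} (λ a b _ → ex a b) (pol-comp t π₁ π₂ π₁ pol pol-π₁ pol-π₂ pol-π₁) , λ a → trans (sym (ex a a)) (idem a)) ,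
    (pol-resp {g = λ a b c → t a a b} (λ a b _ → ey a b) (pol-comp t π₁ π₁ π₂ pol pol-π₁ pol-π₁ pol-π₂) , λ a → trans (sym (ey a a)) (idem a)) ,
    (pol-resp {g = λ a b c → t a b b} (λ a b _ → eu a b) (pol-comp t π₁ π₂ π₂ pol pol-π₁ pol-π₂ pol-π₂) , λ a → trans (sym (eu a a)) (idem a))

  add-identityʳ : ∀ {x} → Binary x → Add′ x α x
  add-identityʳ {x} (px , ix) = add {op = λ a b _ → x a b} px ix (λ _ _ → refl) (λ a _ → ix a) (λ _ _ → refl)

  add-identityˡ : ∀ {y} → Binary y → Add′ α y y
  add-identityˡ {y} (py , iy) = add {op = λ a _ c → y a c}
    (pol-comp (λ a b _ → y a b) π₁ π₃ π₃ py pol-π₁ pol-π₃ pol-π₃) iy (λ a _ → iy a) (λ _ _ → refl) (λ _ _ → refl)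

  add-resp : ∀ {x x′ y y′ u u′} → x ≗₂ x′ → y ≗₂ y′ → u ≗₂ u′ → Add′ x y u → Add′ x′ y′ u′
  add-resp hx hy hu (add {t} pol idem ex ey eu) = add {op = t} pol idem
    (λ a b → trans (ex a b) (hx a b)) (λ a b → trans (ey a b) (hy a b)) (λ a b → trans (eu a b) (hu a b))

  -- The group laws below all come from this closure under p: the three triples are chosen such that
  -- in most columns two neighbouring entries coincide and p cancels them.
  add-pp : ∀ {x y u x′ y′ u′ x″ y″ u″} → Add′ x y u → Add′ x′ y′ u′ → Add′ x″ y″ u″ →
           Add′ (pp x x′ x″) (pp y y′ y″) (pp u u′ u″)
  add-pp (add {t} pol idem ex ey eu) (add {t′} pol′ idem′ ex′ ey′ eu′) (add {t″} pol″ idem″ ex″ ey″ eu″) =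
    add {op = λ a b c → p (t a b c) (t′ a b c) (t″ a b c)} (pol-comp p t t′ t″ pol-p pol pol′ pol″)
      (λ a → trans (cong₃ (idem a) (idem′ a) (idem″ a)) (p-left a a))
      (λ a b → cong₃ (ex a b) (ex′ a b) (ex″ a b)) (λ a b → cong₃ (ey a b) (ey′ a b) (ey″ a b)) (λ a b → cong₃ (eu a b) (eu′ a b) (eu″ a b))
    where
    cong₃ : ∀ {a a′ b b′ c c′} → a ≡ a′ → b ≡ b′ → c ≡ c′ → p a b c ≡ p a′ b′ c′
    cong₃ refl refl refl = refl

  pp-right : ∀ {x y} → pp x y y ≗₂ x
  pp-right a b = p-right _ _

  pp-left : ∀ {x y} → pp x x y ≗₂ y
  pp-left a b = p-left _ _

  α≁β : ¬ α ∼ β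
  α≁β (add {t} pol idem ex ey eu) = ¬maj (t , pol , λ a b → eu b a , ex a b , ey a b)

  ∼-functional : ∀ {x y u v} → Add′ x y u → Add′ x y v → u ∼ v
  ∼-functional a₁ a₂ = add-resp pp-right pp-right pp-left (add-pp (add-identityʳ (proj₂ (proj₂ (add-binary a₁)))) a₁ a₂)

  ∼-refl : ∀ {u} → Binary u → u ∼ u
  ∼-refl = add-identityʳ

  ∼-sym : ∀ {u v} → u ∼ v → v ∼ u
  ∼-sym h = let bu , _ , bv = add-binary h in
    add-resp pp-right pp-right pp-left (add-pp (∼-refl bv) h (∼-refl bu))

  add-resp-∼ʳ : ∀ {x y u v} → Add′ x y u → u ∼ v → Add′ x y v
  add-resp-∼ʳ h u∼v = add-resp pp-right pp-right pp-left (add-pp h (∼-refl (proj₁ (add-binary u∼v))) u∼v)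

  ∼-trans : ∀ {u v w} → u ∼ v → v ∼ w → u ∼ w
  ∼-trans = add-resp-∼ʳ

  add-resp-∼ˡ : ∀ {x x′ y u} → Add′ x y u → x ∼ x′ → Add′ x′ y u
  add-resp-∼ˡ h x∼x′ = add-resp pp-left pp-right pp-right (add-pp h (∼-refl (proj₁ (add-binary x∼x′))) (∼-sym x∼x′))

  ∼-det : ∀ {x x′ y u u′} → Add′ x y u → Add′ x′ y u′ → x ∼ x′ → u ∼ u′
  ∼-det h h′ x∼x′ = ∼-functional (add-resp-∼ˡ h x∼x′) h′

  add-total : ∀ {x y} → Binary x → Binary y → Add′ x y (pp x α y)
  add-total bx by = add-resp pp-right pp-left (λ _ _ → refl) (add-pp (add-identityʳ bx) (add-identityʳ binary-α) (add-identityˡ by))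

  multiple : ℕ → Tuple
  multiple zero    = α
  multiple (suc j) = pp (multiple j) α β

  binary-multiple : ∀ j → Binary (multiple j)
  binary-multiple zero    = binary-α
  binary-multiple (suc j) = binary-pp {multiple j} {α} {β} (binary-multiple j) binary-α binary-β

  add-multiple : ∀ i j → Add′ (multiple i) (multiple j) (multiple (i + j))
  add-multiple i zero    = subst (λ z → Add′ (multiple i) α (multiple z)) (sym (+-identityʳ i)) (add-identityʳ (binary-multiple i))
  add-multiple i (suc j) = subst (λ z → Add′ (multiple i) (multiple (suc j)) (multiple z)) (sym (+-suc i j))
    (add-resp pp-right (λ _ _ → refl) (λ _ _ → refl)
      (add-pp (add-multiple i j) (add-identityʳ binary-α) (add-identityˡ binary-β)))

  -- Cancelling j copies of β would leave α ∼ β.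
  multiple-suc≁ : ∀ j → ¬ multiple j ∼ multiple (suc j)
  multiple-suc≁ j h = α≁β (∼-functional
      (add-resp pp-left pp-right pp-left (add-pp (add-resp (λ _ _ → refl) pp-left (λ _ _ → refl) step) h (add-identityʳ binary-α)))
      (add-identityˡ binary-β))
    where
    step : Add′ (multiple j) (multiple 1) (multiple (suc j))
    step = subst (λ z → Add′ (multiple j) (multiple 1) (multiple z)) (+-comm j 1) (add-multiple j 1)

  k d : ℕ
  k = suc (size S)
  d = (k ^ k) ^ k

  abstract
    encode : Tuple → Fin d
    encode u = Fin.funToFin (λ a → Fin.funToFin (u a))

    decode : Fin d → Tuple
    decode i a = Fin.finToFun (Fin.finToFun i a)

    decode-encode : ∀ u → decode (encode u) ≗₂ u
    decode-encode u a b = trans (cong (λ i → Fin.finToFun i b) (Fin.finToFun-funToFin (λ a → Fin.funToFin (u a)) a)) (Fin.finToFun-funToFin (u a) b)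

  abstract
    -- Among the first d + 1 multiples of β two coincide, as there are only d tuples. Cancelling the
    -- smaller one leaves a positive multiple of β that vanishes.
    period : ∃ λ m′ → Add′ α (multiple (suc m′)) α
    period with Fin.pigeonhole (n<1+n d) (λ (i : Fin (suc d)) → encode (multiple (Fin.toℕ i)))
    ... | i , j , i<j , eq = m′ , add-resp pp-left pp-right pp-left
        (add-pp (add-resp (λ _ _ → refl) (λ _ _ → refl) back (add-multiple (Fin.toℕ i) (suc m′))) (∼-refl (binary-multiple (Fin.toℕ i))) (add-identityʳ binary-α))
      where
      m′ : ℕ
      m′ = Fin.toℕ j ∸ suc (Fin.toℕ i)
      i+m≡j : Fin.toℕ i + suc m′ ≡ Fin.toℕ j
      i+m≡j = trans (+-suc (Fin.toℕ i) m′) (m+[n∸m]≡n i<j)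
      back : multiple (Fin.toℕ i + suc m′) ≗₂ multiple (Fin.toℕ i)
      back a b = trans (cong (λ z → multiple z a b) i+m≡j) (trans (sym (decode-encode (multiple (Fin.toℕ j)) a b))
        (trans (cong (λ z → decode z a b) (sym eq)) (decode-encode (multiple (Fin.toℕ i)) a b)))

  m′ : ℕ
  m′ = proj₁ period

  m : ℕ
  m = suc m′

  multiple-+m : ∀ j → multiple (j + m) ∼ multiple j
  multiple-+m j = ∼-functional (add-multiple j m)
    (add-resp pp-right pp-left pp-right (add-pp (add-identityʳ (binary-multiple j)) (add-identityʳ binary-α) (proj₂ period)))

  multiple-+* : ∀ j q → multiple (j + q * m) ∼ multiple j
  multiple-+* j zero    = subst (λ z → multiple z ∼ multiple j) (sym (+-identityʳ j)) (∼-refl (binary-multiple j))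
  multiple-+* j (suc q) = ∼-trans (subst (λ z → multiple z ∼ multiple (j + q * m)) (trans (+-assoc j (q * m) m) (cong (λ z → j + z) (+-comm (q * m) m))) (multiple-+m (j + q * m))) (multiple-+* j q)

  multiple-% : ∀ j → multiple j ∼ multiple (j % m)
  multiple-% j = subst (λ z → multiple z ∼ multiple (j % m)) (sym (m≡m%n+[m/n]*n j m)) (multiple-+* (j % m) (j / m))

  -- Reducing modulo m makes numbers of equal residue give the same tuple and not merely equivalent
  -- ones, since the two families must coincide literally on what is seen.
  val : ℕ → Tuple
  val j = multiple (j % m)

  val≁ : ∀ {u} j → u ∼ val j → ¬ u ∼ val (suc j)
  val≁ j h h′ = multiple-suc≁ j (∼-trans (multiple-% j) (∼-trans (∼-trans (∼-sym h) h′) (∼-sym (multiple-% (suc j)))))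

  add-val : ∀ i j → Add′ (val i) (val j) (val (i + j))
  add-val i j = subst (λ z → Add′ (val i) (val j) (multiple z)) (sym (%-distribˡ-+ i j m))
    (add-resp-∼ʳ (add-multiple (i % m) (j % m)) (multiple-% (i % m + j % m)))

-- Lines in a grid

toℕ-mod : ∀ a n .{{_ : NonZero n}} → a < n → Fin.toℕ (a mod n) ≡ a
toℕ-mod a n a<n = trans (Fin.toℕ-fromℕ< (m%n<n a n)) (m<n⇒m%n≡m a<n)

lines-meet-once : ∀ a b a′ b′ c c′ → a * c + b ≡ a′ * c + b′ → a * c′ + b ≡ a′ * c′ + b′ → c ≢ c′ → a ≡ a′ × b ≡ b′
lines-meet-once a b a′ b′ c c′ e e′ c≢c′ = a≡a′ , +-cancelˡ-≡ (a * c) b b′ (trans e (cong (λ z → z * c + b′) (sym a≡a′)))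
  where
  open ℤ.+-*-Solver
  cast : ∀ c → a * c + b ≡ a′ * c + b′ → + a ℤ.* + c ℤ.+ + b ≡ + a′ ℤ.* + c ℤ.+ + b′
  cast c eq = trans (cong (ℤ._+ + b) (sym (ℤ.pos-* a c))) (trans (cong +_ eq) (cong (ℤ._+ + b′) (ℤ.pos-* a′ c)))
  product-0 : (+ a ℤ.- + a′) ℤ.* (+ c ℤ.- + c′) ≡ + 0
  product-0 = trans
    (solve 6 (λ a b a′ b′ c c′ → (a :- a′) :* (c :- c′) := ((a :* c :+ b) :- (a′ :* c :+ b′)) :- ((a :* c′ :+ b) :- (a′ :* c′ :+ b′))) refl (+ a) (+ b) (+ a′) (+ b′) (+ c) (+ c′))
    (cong₂ ℤ._-_ (ℤ.i≡j⇒i-j≡0 (cast c e)) (ℤ.i≡j⇒i-j≡0 (cast c′ e′)))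
  differences-0 : ∀ i j → i ℤ.* j ≡ + 0 → i ≡ + 0 ⊎ j ≡ + 0
  differences-0 i j = ℤ.i*j≡0⇒i≡0∨j≡0 i
  a≡a′ : a ≡ a′
  a≡a′ = Sum.[ (λ eq → ℤ.+-injective (ℤ.i-j≡0⇒i≡j (+ a) (+ a′) eq))
             , (λ eq → ⊥-elim (c≢c′ (ℤ.+-injective (ℤ.i-j≡0⇒i≡j (+ c) (+ c′) eq)))) ]′
         (differences-0 (+ a ℤ.- + a′) (+ c ℤ.- + c′) product-0)

-- Points (c, e) of a grid with layers c ≤ K, and lines c ↦ (c, a c + b) with a < N, b < N².

module Lines (K N : ℕ) where

  H : ℕ
  H = suc (N * K + N * N)

  L : ℕ
  L = suc K * H

  -- The points number about (K + 1)N² for large N, so N³ lines outnumber them by any prescribed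
  -- factor; the counting argument rests on this.
  #lines : ℕ
  #lines = N * (N * N)

  abstract
    point : ℕ → ℕ → Fin L
    point c e = Fin.combine (c mod suc K) (e mod H)

    point-injective : ∀ {c e c′ e′} → c ≤ K → e < H → c′ ≤ K → e′ < H → point c e ≡ point c′ e′ → c ≡ c′ × e ≡ e′
    point-injective {c} {e} {c′} {e′} c≤ e< c′≤ e′< eq =
      let c≡ , e≡ = Fin.combine-injective (c mod suc K) (e mod H) (c′ mod suc K) (e′ mod H) eq
      in trans (sym (toℕ-mod c (suc K) (s≤s c≤))) (trans (cong Fin.toℕ c≡) (toℕ-mod c′ (suc K) (s≤s c′≤))) ,
         trans (sym (toℕ-mod e H e<)) (trans (cong Fin.toℕ e≡) (toℕ-mod e′ H e′<))

    slope offset : Fin #lines → ℕ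
    slope  i = Fin.toℕ (proj₁ (Fin.remQuot {N} (N * N) i))
    offset i = Fin.toℕ (proj₂ (Fin.remQuot {N} (N * N) i))

    height< : ∀ i {c} → c ≤ K → slope i * c + offset i < H
    height< i {c} c≤ = s≤s (+-mono-≤ (*-mono-≤ (<⇒≤ (Fin.toℕ<n (proj₁ (Fin.remQuot {N} (N * N) i)))) c≤) (<⇒≤ (Fin.toℕ<n (proj₂ (Fin.remQuot {N} (N * N) i)))))

    line-ext : ∀ i j → slope i ≡ slope j → offset i ≡ offset j → i ≡ j
    line-ext i j s≡ o≡ = trans (sym (Fin.combine-remQuot {N} (N * N) i)) (trans
      (cong₂ (Fin.combine {N}) (Fin.toℕ-injective s≡) (Fin.toℕ-injective o≡)) (Fin.combine-remQuot {N} (N * N) j))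

  line : Fin #lines → ℕ → Fin L
  line i c = point c (slope i * c + offset i)

  -- The common first summand of all lines. It lies in layer K, whereas the other summands and the
  -- hidden layer B lie below K, so flips in layer B leave it alone.
  origin : Fin L
  origin = point K 0

  line-layer : ∀ i j {c c′} → c ≤ K → c′ ≤ K → line i c ≡ line j c′ → c ≡ c′
  line-layer i j c≤ c′≤ eq = proj₁ (point-injective c≤ (height< i c≤) c′≤ (height< j c′≤) eq)

  line≢origin : ∀ i {c} → c < K → line i c ≢ origin
  line≢origin i c<K eq = <⇒≢ c<K (proj₁ (point-injective (<⇒≤ c<K) (height< i (<⇒≤ c<K)) ≤-refl (s≤s z≤n) eq))

  lines-meet : ∀ i j {c c′} → c ≤ K → c′ ≤ K → i ≢ j → line i c ≡ line j c → line i c′ ≡ line j c′ → c ≡ c′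
  lines-meet i j {c} {c′} c≤ c′≤ i≢j e e′ with c ℕ.≟ c′
  ... | yes p = p
  ... | no c≢c′ = ⊥-elim (i≢j (let s≡ , o≡ = lines-meet-once (slope i) (offset i) (slope j) (offset j) c c′ (h c≤ e) (h c′≤ e′) c≢c′ in line-ext i j s≡ o≡))
    where
    h : ∀ {c} → c ≤ K → line i c ≡ line j c → slope i * c + offset i ≡ slope j * c + offset j
    h c≤ e = proj₂ (point-injective c≤ (height< i c≤) c≤ (height< j c≤) e)

length-cartesian : ∀ (f : X → Y → Z) xs ys → length (cartesianProductWith f xs ys) ≡ length xs * length ys
length-cartesian f xs ys = trans (length-∑ (cartesianProductWith f xs ys)) (trans (∑-cartesian f xs ys (λ _ → 1))
  (trans (∑-const xs _) (cong (length xs *_) (sym (length-∑ ys)))))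

n≤8^n : ∀ n → n ≤ 8 ^ n
n≤8^n zero    = z≤n
n≤8^n (suc n) = begin
  1 + n              ≤⟨ +-mono-≤ (m^n>0 8 n) (n≤8^n n) ⟩
  8 ^ n + 8 ^ n      ≡⟨ cong (λ z → 8 ^ n + z) (sym (+-identityʳ _)) ⟩
  2 * 8 ^ n          ≤⟨ *-monoˡ-≤ (8 ^ n) {2} {8} (s≤s (s≤s z≤n)) ⟩
  8 * 8 ^ n          ∎
  where open ≤-Reasoning

-- Take N = 2M, so that N³ = 8M³ and r + 1 = M³. Since 1 and K are at most M, the height 1 + NK + N²
-- is at most 7M², and the choice M = 7(t + 1)(K + 1) absorbs the remaining factors.
hidden-sizes : ∀ t K → ∃ λ N → ∃ λ r → Lines.#lines K N ≡ 8 * suc r × t * Lines.L K N ≤ suc r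
hidden-sizes t K = 2 * M , pred (M * (M * M)) , cubes , bound
  where
  σ = suc t
  M = 7 * (σ * suc K)
  M>0 : 1 ≤ M
  M>0 = *-mono-≤ {1} {7} (s≤s z≤n) (*-mono-≤ {1} {σ} (s≤s z≤n) (s≤s z≤n))
  suc-r : suc (pred (M * (M * M))) ≡ M * (M * M)
  suc-r = suc-pred (M * (M * M)) {{>-nonZero (*-mono-≤ M>0 (*-mono-≤ M>0 M>0))}}
  cubes : 2 * M * (2 * M * (2 * M)) ≡ 8 * suc (pred (M * (M * M)))
  cubes = trans (eq M) (cong (8 *_) (sym suc-r))
    where
    open +-*-Solver
    eq : ∀ n → 2 * n * (2 * n * (2 * n)) ≡ 8 * (n * (n * n))
    eq = solve 1 (λ n → con 2 :* n :* (con 2 :* n :* (con 2 :* n)) := con 8 :* (n :* (n :* n))) refl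
  K≤M : K ≤ M
  K≤M = ≤-trans (n≤1+n K) (≤-trans (m≤n*m (suc K) σ) (m≤n*m (σ * suc K) 7))
  expand : ∀ σ k n → σ * (k * (n * n + (2 * n * n + 2 * n * (2 * n)))) ≡ 7 * (σ * k) * (n * n)
  expand = solve 3 (λ σ k n → σ :* (k :* (n :* n :+ (con 2 :* n :* n :+ con 2 :* n :* (con 2 :* n)))) := con 7 :* (σ :* k) :* (n :* n)) refl
    where open +-*-Solver
  bound : t * Lines.L K (2 * M) ≤ suc (pred (M * (M * M)))
  bound = begin
    t * (suc K * suc (2 * M * K + 2 * M * (2 * M)))           ≤⟨ *-monoˡ-≤ _ (n≤1+n t) ⟩
    σ * (suc K * suc (2 * M * K + 2 * M * (2 * M)))           ≤⟨ *-monoʳ-≤ σ (*-monoʳ-≤ (suc K) (s≤s (+-monoˡ-≤ (2 * M * (2 * M)) (*-monoʳ-≤ (2 * M) K≤M)))) ⟩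
    σ * (suc K * (1 + (2 * M * M + 2 * M * (2 * M))))         ≤⟨ *-monoʳ-≤ σ (*-monoʳ-≤ (suc K) (+-monoˡ-≤ (2 * M * M + 2 * M * (2 * M)) (*-mono-≤ M>0 M>0))) ⟩
    σ * (suc K * (M * M + (2 * M * M + 2 * M * (2 * M))))     ≡⟨ expand σ (suc K) M ⟩
    M * (M * M)                                               ≡⟨ sym suc-r ⟩
    suc (pred (M * (M * M)))                                  ∎
    where open ≤-Reasoning

-- Every line i carries the partial sums of a random vector ω along its points, and the satisfying assignments
-- are given by these sums.  For a hidden layer B, the far assignments add a fixed w i ∈ {0, 1} to the sums
-- after layer B.  This cannot be noticed by looking at few points and lines: adding w i to the value at layer B of each
-- line i that is looked at changes the satisfying assignment into the far one there.

module Linear (S : Structure) (p : Op₃ S) (pol-p : IsPolymorphism₃ S p) (maltsev : IsMaltsev p)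
              (¬maj : ¬ HasMajorityPolymorphism S) where

  open Addition S p pol-p maltsev ¬maj hiding (k)

  module _ (K₁ N r : ℕ) (#lines≡ : Lines.#lines (suc K₁) N ≡ 8 * suc r)
           (candidates-bound : m * d * Lines.L (suc K₁) N ≤ suc r) where

    K : ℕ
    K = suc K₁

    open Lines K N

    Edge : Set
    Edge = Fin #lines × Fin K

    Nd : Set
    Nd = Fin L ⊎ Edge

    prefix : Fin #lines → Fin (suc K) → Nd
    prefix i zero    = inj₁ origin
    prefix i (suc c) = inj₂ (i , c)

    xNode yNode uNode : Edge → Nd
    xNode (i , c) = prefix i (Fin.inject₁ c)
    yNode (i , c) = inj₁ (line i (Fin.toℕ c))
    uNode (i , c) = inj₂ (i , c)

    last : Fin #lines → Nd
    last i = inj₂ (i , Fin.fromℕ K₁)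

    marked : List Nd
    marked = map last (allFin #lines)

    finEdge : Finite Edge
    finEdge = fin× (finFin #lines) (finFin K)

    finNd : Finite Nd
    finNd = fin⊎ (finFin L) finEdge

    abstract
      length-marked : length marked ≡ 8 * suc r
      length-marked = trans (List.length-map last (allFin #lines)) (trans (length-allFin #lines) #lines≡)

    open Gadgets S finNd finEdge xNode yNode uNode marked r length-marked hiding (D) public

    psum : Vec ℕ L → Fin #lines → ℕ → ℕ
    psum ω i zero    = lookup ω origin
    psum ω i (suc c) = psum ω i c + lookup ω (line i c)

    Codes : Set
    Codes = Vec (Fin d) L

    eval : Codes → Fin #lines → ℕ → Tuple
    eval ζ i zero    = decode (lookup ζ origin)
    eval ζ i (suc c) = pp (eval ζ i c) α (decode (lookup ζ (line i c)))

    -- The sum along line i determined by the values ζ of the points is the one that ω and b prescribe.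
    Agreement : Vec ℕ L × Codes → Fin #lines → Bool → Set
    Agreement (ω , ζ) i b = eval ζ i K ∼ val (psum ω i K + ind b)

    agreement-exclusive : ∀ c i → ¬ (Agreement c i true × Agreement c i false)
    agreement-exclusive (ω , ζ) i (h₁ , h₀) = val≁ (psum ω i K + 0) h₀
      (subst (λ z → eval ζ i K ∼ val z) (trans (+-comm (psum ω i K) 1) (cong suc (sym (+-identityʳ (psum ω i K))))) h₁)

    -- At the end of a line the far sum depends on ω and w but not on B, as every hidden layer comes
    -- before the end; the sum of a solution depends, up to `∼`, only on its values ζ at the points.
    -- So w has to avoid no more than these (m d)^L pairs.
    candidates : List (Vec ℕ L × Codes)
    candidates = cartesianProduct (residues m′ L) (allVecs (allFin d) L)

    length-candidates : length candidates ≤ 8 ^ suc r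
    length-candidates = begin
      length candidates                                        ≡⟨ length-cartesian _,_ (residues m′ L) (allVecs (allFin d) L) ⟩
      length (residues m′ L) * length (allVecs (allFin d) L)   ≡⟨ cong₂ _*_ (length-allVecs (upTo m) L) (length-allVecs (allFin d) L) ⟩
      length (upTo m) ^ L * length (allFin d) ^ L              ≡⟨ cong₂ (λ a b → a ^ L * b ^ L) (List.length-upTo m) (length-allFin d) ⟩
      m ^ L * d ^ L                                            ≡⟨ *-^ L m d ⟨
      (m * d) ^ L                                              ≤⟨ ^-monoˡ-≤ L (n≤8^n (m * d)) ⟩
      (8 ^ (m * d)) ^ L                                        ≡⟨ ^-*-assoc 8 (m * d) L ⟩
      8 ^ (m * d * L)                                          ≤⟨ ^-monoʳ-≤ 8 candidates-bound ⟩
      8 ^ suc r                                                    ∎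
      where open ≤-Reasoning

    -- At least r + 1 of the 8(r + 1) lines then disagree, which is the number of changes that
    -- `far-from` asks for.
    FewAgreements : (Fin #lines → Bool) → Set
    FewAgreements w = ∀ {c} → c ∈ candidates →
      Σ (∀ i → Dec (Agreement c i (w i))) λ dec → ∑ (allFin #lines) (λ i → ind (does (dec i))) ≤ 7 * suc r

    -- Choosing w involves deciding finitely many agreements. The final goal is a negation, so these
    -- instances of excluded middle may be assumed under a double negation.
    far-vector : ¬ ¬ ∃ FewAgreements
    far-vector ¬w = ¬¬-All {P = λ c → ∀ i → Dec (Agreement c i true) × Dec (Agreement c i false)}
        (λ c → ¬¬-∀ (λ i ¬d → ¬¬-dec (Agreement c i true) (λ d₁ → ¬¬-dec (Agreement c i false) (λ d₀ → ¬d (d₁ , d₀)))))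
        candidates (λ decs → ¬w (choose decs))
      where
      module _ (decs : All (λ c → ∀ i → Dec (Agreement c i true) × Dec (Agreement c i false)) candidates) where
        Tagged : Set
        Tagged = Σ (Vec ℕ L × Codes) (λ c → ∀ i → Dec (Agreement c i true) × Dec (Agreement c i false))
        decide : (τ : Tagged) → ∀ i b → Dec (Agreement (proj₁ τ) i b)
        decide τ i true  = proj₁ (proj₂ τ i)
        decide τ i false = proj₂ (proj₂ τ i)
        table : Tagged → Fin #lines → Bool → Bool
        table τ i b = does (decide τ i b)
        exclusive : ∀ τ i → ¬ (table τ i true ≡ true × table τ i false ≡ true)
        exclusive τ i (e₁ , e₀) = agreement-exclusive (proj₁ τ) i (does⇒ (decide τ i true) e₁ , does⇒ (decide τ i false) e₀)
        choose : ∃ FewAgreements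
        choose with few-agreements (tag decs) #lines table exclusive (λ _ → 1)
        ... | w , total = w , λ {c} c∈ →
          let ds , τ∈ = ∈-tag decs c∈
              a = ∑ (allFin #lines) (λ i → ind (table (c , ds) i (w i)))
          in (λ i → decide (c , ds) i (w i)) , agreement-bound (suc r) a (length (tag decs))
            (≤-trans (≤-reflexive (length-tag decs)) length-candidates)
            (subst (λ z → 2 ^ z * 8 ^ a ≤ 9 ^ z * length (tag decs)) #lines≡ (begin
              2 ^ #lines * 8 ^ a
                ≤⟨ *-monoʳ-≤ (2 ^ #lines) (≤-trans (≤-reflexive (sym (*-identityˡ (8 ^ a)))) (∈⇒≤∑ (λ τ → 1 * 8 ^ ∑ (allFin #lines) (λ i → ind (table τ i (w i)))) τ∈)) ⟩
              2 ^ #lines * ∑ (tag decs) (λ τ → 1 * 8 ^ ∑ (allFin #lines) (λ i → ind (table τ i (w i))))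
                ≤⟨ total ⟩
              9 ^ #lines * ∑ (tag decs) (λ _ → 1)
                ≡⟨ cong (9 ^ #lines *_) (sym (length-∑ (tag decs))) ⟩
              9 ^ #lines * length (tag decs) ∎))
          where open ≤-Reasoning

    module _ (w : Fin #lines → Bool) (few : FewAgreements w) where

      -- The flag t is true for the far assignments.
      jump : Bool → Fin K → Fin #lines → ℕ → ℕ
      jump t B i c = ind (t ∧ does (Fin.toℕ B ℕ.<? c) ∧ w i)

      hiddenSum : Bool → Fin K → Vec ℕ L → Fin #lines → ℕ → ℕ
      hiddenSum t B ω i c = psum ω i c + jump t B i c

      number : Bool → Fin K → Vec ℕ L → Nd → ℕ
      number t B ω (inj₁ q)       = lookup ω q
      number t B ω (inj₂ (i , c)) = hiddenSum t B ω i (suc (Fin.toℕ c))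

      jump-0 : ∀ t B i → jump t B i 0 ≡ 0
      jump-0 true  B i = refl
      jump-0 false B i = refl

      number-prefix : ∀ t B ω i c → number t B ω (prefix i c) ≡ hiddenSum t B ω i (Fin.toℕ c)
      number-prefix t B ω i zero    = sym (trans (cong (λ z → lookup ω origin + z) (jump-0 t B i)) (+-identityʳ _))
      number-prefix t B ω i (suc c) = refl

      number-x : ∀ t B ω i c → number t B ω (xNode (i , c)) ≡ hiddenSum t B ω i (Fin.toℕ c)
      number-x t B ω i c = trans (number-prefix t B ω i (Fin.inject₁ c)) (cong (hiddenSum t B ω i) (Fin.toℕ-inject₁ c))

      nodeOf : Bool → Fin K → Vec ℕ L → Nd → Tuple
      nodeOf t B ω ν = val (number t B ω ν)

      -- The numbers are reduced first, so that the operation, and with it the private variables,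
      -- depends on the residues alone.
      opOf : Bool → Fin K → Vec ℕ L → Edge → Op₃ S
      opOf t B ω e = Add.op (add-val (number t B ω (xNode e) % m) (number t B ω (yNode e) % m))

      hiddenAssignment : Bool → Fin K → Vec ℕ L → Assignment S n
      hiddenAssignment t B ω = assign (nodeOf t B ω) (opOf t B ω)

      yes-satisfies : ∀ B ω → Satisfies I (hiddenAssignment false B ω)
      yes-satisfies B ω = assign-satisfies (nodeOf false B ω) (opOf false B ω)
        (λ e → Add.pol (sum e)) (λ e → Add.idem (sum e))
        (λ e a b → trans (Add.op-x (sum e) a b) (cong (λ z → multiple z a b) (m%n%n≡m%n (x e) m)))
        (λ e a b → trans (Add.op-y (sum e) a b) (cong (λ z → multiple z a b) (m%n%n≡m%n (y e) m)))
        (λ e a b → trans (Add.op-u (sum e) a b) (cong (λ z → multiple z a b)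
          (trans (sym (%-distribˡ-+ (x e) (y e) m)) (cong (_% m) (x+y e)))))
        where
        x y : Edge → ℕ
        x e = number false B ω (xNode e)
        y e = number false B ω (yNode e)
        sum : ∀ e → Add′ (val (x e % m)) (val (y e % m)) (val (x e % m + y e % m))
        sum e = add-val (x e % m) (y e % m)
        x+y : ∀ e → x e + y e ≡ number false B ω (uNode e)
        x+y (i , c) = trans (cong (λ z → z + lookup ω (line i (Fin.toℕ c))) (trans (number-x false B ω i c) (+-identityʳ _))) (sym (+-identityʳ _))

      module _ (g : Assignment S n) (sat : Satisfies I g) (std : Standard g) where

        codes : Codes
        codes = Vec.tabulate (λ q → encode (nodeval g (inj₁ q)))

        decode-codes : ∀ q → decode (lookup codes q) ≗₂ nodeval g (inj₁ q)
        decode-codes q a b = trans (cong (λ z → decode z a b) (Vec.lookup∘tabulate (λ q → encode (nodeval g (inj₁ q))) q)) (decode-encode (nodeval g (inj₁ q)) a b)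

        edge-add : ∀ e → Add′ (nodeval g (xNode e)) (nodeval g (yNode e)) (nodeval g (uNode e))
        edge-add = satisfies⇒Add g sat std

        prefix∼eval : ∀ i c → nodeval g (prefix i c) ∼ eval codes i (Fin.toℕ c)
        prefix∼eval i = <-weakInduction (λ c → nodeval g (prefix i c) ∼ eval codes i (Fin.toℕ c)) base step
          where
          base : nodeval g (inj₁ origin) ∼ decode (lookup codes origin)
          base = add-resp (λ _ _ → refl) (λ _ _ → refl) (λ a b → sym (decode-codes origin a b)) (∼-refl (proj₁ (add-binary (edge-add (i , zero)))))
          step : ∀ c → nodeval g (prefix i (Fin.inject₁ c)) ∼ eval codes i (Fin.toℕ (Fin.inject₁ c)) →
                 nodeval g (inj₂ (i , c)) ∼ eval codes i (suc (Fin.toℕ c))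
          step c ih = ∼-det (edge-add (i , c)) computed ih′
            where
            ih′ : nodeval g (prefix i (Fin.inject₁ c)) ∼ eval codes i (Fin.toℕ c)
            ih′ = subst (λ z → nodeval g (prefix i (Fin.inject₁ c)) ∼ eval codes i z) (Fin.toℕ-inject₁ c) ih
            computed : Add′ (eval codes i (Fin.toℕ c)) (nodeval g (inj₁ (line i (Fin.toℕ c)))) (eval codes i (suc (Fin.toℕ c)))
            computed = add-resp (λ _ _ → refl) (λ _ _ → refl) (λ a b → cong (λ z → p (eval codes i (Fin.toℕ c) a b) a z) (sym (decode-codes (line i (Fin.toℕ c)) a b)))
              (add-total (proj₂ (proj₂ (add-binary ih′))) (proj₁ (proj₂ (add-binary (edge-add (i , c))))))

        agreement : ∀ B ω i → diff (nodeOf true B ω) g (last i) ≡ 0 → Agreement (ω , codes) i (w i)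
        agreement B ω i d≡0 = add-resp (λ _ _ → refl) (λ _ _ → refl) end (∼-sym (subst (λ z → nodeval g (last i) ∼ eval codes i z) (cong suc (Fin.toℕ-fromℕ K₁)) (prefix∼eval i (suc (Fin.fromℕ K₁)))))
          where
          number-last : number true B ω (last i) ≡ psum ω i K + ind (w i)
          number-last = trans (cong (λ c → hiddenSum true B ω i (suc c)) (Fin.toℕ-fromℕ K₁))
            (cong (λ z → psum ω i K + ind (z ∧ w i)) (dec-true (Fin.toℕ B ℕ.<? K) (Fin.toℕ<n B)))
          end : nodeval g (last i) ≗₂ val (psum ω i K + ind (w i))
          end a b = trans (nodeval-diff-0 (nodeOf true B ω) g (last i) d≡0 (proj₂ (binary-multiple (number true B ω (last i) % m))) a b)
                    (cong (λ z → val z a b) number-last)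

      no-far : ∀ B {ω} → ω ∈ residues m′ L → Far I (threshold S) (hiddenAssignment true B ω)
      no-far B {ω} ω∈ = far-from (nodeOf true B ω) (opOf true B ω) λ g sat std →
        let dec , bound = few {ω , codes g sat std} (∈-cartesianProduct⁺ ω∈ (∈-allVecs (codes g sat std) (λ _ → ∈-allFin _)))
            δ : Fin #lines → ℕ
            δ i = diff (nodeOf true B ω) g (last i)
            each : ∀ i → 1 ≤ ind (does (dec i)) + δ i
            each i = at-least-one (dec i) (agreement g sat std B ω i)
        in +-cancelˡ-≤ (7 * suc r) (suc r) (∑ marked (diff (nodeOf true B ω) g)) (begin
          7 * suc r + suc r                                                     ≡⟨ +-comm (7 * suc r) (suc r) ⟩
          8 * suc r                                                             ≡⟨ trans (sym #lines≡) (sym (length-allFin #lines)) ⟩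
          length (allFin #lines)                                                ≡⟨ length-∑ (allFin #lines) ⟩
          ∑ (allFin #lines) (λ _ → 1)                                           ≤⟨ ∑-mono (allFin #lines) each ⟩
          ∑ (allFin #lines) (λ i → ind (does (dec i)) + δ i)                    ≡⟨ ∑-+ (allFin #lines) (λ i → ind (does (dec i))) δ ⟩
          ∑ (allFin #lines) (λ i → ind (does (dec i))) + ∑ (allFin #lines) δ    ≤⟨ +-monoˡ-≤ (∑ (allFin #lines) δ) bound ⟩
          7 * suc r + ∑ (allFin #lines) δ                                       ≡⟨ cong (λ z → 7 * suc r + z) (sym (∑-map last (allFin #lines) (diff (nodeOf true B ω) g))) ⟩
          7 * suc r + ∑ marked (diff (nodeOf true B ω) g)                       ∎)
        where
        open ≤-Reasoning
        at-least-one : ∀ {P : Set} {e} (d : Dec P) → (e ≡ 0 → P) → 1 ≤ ind (does d) + e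
        at-least-one         (yes _) h = s≤s z≤n
        at-least-one {e = zero}  (no ¬p) h = ⊥-elim (¬p (h refl))
        at-least-one {e = suc e} (no ¬p) h = s≤s z≤n

      Atom : Set
      Atom = Fin L ⊎ Fin #lines

      -- Compensating the jump on line i changes its point in layer B. This would be noticed at that
      -- point itself or on another line through it.
      Conflict : Atom → Atom → Fin K → Set
      Conflict (inj₁ q) (inj₂ i) B = q ≡ line i (Fin.toℕ B)
      Conflict (inj₂ i) (inj₂ j) B = i ≢ j × line i (Fin.toℕ B) ≡ line j (Fin.toℕ B)
      Conflict _        (inj₁ _) B = ⊥

      conflict? : ∀ a a′ B → Dec (Conflict a a′ B)
      conflict? (inj₁ q) (inj₂ i) B = q Fin.≟ line i (Fin.toℕ B)
      conflict? (inj₂ i) (inj₂ j) B = ¬? (i Fin.≟ j) ×-dec (line i (Fin.toℕ B) Fin.≟ line j (Fin.toℕ B))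
      conflict? (inj₁ _) (inj₁ _) B = no λ ()
      conflict? (inj₂ _) (inj₁ _) B = no λ ()

      below : ∀ (B : Fin K) → Fin.toℕ B ≤ K
      below B = <⇒≤ (Fin.toℕ<n B)

      conflict-unique : ∀ a a′ {B B′} → Conflict a a′ B → Conflict a a′ B′ → B ≡ B′
      conflict-unique (inj₁ q) (inj₂ i) {B} {B′} e e′ = Fin.toℕ-injective (line-layer i i (below B) (below B′) (trans (sym e) e′))
      conflict-unique (inj₂ i) (inj₂ j) {B} {B′} (i≢j , e) (_ , e′) = Fin.toℕ-injective (lines-meet i j (below B) (below B′) i≢j e e′)

      atoms : V → List Atom
      atoms (const a)                 = []
      atoms (node (inj₁ q) a b)       = inj₁ q ∷ []
      atoms (node (inj₂ (i , c)) a b) = inj₂ i ∷ []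
      atoms (priv (i , c) a b a′)     = inj₂ i ∷ inj₁ (line i (Fin.toℕ c)) ∷ []

      length-atoms : ∀ v → length (atoms v) ≤ 2
      length-atoms (const a)                 = z≤n
      length-atoms (node (inj₁ q) a b)       = s≤s z≤n
      length-atoms (node (inj₂ (i , c)) a b) = s≤s z≤n
      length-atoms (priv (i , c) a b a′)     = ≤-refl

      module _ (As : List Atom) (B : Fin K) (free : ∀ a a′ → a ∈ As → a′ ∈ As → ¬ Conflict a a′ B) where

        layer : ℕ
        layer = Fin.toℕ B

        Flip : Fin L → Atom → Set
        Flip q (inj₁ _) = ⊥
        Flip q (inj₂ i) = w i ≡ true × line i layer ≡ q

        flip? : ∀ q a → Dec (Flip q a)
        flip? q (inj₁ _) = no λ ()
        flip? q (inj₂ i) = (w i Bool.≟ true) ×-dec (line i layer Fin.≟ q)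

        flipped : Fin L → Bool
        flipped q = does (any? (flip? q) As)

        flips : Vec Bool L
        flips = Vec.tabulate flipped

        not-flipped : ∀ q → (∀ i → inj₂ i ∈ As → w i ≡ true → line i layer ≢ q) → flipped q ≡ false
        not-flipped q h = dec-false (any? (flip? q) As) λ any → contra (find any)
          where
          contra : ¬ ∃ λ a → a ∈ As × Flip q a
          contra (inj₂ i , i∈ , wi , eq) = h i i∈ wi eq

        lookup-shift : ∀ ω q → lookup (shift m′ flips ω) q ≡ incIf m′ (flipped q) (lookup ω q)
        lookup-shift ω q = trans (Vec.lookup-zipWith (incIf m′) q flips ω) (cong (λ b → incIf m′ b (lookup ω q)) (Vec.lookup∘tabulate flipped q))

        lookup-unflipped : ∀ ω q → flipped q ≡ false → lookup (shift m′ flips ω) q ≡ lookup ω q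
        lookup-unflipped ω q eq = trans (lookup-shift ω q) (cong (λ b → incIf m′ b (lookup ω q)) eq)

        shift-point : ∀ ω q → inj₁ q ∈ As → lookup (shift m′ flips ω) q ≡ lookup ω q
        shift-point ω q q∈ = lookup-unflipped ω q (not-flipped q (λ i i∈ _ eq → free (inj₁ q) (inj₂ i) q∈ i∈ (sym eq)))

        shift-origin : ∀ ω → lookup (shift m′ flips ω) origin ≡ lookup ω origin
        shift-origin ω = lookup-unflipped ω origin (not-flipped origin (λ i _ _ → line≢origin i (Fin.toℕ<n B)))

        incIf-% : ∀ b x → incIf m′ b x % m ≡ (x + ind b) % m
        incIf-% true  x = trans (m%n%n≡m%n (suc x) m) (cong (_% m) (+-comm 1 x))
        incIf-% false x = cong (_% m) (sym (+-identityʳ x))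

        %-cong-+ : ∀ a a′ b b′ → a % m ≡ a′ % m → b % m ≡ b′ % m → (a + b) % m ≡ (a′ + b′) % m
        %-cong-+ a a′ b b′ e e′ = trans (%-distribˡ-+ a b m) (trans (cong₂ (λ x y → (x + y) % m) e e′) (sym (%-distribˡ-+ a′ b′ m)))

        -- The jump sets in right after the point of layer B. That point is flipped exactly if w i
        -- holds, as no other inspected line passes through it, and no point of another layer on the
        -- line is flipped.
        flipped-line : ∀ i c → inj₂ i ∈ As → c < K → ind (flipped (line i c)) + jump true B i c ≡ jump true B i (suc c)
        flipped-line i c i∈ c<K with layer ℕ.≟ c
        ... | yes refl = trans (cong₂ _+_ (cong ind (flipped≡w (w i) refl)) (cong (λ z → ind (z ∧ w i)) (dec-false (layer ℕ.<? layer) (<-irrefl refl))))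
                           (trans (+-identityʳ _) (cong (λ z → ind (z ∧ w i)) (sym (dec-true (layer ℕ.<? suc layer) (n<1+n layer)))))
          where
          flipped≡w : ∀ b → w i ≡ b → flipped (line i layer) ≡ b
          flipped≡w true  wi = dec-true (any? (flip? (line i layer)) As) (lose i∈ (wi , refl))
          flipped≡w false wi = not-flipped (line i layer) none
            where
            none : ∀ j → inj₂ j ∈ As → w j ≡ true → line j layer ≢ line i layer
            none j j∈ wj eq with j Fin.≟ i
            ... | no j≢i   = free (inj₂ j) (inj₂ i) j∈ i∈ (j≢i , eq)
            ... | yes refl with trans (sym wj) wi
            ...   | ()
        ... | no B≢c = trans (cong (λ z → ind z + jump true B i c) (not-flipped (line i c) (λ j _ _ eq → B≢c (line-layer j i (below B) (<⇒≤ c<K) eq))))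
                         (cong (λ z → ind (z ∧ w i)) (does-⇔ (mk⇔ m<n⇒m<1+n (λ B<1+c → ≤∧≢⇒< (≤-pred B<1+c) B≢c)) (layer ℕ.<? c) (layer ℕ.<? suc c)))

        shift-psum : ∀ ω i → inj₂ i ∈ As → ∀ c → c ≤ K → psum (shift m′ flips ω) i c % m ≡ hiddenSum true B ω i c % m
        shift-psum ω i i∈ zero    _   = cong (_% m) (trans (shift-origin ω) (sym (+-identityʳ _)))
        shift-psum ω i i∈ (suc c) c<K = begin
          (psum (shift m′ flips ω) i c + lookup (shift m′ flips ω) q) % m
            ≡⟨ %-cong-+ (psum (shift m′ flips ω) i c) (hiddenSum true B ω i c) (lookup (shift m′ flips ω) q) (lookup ω q + ind (flipped q)) (shift-psum ω i i∈ c (<⇒≤ c<K)) (trans (cong (_% m) (lookup-shift ω q)) (incIf-% (flipped q) (lookup ω q))) ⟩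
          (psum ω i c + jump true B i c + (lookup ω q + ind (flipped q))) % m
            ≡⟨ cong (_% m) (solve 4 (λ s j x f → s :+ j :+ (x :+ f) := s :+ x :+ (f :+ j)) refl (psum ω i c) (jump true B i c) (lookup ω q) (ind (flipped q))) ⟩
          (psum ω i c + lookup ω q + (ind (flipped q) + jump true B i c)) % m
            ≡⟨ cong (λ z → (psum ω i c + lookup ω q + z) % m) (flipped-line i c i∈ c<K) ⟩
          hiddenSum true B ω i (suc c) % m ∎
          where
          open ≡-Reasoning
          open +-*-Solver
          q = line i c

        shift-line : ∀ ω i → inj₂ i ∈ As → ∀ c → c ≤ K → hiddenSum true B ω i c % m ≡ hiddenSum false B (shift m′ flips ω) i c % m
        shift-line ω i i∈ c c≤ = sym (trans (cong (_% m) (+-identityʳ (psum (shift m′ flips ω) i c))) (shift-psum ω i i∈ c c≤))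

        shift-value : ∀ ω v → (∀ {a} → a ∈ atoms v → a ∈ As) →
          value (nodeOf true B ω) (opOf true B ω) v ≡ value (nodeOf false B (shift m′ flips ω)) (opOf false B (shift m′ flips ω)) v
        shift-value ω (const a)                 h = refl
        shift-value ω (node (inj₁ q) a b)       h = cong (λ z → val z a b) (sym (shift-point ω q (h (here refl))))
        shift-value ω (node (inj₂ (i , c)) a b) h = cong (λ z → multiple z a b) (shift-line ω i (h (here refl)) (suc (Fin.toℕ c)) (Fin.toℕ<n c))
        shift-value ω (priv (i , c) a b a′)     h = cong₂ (λ y z → Add.op (add-val y z) a b a′)
          (trans (cong (_% m) (number-x true B ω i c)) (trans (shift-line ω i (h (here refl)) (Fin.toℕ c) (<⇒≤ (Fin.toℕ<n c))) (cong (_% m) (sym (number-x false B (shift m′ flips ω) i c)))))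
          (cong (_% m) (sym (shift-point ω (line i (Fin.toℕ c)) (h (there (here refl))))))

      untestable : ∀ q → 16 * (queryBound (suc (size S)) q * queryBound (suc (size S)) q) ≤ K → ∀ ts → ¬ IsTester false I (threshold S) q ts
      untestable q large = no-tester I (threshold S) q m′ (hiddenAssignment false) (hiddenAssignment true) yes-satisfies no-far fool (s≤s z≤n)
        where
        fool : ∀ (W : List (Fin n)) → length W ≤ queryBound (suc (size S)) q →
               ∃ λ (bad : Fin K → Bool) → 4 * ∑ (allFin K) (ind ∘ bad) ≤ K ×
                 (∀ B → bad B ≡ false → ∃ λ ρ → ∀ ω {x} → x ∈ W → hiddenAssignment true B ω x ≡ hiddenAssignment false B (shift m′ ρ ω) x)
        fool W len = conflicting Conflict conflict? conflict-unique As , few-bad , good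
          where
          As = concatMap (atoms ∘ dec FV) W
          few-bad : 4 * ∑ (allFin K) (ind ∘ conflicting Conflict conflict? conflict-unique As) ≤ K
          few-bad = ≤-trans (few-conflicts-queried Conflict conflict? conflict-unique (queryBound (suc (size S)) q) (atoms ∘ dec FV) (λ x → length-atoms (dec FV x)) W len) large
          good : ∀ B → conflicting Conflict conflict? conflict-unique As B ≡ false → ∃ λ ρ → ∀ ω {x} → x ∈ W → hiddenAssignment true B ω x ≡ hiddenAssignment false B (shift m′ ρ ω) x
          good B eq = flips As B free , λ ω {x} x∈ → shift-value As B free ω (dec FV x) (λ a∈ → ∈-concatMap x∈ a∈)
            where
            free : ∀ a a′ → a ∈ As → a′ ∈ As → ¬ Conflict a a′ B
            free = no-conflict Conflict conflict? conflict-unique As B eq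

no-majority⇒untestable : ∀ S → HasMaltsevPolymorphism S → ¬ HasMajorityPolymorphism S → ¬ ConstantQueryTestable S
no-majority⇒untestable S (p , pol-p , maltsev) ¬maj testable with testable (threshold S) (unitFraction>0 (gapDenominator S)) (unitFraction<1 (2 * (size S + 8 * (suc (size S) * suc (size S)))))
... | q , tester = with-sizes (hidden-sizes (m * d) (suc K₁))
  where
  open Addition S p pol-p maltsev ¬maj using (m; d)
  open Linear S p pol-p maltsev ¬maj
  K₁ : ℕ
  K₁ = 16 * (queryBound (suc (size S)) q * queryBound (suc (size S)) q)
  with-sizes : ¬ ∃ λ N → ∃ λ r → Lines.#lines (suc K₁) N ≡ 8 * suc r × m * d * Lines.L (suc K₁) N ≤ suc r
  with-sizes (N , r , #lines≡ , bound) = far-vector K₁ N r #lines≡ bound λ (w , few) →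
    let ts , isTester = tester (n K₁ N r #lines≡ bound) (I K₁ N r #lines≡ bound)
                          (_ , yes-satisfies K₁ N r #lines≡ bound w few zero (Vec.replicate _ 0))
    in untestable K₁ N r #lines≡ bound w few q (n≤1+n K₁) ts isTester

theorem1p1 : (S : Structure) →
    ((HasMajorityPolymorphism S × HasMaltsevPolymorphism S) →
    ConstantQueryTestableOneSided S)
    × (¬ (HasMajorityPolymorphism S × HasMaltsevPolymorphism S) →
    ¬ ConstantQueryTestable S)
theorem1p1 S =
  (λ (maj , malt) → majority+maltsev⇒testable S maj malt) ,
  λ ¬both testable → no-maltsev⇒untestable S
    (λ malt → no-majority⇒untestable S malt (λ maj → ¬both (maj , malt)) testable) testable
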